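{- Consider the restricted block compression of a string $S\in [0..\sigma)^n$ with measure $\delta$, where the functions $(\pi_k)_{k\ge 0}$ are chosen uniformly at random. Then, the expected size of the resulting RLSLP is $O(\delta\log\tfrac{n\log \sigma}{\delta \log n})$.
   Context: For a string $S$ and integer $k\ge0$, $d_k(S)$ is the number of distinct length-$k$ substrings of $S$; the measure is $\delta=\max\{d_k(S)/k:k\ge1\}$. An RLSLP (run-length straight-line program) is a context-free grammar generating a single string, with rules whose right-hand sides are sequences of terminals and earlier nonterminals, plus rules $A\to A_1^m$ ($m\ge2$); its size is the total size of its productions. Let $\Sigma=[0..\sigma)=\{0,\ldots,\sigma-1\}$ and $\mathcal{A}$ the least set with $\mathcal{A}=\Sigma\cup(\mathcal{A}\times\mathbb{Z}_{\ge2})\cup\bigcup_{i\ge2}\mathcal{A}^i$, with expansion $\mathrm{exp}(a)=a$ for $a\in\Sigma$, $\mathrm{exp}((A_1,\ldots,A_i))=\mathrm{exp}(A_1)\cdots\mathrm{exp}(A_i)$, $\mathrm{exp}((B,m))=\mathrm{exp}(B)^m$; each non-terminal $(A_1,\ldots,A_i)$ has production $\to A_1\cdots A_i$ and $(A,m)$ has production $\to A^m$. Restricted block compression of $S$: let $\ell_k=(4/3)^{\lceil k/2\rceil-1}$ and $\mathcal{A}_k=\{A\in\mathcal{A}:|\mathrm{exp}(A)|\le\ell_k\}$. Set $S_0=S$. For odd $k>0$, $S_k$ is obtained from $T=S_{k-1}$ by placing a block boundary between $T[i]$ and $T[i+1]$ whenever $T[i]\notin\mathcal{A}_k$, $T[i+1]\notin\mathcal{A}_k$,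 or $T[i]\ne T[i+1]$, and replacing each block $A^m$ with $m\ge2$ by the symbol $(A,m)$. For even $k>0$, with $\pi_k$ a bijection from the set of symbols occurring in $S_{k-1}$ to $[1..|\Sigma(S_{k-1})|]$ such that $\pi_k(A)<\pi_k(B)$ whenever $A\notin\mathcal{A}_k$ and $B\in\mathcal{A}_k$ (chosen uniformly at random among such bijections), $S_k$ is obtained from $T=S_{k-1}$ by placing a block boundary between $T[i]$ and $T[i+1]$ whenever $T[i]\notin\mathcal{A}_k$, $T[i+1]\notin\mathcal{A}_k$, or $i$ is a local minimum ($1<i<|T|$ and $\pi_k(T[i-1])>\pi_k(T[i])<\pi_k(T[i+1])$), and replacing each block $T[i..i+m)$ with $m\ge2$ by the symbol $(T[i],\ldots,T[i+m-1])$. The process continues while $|S_k|>1$; the resulting RLSLP consists of the productions of all symbols occurring in some $S_k$, with the single symbol of the last $S_k$ as start symbol. -}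

module Defs where

open import Data.Bool using (Bool; true; false; if_then_else_; _∧_; _∨_; not)
open import Data.Nat as ℕ using (ℕ; zero; suc; _+_; _*_; _∸_; _^_; _/_)
open import Data.Nat.Logarithm using (⌈log₂_⌉)
open import Data.Fin using (Fin; toℕ)
open import Data.Vec using (Vec; toList)
open import Data.List using (List; []; _∷_; length; map; foldr; take; drop; reverse; _++_; concatMap; applyUpTo; filterᵇ)
open import Data.Maybe using (Maybe; just; nothing)
open import Data.Integer using (+_)
open import Data.Rational as ℚ using (ℚ; 0ℚ; _⊔_)

data Sym : Set where
  term : ℕ → Sym
  pw   : Sym → ℕ → Sym        -- (A , m), m ≥ 2
  tup  : List Sym → Sym       -- (A₁ , … , Aᵢ), i ≥ 2

mutual
  symEq : Sym → Sym → Bool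
  symEq (term a) (term b) = a ℕ.≡ᵇ b
  symEq (pw A m) (pw B k) = symEq A B ∧ (m ℕ.≡ᵇ k)
  symEq (tup as) (tup bs) = listEq as bs
  symEq _ _ = false

  listEq : List Sym → List Sym → Bool
  listEq [] [] = true
  listEq (a ∷ as) (b ∷ bs) = symEq a b ∧ listEq as bs
  listEq _ _ = false

mutual
  expLen : Sym → ℕ
  expLen (term _) = 1
  expLen (pw A m) = m * expLen A
  expLen (tup as) = expLens as

  expLens : List Sym → ℕ
  expLens [] = 0
  expLens (a ∷ as) = expLen a + expLens as

-- A ∈ 𝒜_k  iff  |exp(A)| ≤ ℓ_k = (4/3)^(⌈k/2⌉-1); for k ≥ 1, ⌈k/2⌉-1 = ⌊(k-1)/2⌋.
-- Decided exactly in ℕ:  3^c · |exp(A)| ≤ 4^c.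
inA : ℕ → Sym → Bool
inA k A = (3 ^ c) * expLen A ℕ.≤ᵇ 4 ^ c
  where c = (k ∸ 1) / 2

-- Splitting a sequence into blocks, given the boundary flags
-- (flag i = true  iff there is a boundary between T[i] and T[i+1]).

splitBlocks : List Sym → List Bool → List (List Sym)
splitBlocks [] _ = []
splitBlocks (x ∷ xs) bs = go (x ∷ []) xs bs
  where
  go : List Sym → List Sym → List Bool → List (List Sym)
  go acc (y ∷ ys) (true ∷ cs)  = reverse acc ∷ go (y ∷ []) ys cs
  go acc (y ∷ ys) (false ∷ cs) = go (y ∷ acc) ys cs
  go acc _ _ = reverse acc ∷ []

oddFlags : ℕ → List Sym → List Bool
oddFlags k (x ∷ y ∷ rest) =
  (not (inA k x) ∨ not (inA k y) ∨ not (symEq x y)) ∷ oddFlags k (y ∷ rest)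
oddFlags k _ = []

oddBlock : List Sym → List Sym
oddBlock [] = []
oddBlock (x ∷ []) = x ∷ []
oddBlock (x ∷ xs) = pw x (length (x ∷ xs)) ∷ []

oddStep : ℕ → List Sym → List Sym
oddStep k T = concatMap oddBlock (splitBlocks T (oddFlags k T))

-- Even levels, for a ranking π (π(A) = position of A in an ordering, from 1).
-- Boundary iff T[i] ∉ 𝒜_k, T[i+1] ∉ 𝒜_k, or i is a local minimum
-- (1 < i < |T| and π(T[i-1]) > π(T[i]) < π(T[i+1])).
evenFlags : ℕ → (Sym → ℕ) → Maybe Sym → List Sym → List Bool
evenFlags k π prev (x ∷ y ∷ rest) =
  (not (inA k x) ∨ not (inA k y) ∨ locmin prev) ∷ evenFlags k π (just x) (y ∷ rest)
  where
  locmin : Maybe Sym → Bool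
  locmin nothing  = false
  locmin (just p) = (π x ℕ.<ᵇ π p) ∧ (π x ℕ.<ᵇ π y)
evenFlags k π prev _ = []

evenBlock : List Sym → List Sym
evenBlock [] = []
evenBlock (x ∷ []) = x ∷ []
evenBlock (x ∷ xs) = tup (x ∷ xs) ∷ []

evenStep : ℕ → (Sym → ℕ) → List Sym → List Sym
evenStep k π T = concatMap evenBlock (splitBlocks T (evenFlags k π nothing T))

elemB : Sym → List Sym → Bool
elemB x [] = false
elemB x (y ∷ ys) = symEq x y ∨ elemB x ys

dedup : List Sym → List Sym
dedup [] = []
dedup (x ∷ xs) = if elemB x xs then dedup xs else x ∷ dedup xs

insertions : Sym → List Sym → List (List Sym)
insertions x [] = (x ∷ []) ∷ []
insertions x (y ∷ ys) = (x ∷ y ∷ ys) ∷ map (y ∷_) (insertions x ys)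

perms : List Sym → List (List Sym)
perms [] = [] ∷ []
perms (x ∷ xs) = concatMap (insertions x) (perms xs)

rank : List Sym → Sym → ℕ
rank [] x = 0
rank (y ∷ ys) x = if symEq x y then 1 else suc (rank ys x)

-- All admissible bijections π_k for the string T, as orderings: an ordering
-- of the distinct symbols of T in which every symbol ∉ 𝒜_k precedes every
-- symbol ∈ 𝒜_k.  These are in one-to-one correspondence with the admissible π_k.
admissibleOrders : ℕ → List Sym → List (List Sym)
admissibleOrders k T =
  concatMap (λ p → map (p ++_) (perms inSyms)) (perms outSyms)
  where
  ds      = dedup T
  outSyms = filterᵇ (λ A → not (inA k A)) ds
  inSyms  = filterᵇ (inA k) ds

-- Size of the RLSLP: sum over distinct non-terminals occurring in some S_k
-- of the size of their productions:  |A → A₁⋯Aᵢ| = i,  |A → B^m| = 2.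

prodSize : Sym → ℕ
prodSize (term _) = 0
prodSize (pw _ _) = 2
prodSize (tup as) = length as

grammarSize : List Sym → ℕ
grammarSize occ = foldr (λ A s → prodSize A + s) 0 (dedup occ)

fromℕ : ℕ → ℚ
fromℕ n = (+ n) ℚ./ 1

sumℚ : List ℚ → ℚ
sumℚ = foldr ℚ._+_ 0ℚ

mean : List ℚ → ℚ
mean [] = 0ℚ
mean (x ∷ xs) = sumℚ (x ∷ xs) ℚ.* ((+ 1) ℚ./ suc (length xs))

-- Expected final grammar size.  Arguments: fuel, current level k (S_k is being
-- produced from T = S_{k-1}), T, symbols occurring so far.  At even levels the
-- expectation is the uniform average over all admissible π_k (independently
-- at each level).  The process stops when |T| ≤ 1.
expSize : ℕ → ℕ → List Sym → List Sym → ℚ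
expSize zero k T occ = fromℕ (grammarSize occ)   -- never reached
expSize (suc f) k T occ with 2 ℕ.≤ᵇ length T
... | false = fromℕ (grammarSize occ)
... | true with k ℕ.% 2
...   | 1 = let T' = oddStep k T in expSize f (suc k) T' (T' ++ occ)
...   | _ = mean (map (λ o → let T' = evenStep k (rank o) T
                                 in expSize f (suc k) T' (T' ++ occ))
                      (admissibleOrders k T))

-- Expected size of the RLSLP produced by restricted block compression of S.
-- Fuel 10n+10 levels exceeds the number of levels ever needed.
expectedRLSLPSize : ∀ {σ n} → Vec (Fin σ) n → ℚ
expectedRLSLPSize {σ} {n} S = expSize (10 * n + 10) 1 S₀ S₀
  where S₀ = map (λ a → term (toℕ a)) (toList S)

substrings : ℕ → List ℕ → List (List ℕ)
substrings k s = applyUpTo (λ i → take k (drop i s)) (suc (length s ∸ k))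

dedupℕs : List (List ℕ) → List (List ℕ)
dedupℕs [] = []
dedupℕs (x ∷ xs) = if any x xs then dedupℕs xs else x ∷ dedupℕs xs
  where
  eqL : List ℕ → List ℕ → Bool
  eqL [] [] = true
  eqL (a ∷ as) (b ∷ bs) = (a ℕ.≡ᵇ b) ∧ eqL as bs
  eqL _ _ = false
  any : List ℕ → List (List ℕ) → Bool
  any x [] = false
  any x (y ∷ ys) = eqL x y ∨ any x ys

dk : ℕ → List ℕ → ℕ
dk k s = if length s ℕ.<ᵇ k then 0 else length (dedupℕs (substrings k s))

-- δ(S) = max_{k ≥ 1} d_k(S)/k ; terms with k > |S| are 0, so k ranges over 1..|S|.
δ : ∀ {σ n} → Vec (Fin σ) n → ℚ
δ {σ} {n} S = foldr _⊔_ 0ℚ (applyUpTo (λ i → fromℕ (dk (suc i) s) ℚ.* ((+ 1) ℚ./ suc i)) n)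
  where s = map toℕ (toList S)

module Submission where

-- Let T be one of the strings S_{k-1}, and call a symbol short if its length is at most ℓ = ℓ_k.
-- A window, that is r consecutive short symbols of T, is determined by a context of length O(r ℓ)
-- in S.  Moreover, T has only O(r) boundaries among O(r ℓ) positions, because a short symbol that
-- stays a block of its own has a long neighbour.  Double counting the pairs of a distinct substring
-- of length M = O(r ℓ) of S and an offset at which it contains a window shows that T has O(r δ)
-- distinct windows.
--
-- At an even level a window lies inside a block only if it has no local minimum, so that one of its
-- halves is monotone; for a random π this has probability 2^{-Ω(r)}.  Hence the tuples created at
-- one level have expected total size O(δ).  A run (A, m) is charged to the first level at which it is
-- short, where it is a window with r = 1.
--
-- It remains to limit the number of levels.  Once ℓ ≥ n / δ there are O(δ) symbols left, and every
-- further production is paid for by the decrease of |T|.  At levels with ℓ ≤ Λ = Θ(log n / log σ),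
-- blocks of length at most Λ are counted by the strings of that length, and the longer ones have
-- r > Λ / ℓ, which makes the expected sizes sum geometrically to O(δ).  Only O(t + 1) levels lie in
-- between when n log σ ≤ 2^t δ log n.

open import Defs
open import Data.Bool using (Bool; true; false; if_then_else_; _∧_; _∨_; not)
open import Data.Bool.Properties as Boolₚ using (∧-conicalˡ; ∧-conicalʳ; ∨-zeroʳ; T-≡)
open import Data.Nat
open import Data.Nat.Properties
open import Data.Nat.DivMod using (m/n≤m; m*n/n≡m; m/n*n≤m; m≡m%n+[m/n]*n; m%n<n; /-mono-≤; [m+kn]%n≡m%n; +-distrib-/-∣ʳ)
open import Data.Nat.Divisibility using (divides)
open import Data.Nat.Tactic.RingSolver using (solve-∀)
open import Data.Nat.Logarithm using (⌈log₂_⌉; ⌈log₂⌉-mono-≤; ⌈log₂2^n⌉≡n; ⌈log₂⌈n/2⌉⌉≡⌈log₂n⌉∸1)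
open import Data.Nat.Induction using (<-rec)
open import Data.Empty using (⊥; ⊥-elim)
open import Data.Unit using (⊤; tt)
open import Data.Fin as Fin using (Fin; toℕ)
open import Data.Fin.Properties as Finₚ using (toℕ<n)
open import Data.List using (List; []; _∷_; _∷ʳ_; length; map; foldr; take; drop; reverse; _++_; concatMap; applyUpTo; filterᵇ; filter; replicate; concat; downFrom; deduplicate; initLast; _∷ʳ′_; mapMaybe; InitLast)
open import Data.List.Properties
open import Data.List.Membership.Propositional using (_∈_; _∉_; find; lose)
open import Data.List.Membership.Propositional.Properties
open import Data.List.Relation.Unary.All as All using (All; []; _∷_)
import Data.List.Relation.Unary.All.Properties as Allₚ
open import Data.List.Relation.Unary.Any as Any using (here; there)
open import Data.List.Relation.Unary.Unique.Propositional using (Unique; []; _∷_)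
import Data.List.Relation.Unary.Unique.Propositional.Properties as Uniqueₚ
open import Data.List.Relation.Unary.Unique.DecPropositional.Properties using (deduplicate-!)
open import Data.Maybe as Maybe using (Maybe; just; nothing)
open import Data.Product using (∃; ∃₂; _×_; _,_; proj₁; proj₂)
open import Data.Sum using (_⊎_; inj₁; inj₂; [_,_]′)
open import Data.Vec using (Vec; toList)
open import Data.Vec.Properties using (length-toList)
open import Function using (_∘_; id; case_of_; Equivalence)
open import Relation.Nullary using (¬_; Dec; yes; no; ¬?; _×-dec_; contradiction)
open import Relation.Binary.PropositionalEquality
open import Data.List.Relation.Binary.Permutation.Propositional using (_↭_; ↭-refl; ↭-sym; ↭-trans; ↭-prep; refl; prep; swap) renaming (trans to transₚ)
open import Data.List.Relation.Binary.Permutation.Propositional.Properties using (shift; ∈-resp-↭; All-resp-↭)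
open import Data.List.Relation.Unary.AllPairs using (allPairs?)
import Data.Integer as ℤ
import Data.Integer.Properties as ℤₚ
open import Data.Rational as ℚ using (ℚ; 0ℚ; toℚᵘ) renaming (_≤_ to _≤ℚ_; _*_ to _*ℚ_; _+_ to _+ℚ_)
import Data.Rational.Properties as ℚₚ
open import Data.Rational.Unnormalised as ℚᵘ using (mkℚᵘ)
import Data.Rational.Unnormalised.Properties as ℚᵘₚ

-- Blocks and boundaries

-- Randomness is handled one level at a time. Every invariant of T holds for every admissible π, so
-- an even level needs only the average over its own π, with T arbitrary, and no joint distribution
-- occurs. Ranking long symbols below short ones lets a boundary screen off everything to its left.
-- This is why the parse of a window depends on a bounded context only. Counting levels by t meets
-- an obstacle. The levels with ℓ ≤ Λ cost about σ^Λ, which is O(√n) for the chosen Λ, and this is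
-- O(δ) only if δ is large enough. For smaller δ the premise on t forces 4^t to be at least of the
-- order of log n. Then O(t + 1) levels lead all the way from ℓ = 1 to ℓ ≥ n / δ, and no low levels
-- are set apart. Powers of 4/3 are cleared of denominators throughout: 3^c · x ≤ a · 4^c stands for
-- x ≤ a (4/3)^c.

true≢false : ∀ {b : Bool} → b ≡ true → b ≡ false → ⊥
true≢false refl ()

≡ᵇ-sound : ∀ m n → (m ≡ᵇ n) ≡ true → m ≡ n
≡ᵇ-sound m n e = ≡ᵇ⇒≡ m n (Equivalence.from T-≡ e)

≡ᵇ-refl : ∀ n → (n ≡ᵇ n) ≡ true
≡ᵇ-refl n = Equivalence.to T-≡ (≡⇒≡ᵇ n n refl)

<ᵇ-sound : ∀ m n → (m <ᵇ n) ≡ true → m < n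
<ᵇ-sound m n e = <ᵇ⇒< m n (Equivalence.from T-≡ e)

<ᵇ-complete : ∀ {m n} → m < n → (m <ᵇ n) ≡ true
<ᵇ-complete p = Equivalence.to T-≡ (<⇒<ᵇ p)

≤ᵇ-sound : ∀ m n → (m ≤ᵇ n) ≡ true → m ≤ n
≤ᵇ-sound m n e = ≤ᵇ⇒≤ m n (Equivalence.from T-≡ e)

≤ᵇ-complete : ∀ {m n} → m ≤ n → (m ≤ᵇ n) ≡ true
≤ᵇ-complete p = Equivalence.to T-≡ (≤⇒≤ᵇ p)

≮⇒<ᵇ-false : ∀ {m n} → ¬ m < n → (m <ᵇ n) ≡ false
≮⇒<ᵇ-false {m} {n} q with m <ᵇ n in e
... | true = contradiction (<ᵇ-sound m n e) q
... | false = refl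

<ᵇ-false⇒≥ : ∀ m n → (m <ᵇ n) ≡ false → n ≤ m
<ᵇ-false⇒≥ m n e = ≮⇒≥ (λ p → true≢false (<ᵇ-complete p) e)

mutual
  symEq-sound : ∀ x y → symEq x y ≡ true → x ≡ y
  symEq-sound (term a) (term b) e = cong term (≡ᵇ-sound a b e)
  symEq-sound (pw A m) (pw B k) e =
    cong₂ pw (symEq-sound A B (∧-conicalˡ _ _ e)) (≡ᵇ-sound m k (∧-conicalʳ (symEq A B) _ e))
  symEq-sound (tup as) (tup bs) e = cong tup (listEq-sound as bs e)

  listEq-sound : ∀ as bs → listEq as bs ≡ true → as ≡ bs
  listEq-sound [] [] e = refl
  listEq-sound (a ∷ as) (b ∷ bs) e =
    cong₂ _∷_ (symEq-sound a b (∧-conicalˡ _ _ e)) (listEq-sound as bs (∧-conicalʳ (symEq a b) _ e))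

mutual
  symEq-refl : ∀ x → symEq x x ≡ true
  symEq-refl (term a) = ≡ᵇ-refl a
  symEq-refl (pw A m) rewrite symEq-refl A = ≡ᵇ-refl m
  symEq-refl (tup as) = listEq-refl as

  listEq-refl : ∀ as → listEq as as ≡ true
  listEq-refl [] = refl
  listEq-refl (a ∷ as) rewrite symEq-refl a = listEq-refl as

symEq-≢ : ∀ {x y} → x ≢ y → symEq x y ≡ false
symEq-≢ {x} {y} x≢y with symEq x y in e
... | true = contradiction (symEq-sound x y e) x≢y
... | false = refl

infix 4 _≟ₛ_
_≟ₛ_ : (x y : Sym) → Dec (x ≡ y)
x ≟ₛ y with symEq x y in e
... | true = yes (symEq-sound x y e)
... | false = no λ { refl → true≢false (symEq-refl x) e }

mutual
  flat : Sym → List ℕ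
  flat (term a) = a ∷ []
  flat (pw A m) = concat (replicate m (flat A))
  flat (tup as) = flats as

  flats : List Sym → List ℕ
  flats [] = []
  flats (a ∷ as) = flat a ++ flats as

length-concat-replicate : ∀ m (xs : List ℕ) → length (concat (replicate m xs)) ≡ m * length xs
length-concat-replicate zero xs = refl
length-concat-replicate (suc m) xs =
  trans (length-++ xs) (cong (length xs +_) (length-concat-replicate m xs))

mutual
  length-flat : ∀ x → length (flat x) ≡ expLen x
  length-flat (term _) = refl
  length-flat (pw A m) =
    trans (length-concat-replicate m (flat A)) (cong (m *_) (length-flat A))
  length-flat (tup as) = length-flats as

  length-flats : ∀ as → length (flats as) ≡ expLens as
  length-flats [] = refl
  length-flats (a ∷ as) = trans (length-++ (flat a)) (cong₂ _+_ (length-flat a) (length-flats as))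

flats-++ : ∀ U V → flats (U ++ V) ≡ flats U ++ flats V
flats-++ [] V = refl
flats-++ (x ∷ U) V = trans (cong (flat x ++_) (flats-++ U V)) (sym (++-assoc (flat x) _ _))

expLens-++ : ∀ U V → expLens (U ++ V) ≡ expLens U + expLens V
expLens-++ [] V = refl
expLens-++ (x ∷ U) V = trans (cong (expLen x +_) (expLens-++ U V)) (sym (+-assoc (expLen x) _ _))

expLens-∷ʳ : ∀ U y → expLens (U ∷ʳ y) ≡ expLens U + expLen y
expLens-∷ʳ U y = trans (expLens-++ U (y ∷ [])) (cong (expLens U +_) (+-identityʳ _))

Positive : List Sym → Set
Positive = All (λ x → 1 ≤ expLen x)

length≤expLens : ∀ {w} → Positive w → length w ≤ expLens w
length≤expLens [] = z≤n
length≤expLens (p ∷ ps) = +-mono-≤ p (length≤expLens ps)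

prefix-unique : ∀ U {V} U' {V'} → Positive (U ++ V) → U ++ V ≡ U' ++ V' →
  expLens U ≡ expLens U' → U ≡ U' × V ≡ V'
prefix-unique [] [] pos e l = refl , e
prefix-unique [] (x ∷ U') pos refl l =
  contradiction (≤-trans (All.head pos) (m≤m+n _ _)) (<⇒≱ (s≤s (≤-reflexive (sym l))))
prefix-unique (x ∷ U) [] {V'} pos refl l =
  contradiction (≤-trans (All.head pos) (m≤m+n _ _)) (<⇒≱ (s≤s (≤-reflexive l)))
prefix-unique (x ∷ U) (y ∷ U') (_ ∷ pos) e l with ∷-injective e
... | refl , e' with prefix-unique U U' pos e' (+-cancelˡ-≡ (expLen x) _ _ l)
...   | refl , q = refl , q

-- The first argument is the predecessor of the two symbols, `nothing` at the start of the string,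
-- where no local minimum can lie. One type serves both parities of the level.
Rule : Set
Rule = Maybe Sym → Sym → Sym → Bool

flags : Rule → Maybe Sym → List Sym → List Bool
flags b p (x ∷ y ∷ rest) = b p x y ∷ flags b (just x) (y ∷ rest)
flags b p _ = []

glue : Bool → Sym → List (List Sym) → List (List Sym)
glue false x (B ∷ Bs) = (x ∷ B) ∷ Bs
glue _ x Bs = (x ∷ []) ∷ Bs

-- Recursion on the string replaces the flag list and the accumulator of `splitBlocks`, so that
-- inductions can follow the symbols.
blks : Rule → Maybe Sym → List Sym → List (List Sym)
blks b p [] = []
blks b p (x ∷ []) = (x ∷ []) ∷ []
blks b p (x ∷ y ∷ ys) = glue (b p x y) x (blks b (just x) (y ∷ ys))

blks-∷ : ∀ b p x xs → ∃₂ λ B Bs → blks b p (x ∷ xs) ≡ (x ∷ B) ∷ Bs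
blks-∷ b p x [] = _ , _ , refl
blks-∷ b p x (y ∷ ys) with b p x y | blks-∷ b (just x) y ys
... | true | B , Bs , e = _ , _ , refl
... | false | B , Bs , e rewrite e = _ , _ , refl

-- The local helper of splitBlocks cannot be named from outside; unification recovers it.
mutual
  collect : List Sym → Sym → List Sym → List Bool → List (List Sym)
  collect = _

  splitBlocks-generalise : ∀ x xs bs (P : List Sym → List (List Sym) → Set) →
    (∀ a → P a (collect a x xs bs)) → P (x ∷ []) (splitBlocks (x ∷ xs) bs)
  splitBlocks-generalise x xs bs P h with List._∷_ x List.[]
  ... | a = h a

prependRev : List Sym → List (List Sym) → List (List Sym)
prependRev acc [] = []
prependRev acc (B ∷ Bs) = (reverse acc ++ B) ∷ Bs

collect-flags : ∀ b p z acc x xs →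
  collect (x ∷ acc) z xs (flags b p (x ∷ xs)) ≡ prependRev acc (blks b p (x ∷ xs))
collect-flags b p z acc x [] = cong (_∷ []) (unfold-reverse x acc)
collect-flags b p z acc x (y ∷ ys) with b p x y
... | true = cong₂ _∷_ (unfold-reverse x acc)
        (trans (collect-flags b (just x) z [] y ys) (strip (blks b (just x) (y ∷ ys))))
  where
  strip : ∀ Bs → prependRev [] Bs ≡ Bs
  strip [] = refl
  strip (_ ∷ _) = refl
... | false with blks b (just x) (y ∷ ys) | blks-∷ b (just x) y ys | collect-flags b (just x) z (x ∷ acc) y ys
...   | .((y ∷ B) ∷ Bs) | B , Bs , refl | ih = trans ih (cong (_∷ Bs)
        (trans (cong (_++ y ∷ B) (unfold-reverse x acc)) (++-assoc (reverse acc) (x ∷ []) (y ∷ B))))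

splitBlocks-flags : ∀ b p T → splitBlocks T (flags b p T) ≡ blks b p T
splitBlocks-flags b p [] = refl
splitBlocks-flags b p (x ∷ xs) = trans (collect-flags b p x [] x xs) (stripped (blks-∷ b p x xs))
  where
  stripped : ∀ {Bs} → (∃₂ λ B Cs → Bs ≡ (x ∷ B) ∷ Cs) → prependRev [] Bs ≡ Bs
  stripped (_ , _ , refl) = refl

-- The boundary between U and V inside U ++ V; both ends of the string count as boundaries.
cutAt : Rule → Maybe Sym → List Sym → List Sym → Bool
cutAt b p [] V = true
cutAt b p (x ∷ []) [] = true
cutAt b p (x ∷ []) (y ∷ V) = b p x y
cutAt b p (x ∷ x' ∷ U) V = cutAt b (just x) (x' ∷ U) V

lastOr : Maybe Sym → List Sym → Maybe Sym
lastOr p [] = p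
lastOr p (x ∷ U) = lastOr (just x) U

lastOr-∷ʳ : ∀ p U y → lastOr p (U ∷ʳ y) ≡ just y
lastOr-∷ʳ p [] y = refl
lastOr-∷ʳ p (x ∷ U) y = lastOr-∷ʳ (just x) U y

cutAt-∷ʳ : ∀ b p U y x V → cutAt b p (U ∷ʳ y) (x ∷ V) ≡ b (lastOr p U) y x
cutAt-∷ʳ b p [] y x V = refl
cutAt-∷ʳ b p (u ∷ []) y x V = refl
cutAt-∷ʳ b p (u ∷ u' ∷ U) y x V = cutAt-∷ʳ b (just u) (u' ∷ U) y x V

cutAt-[] : ∀ b p U → cutAt b p U [] ≡ true
cutAt-[] b p [] = refl
cutAt-[] b p (x ∷ []) = refl
cutAt-[] b p (x ∷ y ∷ U) = cutAt-[] b (just x) (y ∷ U)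

cutAt-head : ∀ b p U x V V' → cutAt b p U (x ∷ V) ≡ cutAt b p U (x ∷ V')
cutAt-head b p [] x V V' = refl
cutAt-head b p (u ∷ []) x V V' = refl
cutAt-head b p (u ∷ u' ∷ U) x V V' = cutAt-head b (just u) (u' ∷ U) x V V'

blks-++ : ∀ b p U V → cutAt b p U V ≡ true →
  blks b p (U ++ V) ≡ blks b p U ++ blks b (lastOr p U) V
blks-++ b p [] V c = refl
blks-++ b p (x ∷ []) [] c = refl
blks-++ b p (x ∷ []) (y ∷ V) c rewrite c = refl
blks-++ b p (x ∷ x' ∷ U) V c
  with blks b (just x) (x' ∷ U) | blks-∷ b (just x) x' U | blks-++ b (just x) (x' ∷ U) V c
... | .((x' ∷ B) ∷ Bs) | B , Bs , refl | ih rewrite ih with b p x x'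
...   | true = refl
...   | false = refl

blks-split : ∀ b p W Bs Cs → blks b p W ≡ Bs ++ Cs → ∃₂ λ U V →
  W ≡ U ++ V × cutAt b p U V ≡ true × blks b p U ≡ Bs × blks b (lastOr p U) V ≡ Cs
blks-split b p W [] Cs e = [] , W , refl , refl , refl , e
blks-split b p (x ∷ []) (B ∷ []) [] e = x ∷ [] , [] , refl , refl , e , refl
blks-split b p (x ∷ y ∷ ys) (B ∷ Bs) Cs e =
  extend (λ Ds → blks-split b (just x) (y ∷ ys) Ds Cs) (b p x y) refl e
  where
  Split : List (List Sym) → Set
  Split Ds = ∃₂ λ U V → y ∷ ys ≡ U ++ V × cutAt b (just x) U V ≡ true ×
    blks b (just x) U ≡ Ds × blks b (lastOr (just x) U) V ≡ Cs

  reglue : ∀ {d U} → b p x y ≡ d →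
    glue (b p x y) x (blks b (just x) U) ≡ glue d x (blks b (just x) U)
  reglue refl = refl

  cons-true : b p x y ≡ true → Split Bs → ∃₂ λ U V → x ∷ y ∷ ys ≡ U ++ V × cutAt b p U V ≡ true ×
    blks b p U ≡ (x ∷ []) ∷ Bs × blks b (lastOr p U) V ≡ Cs
  cons-true c ([] , V , refl , cut , f , g) = x ∷ [] , V , refl , c , cong ((x ∷ []) ∷_) f , g
  cons-true c (.y ∷ U , V , refl , cut , f , g) =
    x ∷ y ∷ U , V , refl , cut , trans (reglue {U = y ∷ U} c) (cong ((x ∷ []) ∷_) f) , g

  cons-false : b p x y ≡ false → ∀ D → Split (D ∷ Bs) → ∃₂ λ U V → x ∷ y ∷ ys ≡ U ++ V ×
    cutAt b p U V ≡ true × blks b p U ≡ (x ∷ D) ∷ Bs × blks b (lastOr p U) V ≡ Cs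
  cons-false c D (.y ∷ U , V , refl , cut , f , g) =
    x ∷ y ∷ U , V , refl , cut , trans (reglue {U = y ∷ U} c) (cong (glue false x) f) , g

  extend : (∀ Ds → blks b (just x) (y ∷ ys) ≡ Ds ++ Cs → Split Ds) → ∀ d → b p x y ≡ d → glue d x (blks b (just x) (y ∷ ys)) ≡ (B ∷ Bs) ++ Cs →
    ∃₂ λ U V → x ∷ y ∷ ys ≡ U ++ V × cutAt b p U V ≡ true ×
    blks b p U ≡ B ∷ Bs × blks b (lastOr p U) V ≡ Cs
  extend ih true c e with ∷-injective e
  ... | refl , e' = cons-true c (ih Bs e')
  extend ih false c e with blks-∷ b (just x) y ys
  ... | D , Ds , q with ∷-injective (trans (cong (glue false x) (sym q)) e)
  ...   | refl , e' = cons-false c (y ∷ D)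
            (ih ((y ∷ D) ∷ Bs) (trans q (cong ((y ∷ D) ∷_) e')))

-- Locality of block decompositions

-- What makes blocks local, with `inn` for membership in 𝒜_k. By `out-p` a long predecessor acts
-- like none; by `after-cut` the symbols behind a boundary are parsed as if the string began there.
-- Q restricts to the symbols of T, the only ones whose ranks are controlled.
record Laws (b : Rule) (inn : Sym → Bool) (Q : Sym → Set) : Set where
  field
    out-l     : ∀ {p x y} → inn x ≡ false → b p x y ≡ true
    out-r     : ∀ {p x y} → inn y ≡ false → b p x y ≡ true
    out-p     : ∀ {z x y} → Q z → Q x → inn z ≡ false → b (just z) x y ≡ b nothing x y
    after-cut : ∀ {p y x v} → Q y → Q x → b p y x ≡ true → b (just y) x v ≡ b nothing x v

At : List Sym → ℕ → List Sym → Set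
At T q w = ∃₂ λ U V → T ≡ U ++ w ++ V × expLens U ≡ q

-- Positions count letters of S. For two occurrences p and p' of a factor of length L, α is the
-- context on either side beyond which T parses both in the same way.
Transfer : ℕ → List Sym → ℕ → ℕ → ℕ → Set
Transfer α T p p' L = ∀ x w → α ≤ x → x + expLens w + α ≤ L → At T (p + x) w → At T (p' + x) w

-- Symbols are compared as trees, so one expansion could a priori have several parses. Excluding
-- this gives the distinctness of neighbours after an odd level and the count of windows by their
-- strings.
Canon : List Sym → Set
Canon T = ∀ U w V U' w' V' → T ≡ U ++ w ++ V → T ≡ U' ++ w' ++ V' → flats w ≡ flats w' → w ≡ w'

map-split : ∀ {A B : Set} (f : A → B) xs ys zs → map f xs ≡ ys ++ zs →
  ∃₂ λ us vs → xs ≡ us ++ vs × map f us ≡ ys × map f vs ≡ zs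
map-split f xs [] zs e = [] , xs , refl , refl , e
map-split f (x ∷ xs) (y ∷ ys) zs e with ∷-injective e
... | refl , e' with map-split f xs ys zs e'
...   | us , vs , refl , refl , g = x ∷ us , vs , refl , refl , g

lastOr-nothing : ∀ U z → lastOr nothing U ≡ just z → ∃ λ U₀ → U ≡ U₀ ∷ʳ z
lastOr-nothing U z e with initLast U
lastOr-nothing .(U₀ ∷ʳ y) z e | U₀ ∷ʳ′ y with trans (sym (lastOr-∷ʳ nothing U₀ y)) e
... | refl = U₀ , refl

module Local {b inn Q} (laws : Laws b inn Q) (T : List Sym) (allQ : All Q T) (positive : Positive T) where
  open Laws laws

  cut : List Sym → List Sym → Bool
  cut = cutAt b nothing

  blocks : List Sym → List (List Sym)
  blocks = blks b nothing

  Q-left : ∀ U {V} → T ≡ U ++ V → All Q U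
  Q-left U e = Allₚ.++⁻ˡ U (subst (All Q) e allQ)

  Q-right : ∀ U {V} → T ≡ U ++ V → All Q V
  Q-right U e = Allₚ.++⁻ʳ U (subst (All Q) e allQ)

  blks-after-cut : ∀ U V → All Q U → All Q V → cut U V ≡ true → blks b (lastOr nothing U) V ≡ blocks V
  blks-after-cut U [] qU qV c = refl
  blks-after-cut U (x ∷ []) qU qV c = refl
  blks-after-cut U (x ∷ v ∷ V) qU (qx ∷ _) c with initLast U
  ... | [] = refl
  ... | U₀ ∷ʳ′ y rewrite lastOr-∷ʳ nothing U₀ y =
    cong (λ d → glue d x (blks b (just x) (v ∷ V)))
      (after-cut (All.lookup qU (∈-++⁺ʳ U₀ (here refl))) qx (trans (sym (cutAt-∷ʳ b nothing U₀ y x _)) c))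

  blocks-++ : ∀ U V → T ≡ U ++ V → cut U V ≡ true → blocks T ≡ blocks U ++ blocks V
  blocks-++ U V refl c = trans (blks-++ b nothing U V c)
    (cong (blocks U ++_) (blks-after-cut U V (Q-left U refl) (Q-right U refl) c))

  blocks-split : ∀ W → All Q W → ∀ Bs Cs → blocks W ≡ Bs ++ Cs → ∃₂ λ U V →
    W ≡ U ++ V × cut U V ≡ true × blocks U ≡ Bs × blocks V ≡ Cs
  blocks-split W qW Bs Cs e with blks-split b nothing W Bs Cs e
  ... | U , V , refl , c , f , g =
    U , V , refl , c , f , trans (sym (blks-after-cut U V (Allₚ.++⁻ˡ U qW) (Allₚ.++⁻ʳ U qW) c)) g

  record Window (Bs Ds Cs : List (List Sym)) : Set where
    constructor window
    field
      before middle after : List Sym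
      decomposition : T ≡ before ++ middle ++ after
      cut-left  : cut before (middle ++ after) ≡ true
      cut-right : cut (before ++ middle) after ≡ true
      blocks-before : blocks before ≡ Bs
      blocks-middle : blocks middle ≡ Ds
      blocks-after  : blocks after ≡ Cs

  cut-extend : ∀ U w V → cut U w ≡ true → cut (U ++ w) V ≡ true → cut U (w ++ V) ≡ true
  cut-extend U [] V c c' rewrite ++-identityʳ U = c'
  cut-extend U (x ∷ w) V c c' = trans (cutAt-head b nothing U x (w ++ V) w) c

  blocks-window : ∀ Bs Ds Cs → blocks T ≡ Bs ++ Ds ++ Cs → Window Bs Ds Cs
  blocks-window Bs Ds Cs e with blocks-split T allQ (Bs ++ Ds) Cs (trans e (sym (++-assoc Bs Ds Cs)))
  ... | W , V , eT , c , f , g with blocks-split W (Q-left W eT) Bs Ds f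
  ...   | U , w , refl , c' , f' , g' =
    window U w V (trans eT (++-assoc U w V)) (cut-extend U w V c' c) c f' g' g

  blocks-fuse : ∀ U w V → T ≡ U ++ w ++ V → cut U (w ++ V) ≡ true → cut (U ++ w) V ≡ true →
    blocks T ≡ blocks U ++ blocks w ++ blocks V
  blocks-fuse U w V eT c c' = trans (blocks-++ (U ++ w) V eT' c')
    (trans (cong (_++ blocks V) fuse₁) (++-assoc (blocks U) _ _))
    where
    eT' : T ≡ (U ++ w) ++ V
    eT' = trans eT (sym (++-assoc U w V))
    cut-restrict : ∀ w → cut U (w ++ V) ≡ true → cut U w ≡ true
    cut-restrict [] _ = cutAt-[] b nothing U
    cut-restrict (x ∷ w) c = trans (cutAt-head b nothing U x w (w ++ V)) c
    fuse₁ : blocks (U ++ w) ≡ blocks U ++ blocks w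
    fuse₁ = trans (blks-++ b nothing U w (cut-restrict w c)) (cong (blocks U ++_)
      (blks-after-cut U w (Q-left U eT) (Allₚ.++⁻ˡ w (Q-right U eT)) (cut-restrict w c)))

  unique : ∀ U {V} U' {V'} → T ≡ U ++ V → T ≡ U' ++ V' → expLens U ≡ expLens U' → U ≡ U' × V ≡ V'
  unique U U' e e' l = prefix-unique U U' (subst Positive e positive) (trans (sym e) e') l

  module Neighbours (ℓ α : ℕ) (inn-≤ : ∀ {x} → inn x ≡ true → expLen x ≤ ℓ) (L : ℕ) where

    -- The symbol z ends at offset a, so it is itself a window of length at most ℓ and transfers;
    -- `unique` identifies the prefix found with A'.
    left-transfer : ∀ {p p' a} A {R} A' {R' z} → Transfer α T p p' L →
      T ≡ A ++ R → expLens A ≡ p + a → T ≡ A' ++ R' → expLens A' ≡ p' + a →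
      lastOr nothing A ≡ just z → inn z ≡ true → α + ℓ ≤ a → a + α ≤ L →
      lastOr nothing A' ≡ just z
    left-transfer {p} {p'} {a} A {R} A' {R'} {z} tr eT lA eT' lA' last inz m₁ m₂
      with lastOr-nothing A z last
    ... | A₀ , refl with tr (a ∸ expLen z) (z ∷ []) α≤ ≤L (A₀ , R , trans eT (∷ʳ-++ A₀ z R) , lA₀)
      where
      z≤a : expLen z ≤ a
      z≤a = ≤-trans (inn-≤ inz) (≤-trans (m≤n+m ℓ α) m₁)
      α≤ : α ≤ a ∸ expLen z
      α≤ = m+n≤o⇒m≤o∸n α (≤-trans (+-monoʳ-≤ α (inn-≤ inz)) m₁)
      ≤L : a ∸ expLen z + (expLen z + 0) + α ≤ L
      ≤L rewrite +-identityʳ (expLen z) | m∸n+n≡m z≤a = m₂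
      lA₀ : expLens A₀ ≡ p + (a ∸ expLen z)
      lA₀ = +-cancelʳ-≡ (expLen z) _ _ (trans (sym (expLens-∷ʳ A₀ z)) (trans lA
        (trans (cong (p +_) (sym (m∸n+n≡m z≤a))) (sym (+-assoc p _ _)))))
    ... | U , V , eU , lU with unique (U ∷ʳ z) A' (trans eU (sym (∷ʳ-++ U z V))) eT' lU'
      where
      z≤a : expLen z ≤ a
      z≤a = ≤-trans (inn-≤ inz) (≤-trans (m≤n+m ℓ α) m₁)
      lU' : expLens (U ∷ʳ z) ≡ expLens A'
      lU' = trans (expLens-∷ʳ U z) (trans (cong (_+ expLen z) lU) (trans (+-assoc p' _ _)
        (trans (cong (p' +_) (m∸n+n≡m z≤a)) (sym lA'))))
    ...   | refl , _ = lastOr-∷ʳ nothing U z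

    right-transfer : ∀ {p p' a} A {R} A' {R' x} → Transfer α T p p' L →
      T ≡ A ++ x ∷ R → expLens A ≡ p + a → T ≡ A' ++ R' → expLens A' ≡ p' + a →
      inn x ≡ true → α ≤ a → a + ℓ + α ≤ L → ∃ λ R₀ → R' ≡ x ∷ R₀
    right-transfer {a = a} A {R} A' {x = x} tr eT lA eT' lA' inx m₁ m₂
      with tr a (x ∷ []) m₁
             (≤-trans (+-monoˡ-≤ α (+-monoʳ-≤ a (≤-trans (≤-reflexive (+-identityʳ _)) (inn-≤ inx)))) m₂)
             (A , R , eT , lA)
    ... | U , V , eU , lU with unique U A' eU eT' (trans lU (sym lA'))
    ...   | _ , e = V , sym e

    inn-or-cut : ∀ {p x y} → b p x y ≡ false → inn x ≡ true × inn y ≡ true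
    inn-or-cut {p} {x} {y} f with inn x in ex | inn y in ey
    ... | true | true = refl , refl
    ... | false | _ = ⊥-elim (true≢false (out-l ex) f)
    ... | true | false = ⊥-elim (true≢false (out-r ey) f)

    -- A boundary depends only on neighbouring in-symbols, each of length at most ℓ: two to the left
    -- (none beyond an out-symbol) and one to the right.
    cut-transfer : ∀ {p p' a} U V U' V' → Transfer α T p p' L → Transfer α T p' p L →
      T ≡ U ++ V → expLens U ≡ p + a → T ≡ U' ++ V' → expLens U' ≡ p' + a →
      α + ℓ + ℓ ≤ a → a + ℓ + α ≤ L → cut U V ≡ true → cut U' V' ≡ true
    cut-transfer {p} {p'} {a} U V U' V' tr rt eT lU eT' lU' m₁ m₂ c with cut U' V' in c'
    ... | true = refl
    -- Without a boundary at U' | V' both adjacent symbols are in-symbols. These transfer back to U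
    -- | V, so the two places can differ only in the predecessor.
    ... | false with initLast U' | V'
    ...   | [] | _ = ⊥-elim (true≢false refl c')
    ...   | U₀' ∷ʳ′ y | [] = ⊥-elim (true≢false (cutAt-[] b nothing (U₀' ∷ʳ y)) c')
    ...   | U₀' ∷ʳ′ y | x ∷ W' with trans (sym (cutAt-∷ʳ b nothing U₀' y x W')) c'
    ...     | f with inn-or-cut f
    ...       | iny , inx
        with lastOr-nothing U y (left-transfer (U₀' ∷ʳ y) U rt eT' lU' eT lU (lastOr-∷ʳ nothing U₀' y) iny
               (≤-trans (m≤m+n _ ℓ) m₁) (≤-trans (+-monoˡ-≤ α (m≤m+n a ℓ)) m₂))
           | right-transfer (U₀' ∷ʳ y) U rt eT' lU' eT lU inx (≤-trans (m≤m+n α ℓ) (≤-trans (m≤m+n _ ℓ) m₁)) m₂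
    ...         | U₀ , refl | W , refl = ⊥-elim (clash (lastOr nothing U₀) (lastOr nothing U₀') refl refl)
      where
      cut-true : b (lastOr nothing U₀) y x ≡ true
      cut-true = trans (sym (cutAt-∷ʳ b nothing U₀ y x W)) c
      y≤a : expLen y ≤ a
      y≤a = ≤-trans (inn-≤ iny) (≤-trans (m≤n+m ℓ (α + ℓ)) m₁)
      shorten : ∀ {q} A → expLens (A ∷ʳ y) ≡ q + a → expLens A ≡ q + (a ∸ expLen y)
      shorten {q} A l = +-cancelʳ-≡ (expLen y) _ _ (trans (sym (expLens-∷ʳ A y)) (trans l
        (trans (cong (q +_) (sym (m∸n+n≡m y≤a))) (sym (+-assoc q _ _)))))
      low : α + ℓ ≤ a ∸ expLen y
      low = m+n≤o⇒m≤o∸n (α + ℓ) (≤-trans (+-monoʳ-≤ (α + ℓ) (inn-≤ iny)) m₁)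
      high : a ∸ expLen y + α ≤ L
      high = ≤-trans (+-monoˡ-≤ α (≤-trans (m∸n≤m a (expLen y)) (m≤m+n a ℓ))) m₂
      eA : T ≡ U₀ ++ y ∷ x ∷ W
      eA = trans eT (∷ʳ-++ U₀ y _)
      eA' : T ≡ U₀' ++ y ∷ x ∷ W'
      eA' = trans eT' (∷ʳ-++ U₀' y _)
      same : lastOr nothing U₀ ≡ lastOr nothing U₀' → ⊥
      same s = true≢false cut-true (trans (cong (λ q → b q y x) s) f)
      Qy : Q y
      Qy = All.head (Q-right U₀ eA)
      Q-last : ∀ A {R z} → T ≡ A ++ R → lastOr nothing A ≡ just z → Q z
      Q-last A {z = z} eq l with lastOr-nothing A z l
      ... | A₀ , refl = All.lookup (Q-left _ eq) (∈-++⁺ʳ A₀ (here refl))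
      forward : ∀ {z} → lastOr nothing U₀ ≡ just z → inn z ≡ true → ⊥
      forward l inz = same (trans l (sym (left-transfer U₀ U₀' tr eA (shorten U₀ lU) eA' (shorten U₀' lU') l inz low high)))
      backward : ∀ {z} → lastOr nothing U₀' ≡ just z → inn z ≡ true → ⊥
      backward l inz = same (trans (left-transfer U₀' U₀ rt eA' (shorten U₀' lU') eA (shorten U₀ lU) l inz low high) (sym l))
      ignore : ∀ A {R} q → T ≡ A ++ R → lastOr nothing A ≡ q →
        (∀ {z} → q ≡ just z → inn z ≡ true → ⊥) → b (lastOr nothing A) y x ≡ b nothing y x
      ignore A nothing eq l absent = cong (λ q → b q y x) l
      ignore A (just z) eq l absent with inn z in inz
      ... | true = ⊥-elim (absent refl inz)
      ... | false = trans (cong (λ q → b q y x) l) (out-p (Q-last A eq l) Qy inz)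
      -- A predecessor that is an in-symbol on one side transfers to the other and makes the two
      -- decisions equal, against `cut-true` and f. Otherwise both predecessors are long or absent,
      -- and the rule ignores them.
      clash : ∀ q q' → lastOr nothing U₀ ≡ q → lastOr nothing U₀' ≡ q' → ⊥
      clash q q' l l' = true≢false
        (trans (sym (trans (ignore U₀ q eA l (λ { refl → forward l }))
                           (sym (ignore U₀' q' eA' l' (λ { refl → backward l' })))))
               cut-true) f

  module Step (c : List Sym → Sym) (flat-c : ∀ U → flats (map c (blocks U)) ≡ flats U) where

    step : List Sym → List Sym
    step U = map c (blocks U)

    expLens-step : ∀ U → expLens (step U) ≡ expLens U
    expLens-step U = trans (sym (length-flats (step U))) (trans (cong length (flat-c U)) (length-flats U))

    step-window : ∀ U' w' V' → step T ≡ U' ++ w' ++ V' → ∃₂ λ Bs Ds → ∃ λ Cs →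
      Window Bs Ds Cs × map c Bs ≡ U' × map c Ds ≡ w' × map c Cs ≡ V'
    step-window U' w' V' e with map-split c (blocks T) U' (w' ++ V') e
    ... | Bs , Es , eB , f , g with map-split c Es w' V' g
    ...   | Ds , Cs , refl , f' , g' = Bs , Ds , Cs , blocks-window Bs Ds Cs eB , f , f' , g'

    -- A factor of the new string is the image of a window of T with boundaries at both ends, and
    -- its blocks are those of the window alone. Equal expansions therefore come from equal windows.
    canon-step : Canon T → Canon (step T)
    canon-step canon U₁ w₁ V₁ U₂ w₂ V₂ e₁ e₂ fl with step-window U₁ w₁ V₁ e₁ | step-window U₂ w₂ V₂ e₂
    ... | _ , _ , _ , window A₁ v₁ C₁ d₁ _ _ _ refl _ , _ , refl , _
        | _ , _ , _ , window A₂ v₂ C₂ d₂ _ _ _ refl _ , _ , refl , _ =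
      cong step (canon A₁ v₁ C₁ A₂ v₂ C₂ d₁ d₂ (trans (sym (flat-c v₁)) (trans fl (flat-c v₂))))

    step-positive : Positive (step T)
    step-positive = All.tabulate λ {x} x∈ → go x (∈-∃++ x∈)
      where
      go : ∀ x → (∃₂ λ U V → step T ≡ U ++ x ∷ V) → 1 ≤ expLen x
      go x (U , V , e) with step-window U (x ∷ []) V e
      ... | _ , _ , _ , window A (y ∷ v) C d _ _ _ refl _ , _ , q , _ =
        ≤-trans (All.head (Allₚ.++⁻ʳ A (subst Positive d positive)))
          (≤-trans (m≤m+n (expLen y) (expLens v))
            (≤-reflexive (trans (sym (expLens-step (y ∷ v))) (trans (cong expLens q) (+-identityʳ _)))))
      ... | _ , _ , _ , window A [] C d _ _ _ refl _ , _ , () , _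

    module _ (ℓ α : ℕ) (inn-≤ : ∀ {x} → inn x ≡ true → expLen x ≤ ℓ) where
      open Neighbours ℓ α inn-≤

      -- The preimage of the window moves by hypothesis and its two end boundaries by
      -- `cut-transfer`, whose two in-symbols on the left account for the increase of the context by
      -- 2 ℓ.
      step-transfer : ∀ {p p' L} → Transfer α T p p' L → Transfer α T p' p L →
        Transfer (α + ℓ + ℓ) (step T) p p' L
      step-transfer {p} {p'} {L} tr rt x w' m₁ m₂ (U' , V' , e , l) with step-window U' w' V' e
      ... | _ , _ , _ , window U w V d cl cr refl refl refl , refl , refl , refl
        with tr x w (≤-trans (≤-trans (m≤m+n α ℓ) (m≤m+n _ ℓ)) m₁)
               (≤-trans (+-mono-≤ (+-monoʳ-≤ x (≤-reflexive (sym (expLens-step w))))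
                 (≤-trans (m≤m+n α ℓ) (m≤m+n _ ℓ))) m₂)
               (U , V , d , trans (sym (expLens-step U)) l)
      ...   | X , Y , d' , lX =
        step X , step Y , fused , trans (expLens-step X) lX
        where
        w≡ : expLens (step w) ≡ expLens w
        w≡ = expLens-step w
        lU : expLens U ≡ p + x
        lU = trans (sym (expLens-step U)) l
        end : ∀ {q} A → expLens A ≡ q + x → expLens (A ++ w) ≡ q + (x + expLens w)
        end {q} A lA = trans (expLens-++ A w) (trans (cong (_+ expLens w) lA) (+-assoc q x _))
        room : x + expLens w + (ℓ + α) ≤ L
        room = ≤-trans (+-mono-≤ (+-monoʳ-≤ x (≤-reflexive (sym w≡)))
          (≤-trans (≤-reflexive (+-comm ℓ α)) (m≤m+n _ ℓ))) m₂
        room₂ : x + expLens w + ℓ + α ≤ L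
        room₂ = ≤-trans (≤-reflexive (+-assoc (x + expLens w) ℓ α)) room
        room₁ : x + ℓ + α ≤ L
        room₁ = ≤-trans (+-monoˡ-≤ α (+-monoˡ-≤ ℓ (m≤m+n x _))) room₂
        re : ∀ A B → A ++ w ++ B ≡ (A ++ w) ++ B
        re A B = sym (++-assoc A w B)
        fused : step T ≡ step X ++ step w ++ step Y
        fused = trans (cong (map c) (blocks-fuse X w Y d'
            (cut-transfer L U (w ++ V) X (w ++ Y) tr rt d lU d' lX m₁ room₁ cl)
            (cut-transfer L (U ++ w) V (X ++ w) Y tr rt (trans d (re U V)) (end U lU) (trans d' (re X Y)) (end X lX)
              (≤-trans m₁ (m≤m+n x _)) room₂ cr)))
          (trans (map-++ c (blocks X) _) (cong (step X ++_) (map-++ c (blocks w) _)))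

NonEmpty : List Sym → Set
NonEmpty B = B ≢ []

blks-nonEmpty : ∀ b p T → All NonEmpty (blks b p T)
blks-nonEmpty b p [] = []
blks-nonEmpty b p (x ∷ []) = (λ ()) ∷ []
blks-nonEmpty b p (x ∷ y ∷ ys) with b p x y | blks-nonEmpty b (just x) (y ∷ ys)
... | true | ih = (λ ()) ∷ ih
... | false | ih with blks b (just x) (y ∷ ys) | ih
...   | [] | _ = (λ ()) ∷ []
...   | B ∷ Bs | _ ∷ ne = (λ ()) ∷ ne

-- Runs and tuples as instances of block rules

oddRule : ℕ → Rule
oddRule k _ x y = not (inA k x) ∨ not (inA k y) ∨ not (symEq x y)

locMin : (Sym → ℕ) → Maybe Sym → Sym → Sym → Bool
locMin π nothing x y = false
locMin π (just p) x y = (π x <ᵇ π p) ∧ (π x <ᵇ π y)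

evenRule : ℕ → (Sym → ℕ) → Rule
evenRule k π p x y = not (inA k x) ∨ not (inA k y) ∨ locMin π p x y

oddFlags-flags : ∀ k p T → oddFlags k T ≡ flags (oddRule k) p T
oddFlags-flags k p [] = refl
oddFlags-flags k p (x ∷ []) = refl
oddFlags-flags k p (x ∷ y ∷ ys) = cong (_ ∷_) (oddFlags-flags k (just x) (y ∷ ys))

evenFlags-flags : ∀ k π p T → evenFlags k π p T ≡ flags (evenRule k π) p T
evenFlags-flags k π p [] = refl
evenFlags-flags k π p (x ∷ []) = refl
evenFlags-flags k π nothing (x ∷ y ∷ ys) = cong (_ ∷_) (evenFlags-flags k π (just x) (y ∷ ys))
evenFlags-flags k π (just p) (x ∷ y ∷ ys) = cong (_ ∷_) (evenFlags-flags k π (just x) (y ∷ ys))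

runSym : List Sym → Sym
runSym [] = term 0
runSym (x ∷ []) = x
runSym (x ∷ y ∷ ys) = pw x (length (x ∷ y ∷ ys))

tupleSym : List Sym → Sym
tupleSym [] = term 0
tupleSym (x ∷ []) = x
tupleSym (x ∷ y ∷ ys) = tup (x ∷ y ∷ ys)

concatMap-singletons : ∀ (f : List Sym → List Sym) (c : List Sym → Sym) →
  (∀ B → NonEmpty B → f B ≡ c B ∷ []) → ∀ Bs → All NonEmpty Bs → concatMap f Bs ≡ map c Bs
concatMap-singletons f c h [] [] = refl
concatMap-singletons f c h (B ∷ Bs) (ne ∷ nes) =
  cong₂ _++_ (h B ne) (concatMap-singletons f c h Bs nes)

oddStep-blks : ∀ k T → oddStep k T ≡ map runSym (blks (oddRule k) nothing T)
oddStep-blks k T = trans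
  (cong (concatMap oddBlock) (trans (cong (splitBlocks T) (oddFlags-flags k nothing T))
    (splitBlocks-flags (oddRule k) nothing T)))
  (concatMap-singletons oddBlock runSym oddBlock-runSym _ (blks-nonEmpty (oddRule k) nothing T))
  where
  oddBlock-runSym : ∀ B → NonEmpty B → oddBlock B ≡ runSym B ∷ []
  oddBlock-runSym [] ne = contradiction refl ne
  oddBlock-runSym (x ∷ []) ne = refl
  oddBlock-runSym (x ∷ y ∷ ys) ne = refl

evenStep-blks : ∀ k π T → evenStep k π T ≡ map tupleSym (blks (evenRule k π) nothing T)
evenStep-blks k π T = trans
  (cong (concatMap evenBlock) (trans (cong (splitBlocks T) (evenFlags-flags k π nothing T))
    (splitBlocks-flags (evenRule k π) nothing T)))
  (concatMap-singletons evenBlock tupleSym evenBlock-tupleSym _ (blks-nonEmpty (evenRule k π) nothing T))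
  where
  evenBlock-tupleSym : ∀ B → NonEmpty B → evenBlock B ≡ tupleSym B ∷ []
  evenBlock-tupleSym [] ne = contradiction refl ne
  evenBlock-tupleSym (x ∷ []) ne = refl
  evenBlock-tupleSym (x ∷ y ∷ ys) ne = refl

oddLaws : ∀ k {Q} → Laws (oddRule k) (inA k) Q
oddLaws k = record
  { out-l = λ { {x = x} e → out-left x e }
  ; out-r = λ { {x = x} e → out-right x e }
  ; out-p = λ _ _ _ → refl
  ; after-cut = λ _ _ _ → refl }
  where
  out-left : ∀ x {y} → inA k x ≡ false → oddRule k nothing x y ≡ true
  out-left x e rewrite e = refl
  out-right : ∀ x {y} → inA k y ≡ false → oddRule k nothing x y ≡ true
  out-right x e rewrite e = ∨-zeroʳ (not (inA k x))

OutsBelow : ℕ → (Sym → ℕ) → (Sym → Set) → Set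
OutsBelow k π Q = ∀ {z x} → Q z → Q x → inA k z ≡ false → inA k x ≡ true → π z < π x

locMin-big : ∀ π {z x y} → π z < π x → locMin π (just z) x y ≡ false
locMin-big π {z} {x} lt rewrite ≮⇒<ᵇ-false {π x} {π z} (<-asym lt) = refl

evenRule-in : ∀ k π {p x y} → inA k x ≡ true → inA k y ≡ true → evenRule k π p x y ≡ locMin π p x y
evenRule-in k π ex ey rewrite ex | ey = refl

locMin-next : ∀ π p {y x} → locMin π p y x ≡ true → π y < π x
locMin-next π (just z) {y} {x} e = <ᵇ-sound (π y) (π x) (∧-conicalʳ (π y <ᵇ π z) _ e)

-- For `after-cut`, a boundary between y and a short x arises either because y is long, hence of
-- smaller rank than x, or because y is a local minimum, hence again smaller. In neither case is x a
-- local minimum.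
evenLaws : ∀ k π {Q} → OutsBelow k π Q → Laws (evenRule k π) (inA k) Q
evenLaws k π {Q} below = record
  { out-l = λ {p} {x} {y} → out-left {p} {x} {y}
  ; out-r = λ {p} {x} {y} → out-right {p} {x} {y}
  ; out-p = ignore
  ; after-cut = λ {p} {y} {x} {v} → after {p} {y} {x} {v} }
  where
  out-left : ∀ {p x y} → inA k x ≡ false → evenRule k π p x y ≡ true
  out-left e rewrite e = refl
  out-right : ∀ {p x y} → inA k y ≡ false → evenRule k π p x y ≡ true
  out-right {x = x} e rewrite e = ∨-zeroʳ (not (inA k x))
  ignore : ∀ {z x y} → Q z → Q x → inA k z ≡ false → evenRule k π (just z) x y ≡ evenRule k π nothing x y
  ignore {z} {x} {y} qz qx ez with inA k x in ex | inA k y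
  ... | false | _ = refl
  ... | true | false = refl
  ... | true | true = locMin-big π (below qz qx ez ex)
  after : ∀ {p y x v} → Q y → Q x → evenRule k π p y x ≡ true →
    evenRule k π (just y) x v ≡ evenRule k π nothing x v
  after {p} {y} {x} {v} qy qx c with inA k x in ex | inA k v | inA k y in ey
  ... | false | _ | _ = refl
  ... | true | false | _ = refl
  ... | true | true | false = locMin-big π (below qy qx ey ex)
  ... | true | true | true = locMin-big π (locMin-next π p c)

flat-runs : ∀ k p U → flats (map runSym (blks (oddRule k) p U)) ≡ flats U
flat-runs k p [] = refl
flat-runs k p (x ∷ []) = refl
flat-runs k p (x ∷ y ∷ ys) with flat-runs k (just x) (y ∷ ys) | inA k x | inA k y | symEq x y in e
... | ih | false | _ | _ = cong (flat x ++_) ih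
... | ih | true | false | _ = cong (flat x ++_) ih
... | ih | true | true | false = cong (flat x ++_) ih
... | ih | true | true | true with symEq-sound x y e
...   | refl with blks (oddRule k) (just x) (x ∷ ys) | blks-∷ (oddRule k) (just x) x ys | ih
...     | .((x ∷ B) ∷ Bs) | B , Bs , refl | ih' = trans
          (trans (++-assoc (flat x) _ _) (cong (flat x ++_) (cong (_++ flats (map runSym Bs)) (run B))))
          (cong (flat x ++_) ih')
  where
  run : ∀ B → concat (replicate (length (x ∷ B)) (flat x)) ≡ flat (runSym (x ∷ B))
  run [] = ++-identityʳ (flat x)
  run (_ ∷ _) = refl

flat-tupleSym : ∀ x B → flat (tupleSym (x ∷ B)) ≡ flats (x ∷ B)
flat-tupleSym x [] = sym (++-identityʳ (flat x))
flat-tupleSym x (_ ∷ _) = refl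

flat-tuples : ∀ b p U → flats (map tupleSym (blks b p U)) ≡ flats U
flat-tuples b p [] = refl
flat-tuples b p (x ∷ []) = refl
flat-tuples b p (x ∷ y ∷ ys) with b p x y | flat-tuples b (just x) (y ∷ ys)
... | true | ih = cong (flat x ++_) ih
... | false | ih with blks b (just x) (y ∷ ys) | blks-∷ b (just x) y ys | ih
...   | .((y ∷ B) ∷ Bs) | B , Bs , refl | ih' = trans (++-assoc (flat x) _ _)
          (cong (flat x ++_) (trans (cong (_++ flats (map tupleSym Bs)) (sym (flat-tupleSym y B))) ih'))

noCut : Rule → Maybe Sym → List Sym → Bool
noCut b p (x ∷ y ∷ ys) = not (b p x y) ∧ noCut b (just x) (y ∷ ys)
noCut b p _ = true

blks-single : ∀ b p w {B} → blks b p w ≡ B ∷ [] → w ≡ B × noCut b p w ≡ true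
blks-single b p (x ∷ []) refl = refl , refl
blks-single b p (x ∷ y ∷ ys) e with b p x y | blks-single b (just x) (y ∷ ys)
... | true | _ with blks b (just x) (y ∷ ys) | blks-∷ b (just x) y ys
...   | .((y ∷ _) ∷ _) | _ , _ , refl = ⊥-elim (case ∷-injectiveʳ e of λ ())
blks-single b p (x ∷ y ∷ ys) e | false | single
  with blks b (just x) (y ∷ ys) | blks-∷ b (just x) y ys | single
... | .((y ∷ B) ∷ Bs) | B , Bs , refl | ih with ∷-injective e
...   | refl , refl with ih refl
...     | q , n = cong (x ∷_) q , n

oddRule-false : ∀ k p x y → oddRule k p x y ≡ false → x ≡ y × inA k x ≡ true × inA k y ≡ true
oddRule-false k p x y e with inA k x | inA k y | symEq x y in s
... | true | true | true = symEq-sound x y s , refl , refl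

noCut-run : ∀ k p x y ys → noCut (oddRule k) p (x ∷ y ∷ ys) ≡ true →
  All (λ z → z ≡ x × inA k z ≡ true) (x ∷ y ∷ ys)
noCut-run k p x y ys e with oddRule k p x y in r
... | false with oddRule-false k p x y r
...   | refl , ix , iy with ys
...     | [] = (refl , ix) ∷ (refl , iy) ∷ []
...     | z ∷ zs = (refl , ix) ∷ noCut-run k (just x) x z zs e

cutAt-run : ∀ k p x a U V → All (λ z → z ≡ a × inA k z ≡ true) (x ∷ U) → inA k a ≡ true →
  cutAt (oddRule k) p (x ∷ U) (a ∷ V) ≡ false
cutAt-run k p x a [] V ((refl , ix) ∷ []) ia rewrite ix | symEq-refl x = refl
cutAt-run k p x a (u ∷ U) V (_ ∷ h) ia = cutAt-run k (just x) u a U V h ia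

AdjacentDistinct : ℕ → List Sym → Set
AdjacentDistinct k T = ∀ U x y V → T ≡ U ++ x ∷ y ∷ V → inA k x ≡ true → inA k y ≡ true → x ≢ y

-- Two equal neighbours would have equal expansions, hence equal preimages by canonicity,
-- and there is no boundary between two copies of the same run.
oddStep-adjacentDistinct : ∀ k {T} → Positive T → Canon T → AdjacentDistinct k (oddStep k T)
oddStep-adjacentDistinct k {T} positive canon U' x .x V' e ix _ refl = impossible
  where
  open Local {Q = λ _ → ⊤} (oddLaws k) T (All.tabulate λ _ → tt) positive
  open Step runSym (flat-runs k nothing)
  clash : ∀ w {B} → blocks w ≡ B ∷ [] → runSym B ≡ x → cut w w ≡ true → ⊥
  clash (a ∷ []) refl refl c = true≢false c (cutAt-run k nothing a a [] [] ((refl , ix) ∷ []) ix)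
  clash (a ∷ a' ∷ w) eB q c
    with noCut-run k nothing a a' w (proj₂ (blks-single (oddRule k) nothing (a ∷ a' ∷ w) eB))
  ... | (h ∷ h') = true≢false c (cutAt-run k nothing a a (a' ∷ w) (a' ∷ w) (h ∷ h') (proj₂ h))
  impossible : ⊥
  impossible with step-window U' (x ∷ x ∷ []) V' (trans (sym (oddStep-blks k T)) e)
  ... | _ , B₁ ∷ B₂ ∷ [] , _ , window A w C d _ _ _ bw _ , _ , q , _
    with blocks-split w (All.tabulate λ _ → tt) (B₁ ∷ []) (B₂ ∷ []) bw
  ...   | w₁ , w₂ , refl , c , f , g
    with canon A w₁ (w₂ ++ C) (A ++ w₁) w₂ C
           (trans d (cong (A ++_) (++-assoc w₁ w₂ C)))
           (trans d (trans (cong (A ++_) (++-assoc w₁ w₂ C)) (sym (++-assoc A w₁ (w₂ ++ C)))))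
           (trans (sym (flat-runs k nothing w₁)) (trans (cong (flats ∘ map runSym) f)
             (trans (cong (λ z → flats (z ∷ [])) (trans (∷-injectiveˡ q) (sym (∷-injectiveˡ (∷-injectiveʳ q)))))
               (trans (sym (cong (flats ∘ map runSym) g)) (flat-runs k nothing w₂)))))
  ...     | refl = clash w₁ f (∷-injectiveˡ q) c

-- Density of boundaries

Level : ℕ → ℕ → Set
Level k c = (k ∸ 1) / 2 ≡ c

oddLevel : ∀ c → Level (1 + c * 2) c
oddLevel c = m*n/n≡m c 2

evenLevel : ∀ c → Level (2 + c * 2) c
evenLevel c = trans (+-distrib-/-∣ʳ 1 {c * 2} {2} (divides c refl)) (m*n/n≡m c 2)

inA-true : ∀ {k c} → Level k c → ∀ {x} → inA k x ≡ true → 3 ^ c * expLen x ≤ 4 ^ c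
inA-true refl e = ≤ᵇ-sound _ _ e

inA-false : ∀ {k c} → Level k c → ∀ {x} → inA k x ≡ false → 4 ^ c < 3 ^ c * expLen x
inA-false refl e = ≰⇒> λ le → true≢false (≤ᵇ-complete le) e

-- ⌊ℓ_k⌋ for the levels k = 2c + 1 and k = 2c + 2.
lev : ℕ → ℕ
lev c = _/_ (4 ^ c) (3 ^ c) ⦃ m^n≢0 3 c ⦄

3^c*lev≤ : ∀ c → 3 ^ c * lev c ≤ 4 ^ c
3^c*lev≤ c = ≤-trans (≤-reflexive (*-comm (3 ^ c) (lev c))) (m/n*n≤m (4 ^ c) (3 ^ c) ⦃ m^n≢0 3 c ⦄)

lev-greatest : ∀ c m → 3 ^ c * m ≤ 4 ^ c → m ≤ lev c
lev-greatest c m h = ≤-trans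
  (≤-reflexive (sym (m*n/n≡m m (3 ^ c) ⦃ m^n≢0 3 c ⦄)))
  (/-mono-≤ {o = 3 ^ c} ⦃ m^n≢0 3 c ⦄ ⦃ m^n≢0 3 c ⦄ (≤-trans (≤-reflexive (*-comm m (3 ^ c))) h) ≤-refl)

inA-lev : ∀ {k c} → Level k c → ∀ {x} → inA k x ≡ true → expLen x ≤ lev c
inA-lev {k} {c} lv {x} e = lev-greatest c _ (inA-true {k} lv {x} e)

outs : (Sym → Bool) → List Sym → ℕ
outs inn [] = 0
outs inn (x ∷ w) = (if inn x then 0 else 1) + outs inn w

outs-bound : ∀ {k c} → Level k c → ∀ w → 4 ^ c * outs (inA k) w ≤ 3 ^ c * expLens w
outs-bound {k} {c} lv [] = ≤-reflexive (trans (*-zeroʳ (4 ^ c)) (sym (*-zeroʳ (3 ^ c))))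
outs-bound {k} {c} lv (x ∷ w) with inA k x in e
... | true = ≤-trans (outs-bound {k} lv w) (*-monoʳ-≤ (3 ^ c) (m≤n+m _ _))
... | false rewrite *-suc (4 ^ c) (outs (inA k) w) | *-distribˡ-+ (3 ^ c) (expLen x) (expLens w) =
  +-mono-≤ (<⇒≤ (inA-false {k} lv {x} e)) (outs-bound {k} lv w)

length-blks : ∀ b p w → length (blks b p w) ≤ length w
length-blks b p [] = z≤n
length-blks b p (x ∷ []) = ≤-refl
length-blks b p (x ∷ y ∷ ys) with b p x y | length-blks b (just x) (y ∷ ys)
... | true | ih = s≤s ih
... | false | ih with blks b (just x) (y ∷ ys)
...   | [] = s≤s z≤n
...   | _ ∷ _ = m≤n⇒m≤1+n ih

-- If singleton blocks of in-symbols only occur next to out-symbols, blocks have average length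
-- about two.  The three bounds are for an arbitrary start, a start with an out-symbol, and a
-- start just after a boundary between in-symbols.
module Halving (b : Rule) (inn : Sym → Bool)
  (no-singleton : ∀ {p y x v} → inn y ≡ true → inn x ≡ true → inn v ≡ true →
     b p y x ≡ true → b (just y) x v ≡ false) where

  -- An out-symbol weighs 4: 2 for its own block and 2 for the additive constant with which the
  -- bound starts again behind it.
  weight : List Sym → ℕ
  weight w = length w + 3 * outs inn w

  Short : ℕ → Maybe Sym → List Sym → Set
  Short d p w = length (blks b p w) * 2 ≤ d + weight w

  weight-out : ∀ x w → inn x ≡ false → weight (x ∷ w) ≡ 4 + weight w
  weight-out x w e rewrite e = solve-weight (length w) (outs inn w)
    where
    solve-weight : ∀ a o → suc (a + 3 * (1 + o)) ≡ 4 + (a + 3 * o)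
    solve-weight = solve-∀

  weight-in : ∀ x w → inn x ≡ true → weight (x ∷ w) ≡ 1 + weight w
  weight-in x w e rewrite e = refl

  weight-grows : ∀ x w → 1 + weight w ≤ weight (x ∷ w)
  weight-grows x w with inn x in e
  ... | true = ≤-refl
  ... | false = s≤s (+-monoʳ-≤ (length w) (*-monoʳ-≤ 3 (n≤1+n _)))

  length-glue : ∀ d x Bs → length (glue d x Bs) ≤ suc (length Bs)
  length-glue true x Bs = ≤-refl
  length-glue false x [] = ≤-refl
  length-glue false x (_ ∷ Bs) = n≤1+n _

  length-joined : ∀ x p y ys → length (glue false x (blks b p (y ∷ ys))) ≡ length (blks b p (y ∷ ys))
  length-joined x p y ys with blks b p (y ∷ ys) | blks-∷ b p y ys
  ... | .(_ ∷ _) | _ , _ , refl = refl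

  mutual
    short : ∀ p w → Short 2 p w
    short p [] = z≤n
    short p (x ∷ w) = by (inn x) refl
      where
      by : ∀ d → inn x ≡ d → Short 2 p (x ∷ w)
      by false ex = ≤-trans (short-out p x w ex) (m≤n+m _ 2)
      by true ex = short-in p x w ex

    short-in : ∀ p x w → inn x ≡ true → Short 2 p (x ∷ w)
    short-in p x [] ex = s≤s (s≤s z≤n)
    short-in p x (y ∷ ys) ex = cases (short (just x) (y ∷ ys)) (b p x y) refl
      where
      by : b p x y ≡ true → ∀ d → inn y ≡ d → Short 1 (just x) (y ∷ ys)
      by c false ey = ≤-trans (short-out (just x) y ys ey) (n≤1+n _)
      by c true ey = short-next (just x) y ys ey λ {v} ev → no-singleton ex ey ev c
      cases : Short 2 (just x) (y ∷ ys) → ∀ d → b p x y ≡ d → Short 2 p (x ∷ y ∷ ys)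
      cases ih false c rewrite c | length-joined x (just x) y ys =
        ≤-trans ih (+-monoʳ-≤ 2 (≤-trans (n≤1+n _) (weight-grows x (y ∷ ys))))
      cases ih true c rewrite c = ≤-trans (s≤s (s≤s (by c (inn y) refl))) (+-monoʳ-≤ 2 (weight-grows x (y ∷ ys)))

    short-out : ∀ p x w → inn x ≡ false → Short 0 p (x ∷ w)
    short-out p x [] e rewrite weight-out x [] e = s≤s (s≤s z≤n)
    short-out p x (y ∷ ys) e =
      ≤-trans (*-monoˡ-≤ 2 (length-glue (b p x y) x (blks b (just x) (y ∷ ys))))
        (≤-trans (s≤s (s≤s (short (just x) (y ∷ ys)))) (≤-reflexive (sym (weight-out x (y ∷ ys) e))))

    short-next : ∀ p x w → inn x ≡ true → (∀ {v} → inn v ≡ true → b p x v ≡ false) → Short 1 p (x ∷ w)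
    short-next p x [] e h rewrite weight-in x [] e = s≤s (s≤s z≤n)
    short-next p x (y ∷ ys) e h = by (short (just x) (y ∷ ys)) (inn y) refl
      where
      by : Short 2 (just x) (y ∷ ys) → ∀ d → inn y ≡ d → Short 1 p (x ∷ y ∷ ys)
      by ih false ey = ≤-trans
        (*-monoˡ-≤ 2 (length-glue (b p x y) x (blks b (just x) (y ∷ ys))))
        (≤-trans (s≤s (s≤s (short-out (just x) y ys ey)))
          (≤-reflexive (cong (1 +_) (sym (weight-in x (y ∷ ys) e)))))
      by ih true ey rewrite h ey | length-joined x (just x) y ys =
        ≤-trans ih (≤-reflexive (cong (1 +_) (sym (weight-in x (y ∷ ys) e))))

-- That is, |F| ≤ 2 + 6 |exp F| / (4/3)^c. The constants are fixed points of the even step: the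
-- bound `short` turns 2 into (2 + 2) / 2 and 6 into (6 + 3) / 2, which is 6 · 3/4, and ℓ grows by
-- 4/3.
Density : ℕ → List Sym → Set
Density c T = ∀ U F V → T ≡ U ++ F ++ V → 4 ^ c * length F ≤ 2 * 4 ^ c + 6 * 3 ^ c * expLens F

evenRule-no-singleton : ∀ k π {p y x v} → inA k y ≡ true → inA k x ≡ true → inA k v ≡ true →
  evenRule k π p y x ≡ true → evenRule k π (just y) x v ≡ false
evenRule-no-singleton k π {p} ey ex ev c rewrite ey | ex | ev = locMin-big π (locMin-next π p c)

oddStep-density : ∀ k c {T} → Positive T → Density c T → Density c (oddStep k T)
oddStep-density k c {T} positive dens U' F' V' e
  with step-window U' F' V' (trans (sym (oddStep-blks k T)) e)
  where
  open Local {Q = λ _ → ⊤} (oddLaws k) T (All.tabulate λ _ → tt) positive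
  open Step runSym (flat-runs k nothing)
... | _ , _ , _ , record { before = U ; middle = w ; after = V ; decomposition = d ; blocks-middle = refl } , _ , refl , _ =
  ≤-trans (*-monoʳ-≤ (4 ^ c) (≤-trans (≤-reflexive (length-map runSym (blks (oddRule k) nothing w))) (length-blks (oddRule k) nothing w)))
    (≤-trans (dens U w V d) (≤-reflexive (cong (λ l → 2 * 4 ^ c + 6 * 3 ^ c * l) (sym same))))
  where
  open Local {Q = λ _ → ⊤} (oddLaws k) T (All.tabulate λ _ → tt) positive
  open Step runSym (flat-runs k nothing)
  same : expLens (map runSym (blks (oddRule k) nothing w)) ≡ expLens w
  same = expLens-step w

evenStep-density : ∀ k c π {T} → Level k c → Positive T → OutsBelow k π (_∈ T) →
  Density c T → Density (suc c) (evenStep k π T)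
evenStep-density k c π {T} lv positive below dens U' F' V' e
  with Local.Step.step-window (evenLaws k π below) T (All.tabulate id) positive tupleSym
         (flat-tuples (evenRule k π) nothing) U' F' V' (trans (sym (evenStep-blks k π T)) e)
... | _ , _ , _ , record { before = U ; middle = w ; after = V ; decomposition = d ; blocks-middle = refl } , _ , refl , _ =
  begin
    4 * A * length (map tupleSym Bs)      ≡⟨ cong (4 * A *_) (length-map tupleSym Bs) ⟩
    4 * A * length Bs                     ≡⟨ e₁ A (length Bs) ⟩
    2 * (A * (length Bs * 2))             ≤⟨ *-monoʳ-≤ 2 (*-monoʳ-≤ A (short nothing w)) ⟩
    2 * (A * (2 + (length w + 3 * o)))    ≡⟨ e₂ A (length w) o ⟩
    2 * (A * length w + 3 * (A * o) + 2 * A)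
      ≤⟨ *-monoʳ-≤ 2 (+-monoˡ-≤ (2 * A) (+-mono-≤ (dens U w V d) (*-monoʳ-≤ 3 (outs-bound {k} lv w)))) ⟩
    2 * (2 * A + 6 * B * l + 3 * (B * l) + 2 * A) ≡⟨ e₃ A B l ⟩
    2 * (4 * A) + 6 * (3 * B) * l         ≡⟨ cong (λ z → 2 * (4 * A) + 6 * (3 * B) * z) (sym same) ⟩
    2 * (4 * A) + 6 * (3 * B) * expLens (map tupleSym Bs) ∎
  where
  open ≤-Reasoning
  open Halving (evenRule k π) (inA k) (λ {p} {y} {x} {v} → evenRule-no-singleton k π {p} {y} {x} {v})
  A = 4 ^ c
  B = 3 ^ c
  Bs = blks (evenRule k π) nothing w
  o = outs (inA k) w
  l = expLens w
  same : expLens (map tupleSym Bs) ≡ l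
  same = Local.Step.expLens-step (evenLaws k π below) T (All.tabulate id) positive tupleSym
    (flat-tuples (evenRule k π) nothing) w
  e₁ : ∀ a m → 4 * a * m ≡ 2 * (a * (m * 2))
  e₁ = solve-∀
  e₂ : ∀ a m o → 2 * (a * (2 + (m + 3 * o))) ≡ 2 * (a * m + 3 * (a * o) + 2 * a)
  e₂ = solve-∀
  e₃ : ∀ a b l → 2 * (2 * a + 6 * b * l + 3 * (b * l) + 2 * a) ≡ 2 * (4 * a) + 6 * (3 * b) * l
  e₃ = solve-∀

-- Invariants of the intermediate strings

Agree : List ℕ → ℕ → ℕ → ℕ → Set
Agree s p p' L = take L (drop p s) ≡ take L (drop p' s) × p + L ≤ length s × p' + L ≤ length s

agree-sym : ∀ {s p p' L} → Agree s p p' L → Agree s p' p L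
agree-sym (e , l , l') = sym e , l' , l

take-drop-take : ∀ x n L (xs : List ℕ) → x + n ≤ L → take n (drop x (take L xs)) ≡ take n (drop x xs)
take-drop-take x n L xs h = trans (take-drop n x (take L xs))
  (trans (cong (drop x) (trans (take-take (x + n) L xs) (cong (λ m → take m xs) (m≤n⇒m⊓n≡m h))))
    (sym (take-drop n x xs)))

agree-factor : ∀ {s p p' L x n} → Agree s p p' L → x + n ≤ L →
  take n (drop (p + x) s) ≡ take n (drop (p' + x) s)
agree-factor {s} {p} {p'} {L} {x} {n} (e , _ , _) h = trans (sym (side p)) (trans (cong (λ z → take n (drop x z)) e) (side p'))
  where
  side : ∀ q → take n (drop x (take L (drop q s))) ≡ take n (drop (q + x) s)
  side q = trans (take-drop-take x n L (drop q s) h) (cong (take n) (drop-drop q x s))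

take-length-++ : ∀ {A : Set} (w v : List A) → take (length w) (w ++ v) ≡ w
take-length-++ [] v = refl
take-length-++ (x ∷ w) v = cong (x ∷_) (take-length-++ w v)

take-drop-middle : ∀ (u w v : List ℕ) → take (length w) (drop (length u) (u ++ w ++ v)) ≡ w
take-drop-middle [] w v = take-length-++ w v
take-drop-middle (_ ∷ u) w v = take-drop-middle u w v

middle-split : ∀ q n (s : List ℕ) → s ≡ take q s ++ take n (drop q s) ++ drop n (drop q s)
middle-split q n s = trans (sym (take++drop≡id q s)) (cong (take q s ++_) (sym (take++drop≡id n (drop q s))))

flats-map-term : ∀ s → flats (map term s) ≡ s
flats-map-term [] = refl
flats-map-term (x ∷ s) = cong (x ∷_) (flats-map-term s)

expLens-map-term : ∀ s → expLens (map term s) ≡ length s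
expLens-map-term s = trans (sym (length-flats (map term s))) (cong length (flats-map-term s))

window-of-terms : ∀ s U w V → map term s ≡ U ++ w ++ V → ∃₂ λ u v → ∃ λ x →
  s ≡ u ++ x ++ v × map term u ≡ U × map term x ≡ w
window-of-terms s U w V e with map-split term s U (w ++ V) e
... | u , xv , refl , f , g with map-split term xv w V g
...   | x , v , refl , h , _ = u , v , x , refl , f , h

-- The invariants of T = S_{k-1}: α is the context that determines a window, and c the exponent of ℓ.
record Good (s : List ℕ) (c α : ℕ) (T : List Sym) : Set where
  field
    flat-eq  : flats T ≡ s
    positive : Positive T
    canon    : Canon T
    density  : Density c T
    transfer : ∀ p p' L → Agree s p p' L → Transfer α T p p' L

good-terms : ∀ s → Good s 0 0 (map term s)
good-terms s = record
  { flat-eq = flats-map-term s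
  ; positive = Allₚ.map⁺ (All.tabulate λ _ → s≤s z≤n)
  ; canon = canon
  ; density = density
  ; transfer = transfer }
  where
  canon : Canon (map term s)
  canon U w V U' w' V' e e' fl with window-of-terms s U w V e | window-of-terms s U' w' V' e'
  ... | _ , _ , x , _ , _ , refl | _ , _ , x' , _ , _ , refl =
    cong (map term) (trans (sym (flats-map-term x)) (trans fl (flats-map-term x')))
  density : Density 0 (map term s)
  density U F V e with window-of-terms s U F V e
  ... | _ , _ , x , _ , _ , refl rewrite expLens-map-term x | length-map term x =
    ≤-trans (≤-reflexive (+-identityʳ (length x))) (≤-trans (m≤n*m (length x) 6) (m≤n+m _ 2))
  transfer : ∀ p p' L → Agree s p p' L → Transfer 0 (map term s) p p' L
  transfer p p' L ag@(_ , _ , fits) x w _ m (U , V , e , l) with window-of-terms s U w V e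
  ... | u , v , y , es , refl , refl =
    map term (take (p' + x) s) , map term (drop (length y) (drop (p' + x) s)) ,
    trans (cong (map term) (trans (middle-split (p' + x) (length y) s) (cong (λ z → take (p' + x) s ++ z ++ drop (length y) (drop (p' + x) s)) same)))
      (trans (map-++ term (take (p' + x) s) _) (cong (map term (take (p' + x) s) ++_) (map-++ term y _))) ,
    trans (expLens-map-term (take (p' + x) s)) (trans (length-take (p' + x) s) (m≤n⇒m⊓n≡m p'x≤))
    where
    m' : x + length y ≤ L
    m' = ≤-trans (+-monoʳ-≤ x (≤-reflexive (sym (expLens-map-term y)))) (≤-trans (m≤m+n _ 0) m)
    lu : length u ≡ p + x
    lu = trans (sym (expLens-map-term u)) l
    p'x≤ : p' + x ≤ length s
    p'x≤ = ≤-trans (+-monoʳ-≤ p' (≤-trans (m≤m+n x _) m')) fits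
    same : take (length y) (drop (p' + x) s) ≡ y
    same = trans (sym (agree-factor {p = p} {p'} {x = x} ag m'))
      (trans (cong (λ q → take (length y) (drop q s)) (sym lu))
        (trans (cong (λ z → take (length y) (drop (length u) z)) es) (take-drop-middle u y v)))

good-odd : ∀ {s k c α T} → Level k c → Good s c α T → Good s c (α + lev c + lev c) (oddStep k T)
good-odd {s} {k} {c} {α} {T} lv g = record
  { flat-eq = trans (trans (cong flats (oddStep-blks k T)) (flat-runs k nothing T)) (Good.flat-eq g)
  ; positive = subst Positive (sym (oddStep-blks k T)) step-positive
  ; canon = subst Canon (sym (oddStep-blks k T)) (canon-step (Good.canon g))
  ; density = oddStep-density k c (Good.positive g) (Good.density g)
  ; transfer = λ p p' L ag → subst (λ R → Transfer (α + lev c + lev c) R p p' L) (sym (oddStep-blks k T))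
      (step-transfer (lev c) α (λ {x} → inA-lev {k} lv {x})
        (Good.transfer g p p' L ag) (Good.transfer g p' p L (agree-sym {p = p} ag))) }
  where
  open Local {Q = λ _ → ⊤} (oddLaws k) T (All.tabulate λ _ → tt) (Good.positive g)
  open Step runSym (flat-runs k nothing)

good-even : ∀ {s k c α T} π → Level k c → OutsBelow k π (_∈ T) → Good s c α T →
  Good s (suc c) (α + lev c + lev c) (evenStep k π T)
good-even {s} {k} {c} {α} {T} π lv below g = record
  { flat-eq = trans (trans (cong flats (evenStep-blks k π T)) (flat-tuples (evenRule k π) nothing T)) (Good.flat-eq g)
  ; positive = subst Positive (sym (evenStep-blks k π T)) step-positive
  ; canon = subst Canon (sym (evenStep-blks k π T)) (canon-step (Good.canon g))
  ; density = evenStep-density k c π lv (Good.positive g) below (Good.density g)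
  ; transfer = λ p p' L ag → subst (λ R → Transfer (α + lev c + lev c) R p p' L) (sym (evenStep-blks k π T))
      (step-transfer (lev c) α (λ {x} → inA-lev {k} lv {x})
        (Good.transfer g p p' L ag) (Good.transfer g p' p L (agree-sym {p = p} ag))) }
  where
  open Local (evenLaws k π below) T (All.tabulate id) (Good.positive g)
  open Step tupleSym (flat-tuples (evenRule k π) nothing)

-- The context at the start of level 1 + 2 c; each of the two levels with a given exponent adds 2 ℓ.
margin : ℕ → ℕ
margin zero = 0
margin (suc c) = margin c + lev c + lev c + lev c + lev c

-- The constant 12 solves 3 x + 12 = 4 x; it is the limit of the geometric sum of 4 (4/3)^i, i < c,
-- relative to (4/3)^c.
3^c*margin≤ : ∀ c → 3 ^ c * margin c ≤ 12 * 4 ^ c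
3^c*margin≤ zero = z≤n
3^c*margin≤ (suc c) = begin
  3 * B * (m + l + l + l + l)   ≡⟨ e₁ B m l ⟩
  3 * (B * m) + 12 * (B * l)    ≤⟨ +-mono-≤ (*-monoʳ-≤ 3 (3^c*margin≤ c)) (*-monoʳ-≤ 12 (3^c*lev≤ c)) ⟩
  3 * (12 * A) + 12 * A         ≡⟨ e₂ A ⟩
  12 * (4 * A)                  ∎
  where
  open ≤-Reasoning
  A = 4 ^ c
  B = 3 ^ c
  m = margin c
  l = lev c
  e₁ : ∀ b m l → 3 * b * (m + l + l + l + l) ≡ 3 * (b * m) + 12 * (b * l)
  e₁ = solve-∀
  e₂ : ∀ a → 3 * (12 * a) + 12 * a ≡ 12 * (4 * a)
  e₂ = solve-∀

3^c*margin+≤ : ∀ c → 3 ^ c * (margin c + lev c + lev c) ≤ 14 * 4 ^ c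
3^c*margin+≤ c = begin
  B * (m + l + l)         ≡⟨ e₁ B m l ⟩
  B * m + 2 * (B * l)     ≤⟨ +-mono-≤ (3^c*margin≤ c) (*-monoʳ-≤ 2 (3^c*lev≤ c)) ⟩
  12 * A + 2 * A          ≡⟨ sym (*-distribʳ-+ A 12 2) ⟩
  14 * A                  ∎
  where
  open ≤-Reasoning
  A = 4 ^ c
  B = 3 ^ c
  m = margin c
  l = lev c
  e₁ : ∀ b m l → b * (m + l + l) ≡ b * m + 2 * (b * l)
  e₁ = solve-∀

-- Finite sums and cardinalities of lists

∑ : ∀ {A : Set} → List A → (A → ℕ) → ℕ
∑ [] f = 0
∑ (x ∷ xs) f = f x + ∑ xs f

∑-cong : ∀ {A : Set} (xs : List A) {f g} → (∀ x → f x ≡ g x) → ∑ xs f ≡ ∑ xs g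
∑-cong [] h = refl
∑-cong (x ∷ xs) h = cong₂ _+_ (h x) (∑-cong xs h)

∑-mono : ∀ {A : Set} (xs : List A) {f g} → (∀ {x} → x ∈ xs → f x ≤ g x) → ∑ xs f ≤ ∑ xs g
∑-mono [] h = z≤n
∑-mono (x ∷ xs) h = +-mono-≤ (h (here refl)) (∑-mono xs (h ∘ there))

∑-++ : ∀ {A : Set} (xs ys : List A) f → ∑ (xs ++ ys) f ≡ ∑ xs f + ∑ ys f
∑-++ [] ys f = refl
∑-++ (x ∷ xs) ys f = trans (cong (f x +_) (∑-++ xs ys f)) (sym (+-assoc (f x) _ _))

∑-map : ∀ {A B : Set} (g : A → B) xs f → ∑ (map g xs) f ≡ ∑ xs (f ∘ g)
∑-map g [] f = refl
∑-map g (x ∷ xs) f = cong (f (g x) +_) (∑-map g xs f)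

∑-concatMap : ∀ {A B : Set} (g : A → List B) xs f → ∑ (concatMap g xs) f ≡ ∑ xs (λ x → ∑ (g x) f)
∑-concatMap g [] f = refl
∑-concatMap g (x ∷ xs) f = trans (∑-++ (g x) _ f) (cong (∑ (g x) f +_) (∑-concatMap g xs f))

∑-+ : ∀ {A : Set} (xs : List A) f g → ∑ xs (λ x → f x + g x) ≡ ∑ xs f + ∑ xs g
∑-+ [] f g = refl
∑-+ (x ∷ xs) f g = trans (cong (f x + g x +_) (∑-+ xs f g)) (interchange (f x) (g x) _ _)
  where
  interchange : ∀ a b c d → a + b + (c + d) ≡ a + c + (b + d)
  interchange = solve-∀

∑-* : ∀ {A : Set} m (xs : List A) f → ∑ xs (λ x → m * f x) ≡ m * ∑ xs f
∑-* m [] f = sym (*-zeroʳ m)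
∑-* m (x ∷ xs) f = trans (cong (m * f x +_) (∑-* m xs f)) (sym (*-distribˡ-+ m (f x) _))

∑-const : ∀ {A : Set} (xs : List A) m → ∑ xs (λ _ → m) ≡ length xs * m
∑-const [] m = refl
∑-const (x ∷ xs) m = cong (m +_) (∑-const xs m)

∑-one : ∀ {A : Set} (xs : List A) → ∑ xs (λ _ → 1) ≡ length xs
∑-one xs = trans (∑-const xs 1) (*-identityʳ _)

∑-bound : ∀ {A : Set} (xs : List A) {f m} → (∀ {x} → x ∈ xs → f x ≤ m) → ∑ xs f ≤ length xs * m
∑-bound xs h = ≤-trans (∑-mono xs h) (≤-reflexive (∑-const xs _))

∑-swap : ∀ {A B : Set} (xs : List A) (ys : List B) (f : A → B → ℕ) → ∑ xs (λ x → ∑ ys (f x)) ≡ ∑ ys (λ y → ∑ xs (λ x → f x y))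
∑-swap [] ys f = sym (trans (∑-const ys 0) (*-zeroʳ (length ys)))
∑-swap (x ∷ xs) ys f = trans (cong (∑ ys (f x) +_) (∑-swap xs ys f)) (sym (∑-+ ys (f x) _))

unique-⊆⇒length≤ : ∀ {A : Set} {xs ys : List A} → Unique xs → (∀ {x} → x ∈ xs → x ∈ ys) → length xs ≤ length ys
unique-⊆⇒length≤ [] h = z≤n
unique-⊆⇒length≤ {xs = x ∷ xs} {ys} (x∉ ∷ u) h with ∈-∃++ (h (here refl))
... | as , bs , refl = ≤-trans (s≤s (unique-⊆⇒length≤ u reduce))
        (≤-reflexive (trans (cong suc (length-++ as)) (trans (sym (+-suc _ _)) (sym (length-++ as)))))
  where
  reduce : ∀ {y} → y ∈ xs → y ∈ as ++ bs
  reduce y∈ with ∈-++⁻ as (h (there y∈))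
  ... | inj₁ p = ∈-++⁺ˡ p
  ... | inj₂ (here refl) = contradiction refl (All.lookup x∉ y∈)
  ... | inj₂ (there p) = ∈-++⁺ʳ as p

defined : ∀ {A : Set} → Maybe A → ℕ
defined (just _) = 1
defined nothing = 0

∈-mapMaybe : ∀ {A B : Set} (g : A → Maybe B) {xs x y} → x ∈ xs → g x ≡ just y → y ∈ mapMaybe g xs
∈-mapMaybe g {x = x} (here refl) e rewrite e = here refl
∈-mapMaybe g {x' ∷ xs} (there p) e with g x'
... | just _ = there (∈-mapMaybe g p e)
... | nothing = ∈-mapMaybe g p e

length-mapMaybe≡∑ : ∀ {A B : Set} (g : A → Maybe B) xs → length (mapMaybe g xs) ≡ ∑ xs (defined ∘ g)
length-mapMaybe≡∑ g [] = refl
length-mapMaybe≡∑ g (x ∷ xs) with g x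
... | just _ = cong suc (length-mapMaybe≡∑ g xs)
... | nothing = length-mapMaybe≡∑ g xs

length-filter-split : ∀ {A : Set} {P : A → Set} (P? : ∀ x → Dec (P x)) xs →
  length xs ≡ length (filter P? xs) + length (filter (¬? ∘ P?) xs)
length-filter-split P? [] = refl
length-filter-split P? (x ∷ xs) with P? x
... | yes _ = cong suc (length-filter-split P? xs)
... | no _ = trans (cong suc (length-filter-split P? xs)) (sym (+-suc _ _))

-- Counting distinct windows

prefix-extend : ∀ A {B} A' {B'} → A ++ B ≡ A' ++ B' → expLens A < expLens A' →
  ∃₂ λ y F → A' ≡ A ++ y ∷ F
prefix-extend [] (y ∷ F) e lt = y , F , refl
prefix-extend (x ∷ A) (y ∷ A') e lt with ∷-injective e
... | refl , e' with prefix-extend A A' e' (+-cancelˡ-< (expLen x) _ _ lt)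
...   | z , F , refl = z , F , refl

-- A partial inverse of `expLens` on prefixes: `nothing` if q falls inside a symbol or beyond the
-- end.
suffixAt : List Sym → ℕ → Maybe (List Sym)
suffixAt T zero = just T
suffixAt [] (suc q) = nothing
suffixAt (x ∷ T) (suc q) = if expLen x ≤ᵇ suc q then suffixAt T (suc q ∸ expLen x) else nothing

suffixAt-complete : ∀ U V → Positive (U ++ V) → suffixAt (U ++ V) (expLens U) ≡ just V
suffixAt-complete [] V pos = refl
suffixAt-complete (x ∷ U) V (px ∷ pos) with expLen x + expLens U in e
... | zero = contradiction (≤-trans px (m≤m+n _ _)) (<⇒≱ (s≤s (≤-reflexive e)))
... | suc q with expLen x ≤ᵇ suc q in le
...   | true = trans (cong (suffixAt (U ++ V)) (trans (cong (_∸ expLen x) (sym e)) (m+n∸m≡n (expLen x) _)))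
                 (suffixAt-complete U V pos)
...   | false = ⊥-elim (true≢false (≤ᵇ-complete (≤-trans (m≤m+n (expLen x) (expLens U)) (≤-reflexive e))) le)

suffixAt-sound : ∀ T q {V} → suffixAt T q ≡ just V → ∃ λ U → T ≡ U ++ V × expLens U ≡ q
suffixAt-sound T zero refl = [] , refl , refl
suffixAt-sound (x ∷ T) (suc q) e with expLen x ≤ᵇ suc q in le
... | true with suffixAt-sound T (suc q ∸ expLen x) e
...   | U , refl , l = x ∷ U , refl , trans (cong (expLen x +_) l) (m+[n∸m]≡n (≤ᵇ-sound (expLen x) (suc q) le))

boundary : List Sym → ℕ → ℕ
boundary T q = defined (suffixAt T q)

windowAt : ℕ → List Sym → ℕ → Maybe (List Sym)
windowAt r T q = Maybe.map (take r) (suffixAt T q)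

defined-windowAt : ∀ r T q → defined (windowAt r T q) ≡ boundary T q
defined-windowAt r T q with suffixAt T q
... | just _ = refl
... | nothing = refl

windowAt-complete : ∀ {T q w} → Positive T → At T q w → windowAt (length w) T q ≡ just w
windowAt-complete {w = w} pos (U , V , refl , refl)
  rewrite suffixAt-complete U (w ++ V) pos = cong just (take-length-++ w V)

boundaries : List Sym → ℕ → ℕ → ℕ
boundaries T a m = ∑ (downFrom m) (λ i → boundary T (a + i))

-- The first and the last boundary in the range enclose F, with one symbol fewer than there are
-- boundaries. This turns a count of positions into a length, to which `Density` applies.
boundaries-factor : ∀ T a m → boundaries T a m ≡ 0 ⊎ ∃₂ λ U F → ∃ λ V →
  T ≡ U ++ F ++ V × a ≤ expLens U × expLens (U ++ F) < a + m × boundaries T a m ≤ suc (length F)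
boundaries-factor T a zero = inj₁ refl
boundaries-factor T a (suc m) with suffixAt T (a + m) in e | boundaries-factor T a m
... | nothing | inj₁ z = inj₁ z
... | nothing | inj₂ (U , F , V , d , l , lt , h) =
  inj₂ (U , F , V , d , l , ≤-trans lt (+-monoʳ-≤ a (n≤1+n m)) , h)
... | just V' | ih with suffixAt-sound T (a + m) e
...   | U' , d' , l' with ih
...     | inj₁ z = inj₂ (U' , [] , V' , d' , ≤-trans (m≤m+n a m) (≤-reflexive (sym l')) ,
            ≤-reflexive (trans (cong suc (trans (cong expLens (++-identityʳ U')) l')) (sym (+-suc a m))) ,
            s≤s (≤-reflexive z))
...     | inj₂ (U , F , V , d , l , lt , h)
  with prefix-extend (U ++ F) U' (trans (++-assoc U F V) (trans (sym d) d')) (≤-trans lt (≤-reflexive (sym l')))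
...       | y , F' , refl = inj₂ (U , F ++ y ∷ F' , V' ,
            trans d' (trans (cong (_++ V') (++-assoc U F (y ∷ F'))) (++-assoc U (F ++ y ∷ F') V')) , l ,
            ≤-reflexive (trans (cong suc (trans (cong expLens (sym (++-assoc U F (y ∷ F')))) l')) (sym (+-suc a m))) ,
            s≤s (≤-trans h (≤-trans (s≤s (m≤m+n (length F) (length F')))
              (≤-reflexive (trans (sym (+-suc _ _)) (sym (length-++ F)))))))

boundaries-bound : ∀ {T c} → Density c T → ∀ a m →
  4 ^ c * boundaries T a m ≤ 3 * 4 ^ c + 6 * 3 ^ c * m
boundaries-bound {T} {c} dens a m with boundaries-factor T a m
... | inj₁ z = ≤-trans (≤-reflexive (trans (cong (4 ^ c *_) z) (*-zeroʳ (4 ^ c)))) z≤n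
... | inj₂ (U , F , V , d , l , lt , h) = begin
  4 ^ c * boundaries T a m                     ≤⟨ *-monoʳ-≤ (4 ^ c) h ⟩
  4 ^ c * suc (length F)                       ≡⟨ *-suc (4 ^ c) (length F) ⟩
  4 ^ c + 4 ^ c * length F                     ≤⟨ +-monoʳ-≤ (4 ^ c) (dens U F V d) ⟩
  4 ^ c + (2 * 4 ^ c + 6 * 3 ^ c * expLens F)  ≡⟨ sym (+-assoc (4 ^ c) (2 * 4 ^ c) _) ⟩
  3 * 4 ^ c + 6 * 3 ^ c * expLens F            ≤⟨ +-monoʳ-≤ (3 * 4 ^ c) (*-monoʳ-≤ (6 * 3 ^ c) F≤m) ⟩
  3 * 4 ^ c + 6 * 3 ^ c * m                    ∎
  where
  open ≤-Reasoning
  F≤m : expLens F ≤ m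
  F≤m = +-cancelˡ-≤ a _ _ (≤-trans (+-monoˡ-≤ (expLens F) l)
    (≤-trans (≤-reflexive (sym (expLens-++ U F))) (<⇒≤ lt)))

infix 4 _≟w_ _∈w?_
_≟w_ : (v w : List Sym) → Dec (v ≡ w)
_≟w_ = ≡-dec _≟ₛ_

_∈w?_ : (w : List Sym) (ws : List (List Sym)) → Dec (w ∈ ws)
w ∈w? ws = Any.any? (w ≟w_) ws

-- Distinct substrings enter the counting as the positions of one occurrence each, so N plays the
-- part of d_L.
Representatives : List ℕ → ℕ → ℕ → Set
Representatives s L N = ∃ λ Ps → length Ps ≤ N ×
  (∀ q → q + L ≤ length s → ∃ λ P → P ∈ Ps × Agree s q P L)

-- Numerical constants are kept abstract, for otherwise the type checker unfolds them in unary.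
abstract
  windowConstant : ℕ
  windowConstant = 1074

  windowConstant-≥ : 1074 ≤ windowConstant
  windowConstant-≥ = ≤-refl

module WindowCount {s c α T} (good : Good s c α T) (Δ : ℕ)
  (reps : ∀ L → 1 ≤ L → Representatives s L (Δ * L))
  (α-bound : 3 ^ c * α ≤ 14 * 4 ^ c) (r : ℕ) (1≤r : 1 ≤ r) (1≤Δ : 1 ≤ Δ) where

  open Good good

  -- Room for r short symbols and a context of α on either side. A factor of length 2 M also lets
  -- the window shift by any i ≤ M.
  M : ℕ
  M = α + α + r * lev c

  3^cM≤ : 3 ^ c * M ≤ (28 + r) * 4 ^ c
  3^cM≤ = begin
    B * (α + α + r * l)            ≡⟨ e₁ B α r l ⟩
    2 * (B * α) + r * (B * l)      ≤⟨ +-mono-≤ (*-monoʳ-≤ 2 α-bound) (*-monoʳ-≤ r (3^c*lev≤ c)) ⟩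
    2 * (14 * A) + r * A           ≡⟨ e₂ A r ⟩
    (28 + r) * A                   ∎
    where
    open ≤-Reasoning
    A = 4 ^ c
    B = 3 ^ c
    l = lev c
    e₁ : ∀ b a r l → b * (a + a + r * l) ≡ 2 * (b * a) + r * (b * l)
    e₁ = solve-∀
    e₂ : ∀ a r → 2 * (14 * a) + r * a ≡ (28 + r) * a
    e₂ = solve-∀

  boundaries≤ : ∀ a m u v → m ≤ u * M + v → boundaries T a m ≤ 3 + 6 * (u * (28 + r) + v)
  boundaries≤ a m u v h = *-cancelˡ-≤ A ⦃ m^n≢0 4 c ⦄ (begin
    A * boundaries T a m                        ≤⟨ boundaries-bound {c = c} density a m ⟩
    3 * A + 6 * B * m                           ≤⟨ +-monoʳ-≤ (3 * A) (*-monoʳ-≤ (6 * B) h) ⟩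
    3 * A + 6 * B * (u * M + v)                 ≡⟨ e₁ A B u M v ⟩
    3 * A + 6 * (u * (B * M) + v * B)           ≤⟨ +-monoʳ-≤ (3 * A) (*-monoʳ-≤ 6 (+-mono-≤ (*-monoʳ-≤ u 3^cM≤) (*-monoʳ-≤ v (^-monoˡ-≤ c (n≤1+n 3))))) ⟩
    3 * A + 6 * (u * ((28 + r) * A) + v * A)    ≡⟨ e₂ A u r v ⟩
    A * (3 + 6 * (u * (28 + r) + v))            ∎)
    where
    open ≤-Reasoning
    A = 4 ^ c
    B = 3 ^ c
    e₁ : ∀ a b u m v → 3 * a + 6 * b * (u * m + v) ≡ 3 * a + 6 * (u * (b * m) + v * b)
    e₁ = solve-∀
    e₂ : ∀ a u r v → 3 * a + 6 * (u * ((28 + r) * a) + v * a) ≡ a * (3 + 6 * (u * (28 + r) + v))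
    e₂ = solve-∀

  module _ (D : List (List Sym)) (uniqueD : Unique D)
    (occurs : ∀ {w} → w ∈ D → ∃ λ q → At T q w)
    (length-r : ∀ {w} → w ∈ D → length w ≡ r)
    (short : ∀ {w} → w ∈ D → expLens w ≤ r * lev c) where

    n : ℕ
    n = length s

    -- Near the ends of s the shifted factors of length 2 M need not fit. Windows that start there
    -- are counted directly: O(M) positions hold only O(r) boundaries.
    edge : List (List Sym)
    edge = mapMaybe (windowAt r T) (downFrom (2 * M)) ++
           mapMaybe (λ j → windowAt r T ((n ∸ 2 * M) + j)) (downFrom (1 + 2 * M))

    edge-bound : length edge ≤ (3 + 6 * (2 * (28 + r) + 0)) + (3 + 6 * (2 * (28 + r) + 1))
    edge-bound = ≤-trans (≤-reflexive (length-++ (mapMaybe (windowAt r T) (downFrom (2 * M))))) (+-mono-≤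
      (≤-trans (≤-reflexive (trans (length-mapMaybe≡∑ _ (downFrom (2 * M))) (∑-cong (downFrom (2 * M)) (λ q → defined-windowAt r T q))))
        (boundaries≤ 0 (2 * M) 2 0 (≤-reflexive (sym (+-identityʳ _)))))
      (≤-trans (≤-reflexive (trans (length-mapMaybe≡∑ _ (downFrom (1 + 2 * M))) (∑-cong (downFrom (1 + 2 * M)) (λ j → defined-windowAt r T ((n ∸ 2 * M) + j)))))
        (boundaries≤ (n ∸ 2 * M) (1 + 2 * M) 2 1 (≤-reflexive (+-comm 1 (2 * M))))))

    inner : List (List Sym)
    inner = filter (λ w → ¬? (w ∈w? edge)) D

    at-window : ∀ {w q} → w ∈ D → At T q w → windowAt r T q ≡ just w
    at-window {w} {q} w∈ at = subst (λ l → windowAt l T q ≡ just w) (length-r w∈) (windowAt-complete positive at)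

    at-≤n : ∀ {q w} → At T q w → q ≤ n
    at-≤n (U , V , d , refl) = ≤-trans (m≤m+n (expLens U) _)
      (≤-reflexive (trans (sym (expLens-++ U _)) (trans (cong expLens (sym d))
        (trans (sym (length-flats T)) (cong length flat-eq)))))

    inner-position : ∀ {w q} → w ∈ inner → At T q w → α + M ≤ q × q + 2 * M ≤ n + α
    inner-position {w} {q} w∈ at with ∈-filter⁻ (λ w → ¬? (w ∈w? edge)) {xs = D} w∈
    ... | w∈D , w∉ = ≮⇒≥ not-left , ≮⇒≥ not-right
      where
      M≤ : α + M ≤ 2 * M
      M≤ = +-mono-≤ (≤-trans (m≤m+n α α) (m≤m+n _ _)) (≤-reflexive (sym (+-identityʳ M)))
      not-left : ¬ q < α + M
      not-left lt = w∉ (∈-++⁺ˡ (∈-mapMaybe (windowAt r T) (∈-downFrom⁺ (≤-trans lt M≤)) (at-window w∈D at)))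
      not-right : ¬ n + α < q + 2 * M
      not-right lt = w∉ (∈-++⁺ʳ (mapMaybe (windowAt r T) (downFrom (2 * M)))
        (∈-mapMaybe (λ j → windowAt r T ((n ∸ 2 * M) + j)) {x = q ∸ (n ∸ 2 * M)}
          (∈-downFrom⁺ (s≤s (m≤n+o⇒m∸n≤o q (n ∸ 2 * M) (≤-trans (at-≤n at) (≤-trans (m≤n+m∸n n (2 * M)) (≤-reflexive (+-comm (2 * M) _)))))))
          (trans (cong (windowAt r T) (m+[n∸m]≡n below)) (at-window w∈D at))))
        where
        below : n ∸ 2 * M ≤ q
        below = m≤n+o⇒m∸n≤o n (2 * M) (≤-trans (m≤m+n n α) (≤-trans (<⇒≤ lt) (≤-reflexive (+-comm q (2 * M)))))

    2M≥1 : 1 ≤ 2 * M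
    2M≥1 = ≤-trans (≤-trans 1≤r (≤-trans (≤-trans (≤-reflexive (sym (*-identityʳ r))) (*-monoʳ-≤ r 1≤lev)) (m≤n+m _ (α + α)))) (m≤m+n M _)
      where
      1≤lev : 1 ≤ lev c
      1≤lev = lev-greatest c 1 (≤-trans (≤-reflexive (*-identityʳ (3 ^ c))) (^-monoˡ-≤ c (n≤1+n 3)))

    private
      Ps : List ℕ
      Ps = proj₁ (reps (2 * M) 2M≥1)

    -- Shifting an occurrence by i ≤ M inside a factor of length 2M, the window is read off at the
    -- boundary at offset α + i of the representative of that factor.
    inner-covered : ∀ i → i < 1 + M → length inner ≤ ∑ Ps (λ P → boundary T (P + α + i))
    inner-covered i (s≤s i≤M) = ≤-trans
      (unique-⊆⇒length≤ (Uniqueₚ.filter⁺ (λ w → ¬? (w ∈w? edge)) uniqueD) cover)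
      (≤-reflexive (trans (length-mapMaybe≡∑ _ Ps) (∑-cong Ps (λ P → defined-windowAt r T (P + α + i)))))
      where
      cover : ∀ {w} → w ∈ inner → w ∈ mapMaybe (λ P → windowAt r T (P + α + i)) Ps
      cover {w} w∈ with ∈-filter⁻ (λ w → ¬? (w ∈w? edge)) {xs = D} w∈
      ... | w∈D , _ with occurs w∈D
      ...   | q , at with inner-position w∈ at
      ...     | lo , hi with proj₂ (proj₂ (reps (2 * M) 2M≥1)) (q ∸ (α + i)) fits
        where
        fits : q ∸ (α + i) + 2 * M ≤ n
        fits = +-cancelʳ-≤ α _ _ (begin
          q ∸ (α + i) + 2 * M + α   ≡⟨ +-assoc (q ∸ (α + i)) (2 * M) α ⟩
          q ∸ (α + i) + (2 * M + α) ≡⟨ cong (q ∸ (α + i) +_) (+-comm (2 * M) α) ⟩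
          q ∸ (α + i) + (α + 2 * M) ≡⟨ sym (+-assoc (q ∸ (α + i)) α (2 * M)) ⟩
          q ∸ (α + i) + α + 2 * M   ≤⟨ +-monoˡ-≤ (2 * M) (+-monoʳ-≤ (q ∸ (α + i)) (m≤m+n α i)) ⟩
          q ∸ (α + i) + (α + i) + 2 * M ≡⟨ cong (_+ 2 * M) (m∸n+n≡m (≤-trans (+-monoʳ-≤ α i≤M) lo)) ⟩
          q + 2 * M                 ≤⟨ hi ⟩
          n + α                     ∎)
          where open ≤-Reasoning
      ...       | P , P∈ , ag = ∈-mapMaybe (λ P → windowAt r T (P + α + i)) P∈
                    (at-window w∈D (subst (λ z → At T z w) (sym (+-assoc P α i))
                      (transfer (q ∸ (α + i)) P (2 * M) ag (α + i) w (m≤m+n α i) room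
                        (subst (λ z → At T z w) (sym (m∸n+n≡m (≤-trans (+-monoʳ-≤ α i≤M) lo))) at))))
        where
        room : α + i + expLens w + α ≤ 2 * M
        room = begin
          α + i + expLens w + α      ≤⟨ +-monoˡ-≤ α (+-mono-≤ (+-monoʳ-≤ α i≤M) (short w∈D)) ⟩
          α + M + r * lev c + α      ≡⟨ e α M (r * lev c) ⟩
          M + (α + α + r * lev c)    ≡⟨ cong (M +_) (sym (+-identityʳ M)) ⟩
          2 * M                      ∎
          where
          open ≤-Reasoning
          e : ∀ a m x → a + m + x + a ≡ m + (a + a + x)
          e = solve-∀

    perFactor : ℕ
    perFactor = 3 + 6 * (1 * (28 + r) + 1)

    -- Double counting: each of the 1 + M shifts sees all inner windows, while each of the at most 2
    -- M Δ representatives offers O(r) boundaries over all shifts together. The factor M cancels.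
    inner-bound : length inner ≤ 2 * Δ * perFactor
    inner-bound = *-cancelˡ-≤ (1 + M) (begin
      (1 + M) * length inner     ≡⟨ cong (_* length inner) (sym (length-downFrom (1 + M))) ⟩
      length (downFrom (1 + M)) * length inner ≡⟨ sym (∑-const (downFrom (1 + M)) (length inner)) ⟩
      ∑ (downFrom (1 + M)) (λ _ → length inner) ≤⟨ ∑-mono (downFrom (1 + M)) (λ {i} i∈ → inner-covered i (∈-downFrom⁻ i∈)) ⟩
      ∑ (downFrom (1 + M)) (λ i → ∑ Ps (λ P → boundary T (P + α + i))) ≡⟨ ∑-swap (downFrom (1 + M)) Ps (λ i P → boundary T (P + α + i)) ⟩
      ∑ Ps (λ P → boundaries T (P + α) (1 + M)) ≤⟨ ∑-bound Ps (λ {P} _ → boundaries≤ (P + α) (1 + M) 1 1 (≤-reflexive (trans (+-comm 1 M) (cong (_+ 1) (sym (*-identityˡ M)))))) ⟩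
      length Ps * perFactor              ≤⟨ *-monoˡ-≤ perFactor (proj₁ (proj₂ (reps (2 * M) 2M≥1))) ⟩
      Δ * (2 * M) * perFactor            ≡⟨ e Δ M perFactor ⟩
      M * (2 * Δ * perFactor)            ≤⟨ *-monoˡ-≤ (2 * Δ * perFactor) (n≤1+n M) ⟩
      (1 + M) * (2 * Δ * perFactor)      ∎)
      where
      open ≤-Reasoning
      e : ∀ d m j → d * (2 * m) * j ≡ m * (2 * d * j)
      e = solve-∀

    -- The edge contributes 684 + 24 r and the interior (354 + 12 r) Δ; with 1 ≤ r and 1 ≤ Δ the sum
    -- is at most (1038 + 36) r Δ.
    windows-bound : length D ≤ windowConstant * (r * Δ)
    windows-bound = begin
      length D ≡⟨ length-filter-split (_∈w? edge) D ⟩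
      length (filter (_∈w? edge) D) + length inner
        ≤⟨ +-mono-≤ (≤-trans (unique-⊆⇒length≤ (Uniqueₚ.filter⁺ (_∈w? edge) uniqueD) (λ w∈ → proj₂ (∈-filter⁻ (_∈w? edge) {xs = D} w∈))) edge-bound) inner-bound ⟩
      (3 + 6 * (2 * (28 + r) + 0)) + (3 + 6 * (2 * (28 + r) + 1)) + 2 * Δ * perFactor ≡⟨ e₁ r Δ ⟩
      (684 + 24 * r) * 1 + (354 + 12 * r) * Δ ≤⟨ +-monoˡ-≤ _ (*-monoʳ-≤ (684 + 24 * r) 1≤Δ) ⟩
      (684 + 24 * r) * Δ + (354 + 12 * r) * Δ ≡⟨ e₂ r Δ ⟩
      (1038 * 1 + 36 * r) * Δ ≤⟨ *-monoˡ-≤ Δ (+-monoˡ-≤ (36 * r) (*-monoʳ-≤ 1038 1≤r)) ⟩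
      (1038 * r + 36 * r) * Δ ≡⟨ e₃ r Δ ⟩
      1074 * (r * Δ) ≤⟨ *-monoˡ-≤ (r * Δ) windowConstant-≥ ⟩
      windowConstant * (r * Δ) ∎
      where
      open ≤-Reasoning
      e₁ : ∀ r d → (3 + 6 * (2 * (28 + r) + 0)) + (3 + 6 * (2 * (28 + r) + 1)) + 2 * d * (3 + 6 * (1 * (28 + r) + 1)) ≡ (684 + 24 * r) * 1 + (354 + 12 * r) * d
      e₁ = solve-∀
      e₂ : ∀ r d → (684 + 24 * r) * d + (354 + 12 * r) * d ≡ (1038 * 1 + 36 * r) * d
      e₂ = solve-∀
      e₃ : ∀ r d → (1038 * r + 36 * r) * d ≡ 1074 * (r * d)
      e₃ = solve-∀

-- Random orders

-- Inserting x and y in either order produces the same multiset of lists. Comparing sums expresses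
-- this without a bijection.
∑-insertions-comm : ∀ x y q (φ : List Sym → ℕ) →
  ∑ (insertions y q) (λ s → ∑ (insertions x s) φ) ≡ ∑ (insertions x q) (λ s → ∑ (insertions y s) φ)
∑-insertions-comm x y [] φ = e (φ (x ∷ y ∷ [])) (φ (y ∷ x ∷ []))
  where
  e : ∀ a b → a + (b + 0) + 0 ≡ b + (a + 0) + 0
  e = solve-∀
∑-insertions-comm x y (z ∷ q) φ =
  trans (cong₂ _+_ (cong (φ (x ∷ y ∷ z ∷ q) +_) (cong (φ (y ∷ x ∷ z ∷ q) +_) (deep x y))) (tail x y))
    (trans (rearrange (φ (x ∷ y ∷ z ∷ q)) (φ (y ∷ x ∷ z ∷ q)) _ _ _)
      (trans (cong (λ R → φ (y ∷ x ∷ z ∷ q) + (φ (x ∷ y ∷ z ∷ q) + C y x) + (C x y + R))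
               (∑-insertions-comm x y q (φ ∘ (z ∷_))))
        (sym (cong₂ _+_ (cong (φ (y ∷ x ∷ z ∷ q) +_) (cong (φ (x ∷ y ∷ z ∷ q) +_) (deep y x))) (tail y x)))))
  where
  C : Sym → Sym → ℕ
  C x y = ∑ (insertions x q) (λ s → φ (y ∷ z ∷ s))
  deep : ∀ x y → ∑ (map (y ∷_) (map (z ∷_) (insertions x q))) φ ≡ C x y
  deep x y = trans (∑-map (y ∷_) (map (z ∷_) (insertions x q)) φ) (∑-map (z ∷_) (insertions x q) _)
  tail : ∀ x y → ∑ (map (z ∷_) (insertions y q)) (λ s → ∑ (insertions x s) φ) ≡
    C y x + ∑ (insertions y q) (λ s → ∑ (insertions x s) (φ ∘ (z ∷_)))
  tail x y = trans (∑-map (z ∷_) (insertions y q) _)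
    (trans (∑-cong (insertions y q) (λ s → cong (φ (x ∷ z ∷ s) +_) (∑-map (z ∷_) (insertions x s) φ)))
      (∑-+ (insertions y q) _ _))
  rearrange : ∀ a b c d r → a + (b + c) + (d + r) ≡ b + (a + d) + (c + r)
  rearrange = solve-∀

∑-perms-∷ : ∀ x xs φ → ∑ (perms (x ∷ xs)) φ ≡ ∑ (perms xs) (λ q → ∑ (insertions x q) φ)
∑-perms-∷ x xs φ = ∑-concatMap (insertions x) (perms xs) φ

-- `perms` recurses on one listing of the symbols; averages must not depend on which.
∑-perms-↭ : ∀ {I K} → I ↭ K → ∀ φ → ∑ (perms I) φ ≡ ∑ (perms K) φ
∑-perms-↭ refl φ = refl
∑-perms-↭ (prep {xs} {ys} x p) φ =
  trans (∑-perms-∷ x xs φ) (trans (∑-perms-↭ p _) (sym (∑-perms-∷ x ys φ)))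
∑-perms-↭ (swap {xs} {ys} x y p) φ =
  trans (∑-perms-∷ x (y ∷ xs) φ) (trans (∑-perms-∷ y xs _)
    (trans (∑-cong (perms xs) (λ q → ∑-insertions-comm x y q φ))
      (trans (∑-perms-↭ p _) (sym (trans (∑-perms-∷ y (x ∷ ys) φ) (∑-perms-∷ x ys _))))))
∑-perms-↭ (transₚ p p') φ = trans (∑-perms-↭ p φ) (∑-perms-↭ p' φ)

insertions-map : ∀ (f : Sym → Sym) x q → insertions (f x) (map f q) ≡ map (map f) (insertions x q)
insertions-map f x [] = refl
insertions-map f x (y ∷ q) = cong ((f x ∷ f y ∷ map f q) ∷_) (trans (cong (map (f y ∷_)) (insertions-map f x q))
  (trans (sym (map-∘ (insertions x q))) (map-∘ (insertions x q))))

∑-perms-map : ∀ (f : Sym → Sym) I φ → ∑ (perms (map f I)) φ ≡ ∑ (perms I) (φ ∘ map f)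
∑-perms-map f [] φ = refl
∑-perms-map f (x ∷ I) φ = trans (∑-perms-∷ (f x) (map f I) φ) (trans (∑-perms-map f I _)
  (trans (∑-cong (perms I) (λ q → trans (cong (λ z → ∑ z φ) (insertions-map f x q)) (∑-map (map f) (insertions x q) φ)))
    (sym (∑-perms-∷ x I _))))

exchange : Sym → Sym → Sym → Sym
exchange a b x with x ≟ₛ a | x ≟ₛ b
... | yes _ | _ = b
... | no _ | yes _ = a
... | no _ | no _ = x

exchange-l : ∀ a b → exchange a b a ≡ b
exchange-l a b with a ≟ₛ a
... | yes _ = refl
... | no n = contradiction refl n

exchange-r : ∀ a b → exchange a b b ≡ a
exchange-r a b with b ≟ₛ a | b ≟ₛ b
... | yes e | _ = e
... | no _ | yes _ = refl
... | no _ | no n = contradiction refl n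

exchange-other : ∀ {a b x} → x ≢ a → x ≢ b → exchange a b x ≡ x
exchange-other {a} {b} {x} na nb with x ≟ₛ a | x ≟ₛ b
... | yes e | _ = contradiction e na
... | no _ | yes e = contradiction e nb
... | no _ | no _ = refl

exchange-involutive : ∀ a b x → exchange a b (exchange a b x) ≡ x
exchange-involutive a b x with x ≟ₛ a | x ≟ₛ b
... | yes refl | _ = exchange-r a b
... | no _ | yes refl = exchange-l a b
... | no na | no nb = exchange-other na nb

rank-map : ∀ {f : Sym → Sym} → (∀ {x y} → f x ≡ f y → x ≡ y) → ∀ q x → rank (map f q) (f x) ≡ rank q x
rank-map inj [] x = refl
rank-map {f} inj (y ∷ q) x with x ≟ₛ y
... | yes refl rewrite symEq-refl y | symEq-refl (f y) = refl
... | no n rewrite symEq-≢ n | symEq-≢ (n ∘ inj {x} {y}) = cong suc (rank-map inj q x)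

rank-exchange : ∀ a b q x → rank (map (exchange a b) q) x ≡ rank q (exchange a b x)
rank-exchange a b q x = trans (cong (rank (map (exchange a b) q)) (sym (exchange-involutive a b x)))
  (rank-map (λ {x} {y} e → trans (sym (exchange-involutive a b x)) (trans (cong (exchange a b) e) (exchange-involutive a b y)))
    q (exchange a b x))

unique-resp-↭ : ∀ {xs ys : List Sym} → xs ↭ ys → Unique xs → Unique ys
unique-resp-↭ refl u = u
unique-resp-↭ (prep x p) (x∉ ∷ u) = All-resp-↭ p x∉ ∷ unique-resp-↭ p u
unique-resp-↭ (swap x y p) ((x≢y ∷ x∉) ∷ (y∉ ∷ u)) =
  ((x≢y ∘ sym) ∷ All-resp-↭ p y∉) ∷ (All-resp-↭ p x∉ ∷ unique-resp-↭ p u)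
unique-resp-↭ (transₚ p p') u = unique-resp-↭ p' (unique-resp-↭ p u)

extract : ∀ {a : Sym} {I} → a ∈ I → ∃ λ R → I ↭ a ∷ R
extract {a} a∈ with ∈-∃++ a∈
... | as , bs , refl = as ++ bs , shift a as bs

-- With a and b moved to the front, relabelling only swaps these two entries, so it yields another
-- listing of the same symbols.
∑-perms-exchange : ∀ {a b I} → a ≢ b → a ∈ I → b ∈ I → Unique I → ∀ φ →
  ∑ (perms I) (φ ∘ map (exchange a b)) ≡ ∑ (perms I) φ
∑-perms-exchange {a} {b} {I} a≢b a∈ b∈ u φ with extract a∈
... | R , p with ∈-resp-↭ p b∈
...   | here b≡a = contradiction (sym b≡a) a≢b
...   | there b∈R with extract b∈R
...     | R' , p' = trans (∑-perms-↭ front _) (trans (sym (∑-perms-map (exchange a b) (a ∷ b ∷ R') φ))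
          (trans (cong (λ z → ∑ (perms z) φ) (cong₂ _∷_ (exchange-l a b) (cong₂ _∷_ (exchange-r a b) fixed)))
            (trans (∑-perms-↭ (swap {xs = R'} b a refl) φ) (sym (∑-perms-↭ front φ)))))
  where
  front : I ↭ a ∷ b ∷ R'
  front = ↭-trans p (↭-prep a p')
  fixed : map (exchange a b) R' ≡ R'
  fixed with unique-resp-↭ front u
  ... | (_ ∷ a∉) ∷ (b∉ ∷ _) = map-id-local (All.tabulate λ x∈ →
    exchange-other (λ { refl → All.lookup a∉ x∈ refl }) (λ { refl → All.lookup b∉ x∈ refl }))

ind : Bool → ℕ
ind true = 1
ind false = 0

ind-mono : ∀ {b c} → (b ≡ true → c ≡ true) → ind b ≤ ind c
ind-mono {true} h rewrite h refl = ≤-refl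
ind-mono {false} h = z≤n

ordered : Bool → ℕ → ℕ → Bool
ordered true m n = m <ᵇ n
ordered false m n = n <ᵇ m

ordered-asym : ∀ d m n c → ind (ordered d m n ∧ c) + ind (ordered d n m ∧ c) ≤ ind c
ordered-asym true m n c with m <ᵇ n in e | n <ᵇ m in f
... | true | true = contradiction (<ᵇ-sound m n e) (<-asym (<ᵇ-sound n m f))
... | true | false = ≤-reflexive (+-identityʳ (ind c))
... | false | true = ≤-refl
... | false | false = z≤n
ordered-asym false m n c = ordered-asym true n m c

-- u lists the pairs (u₁,u₂), (u₃,u₄), …
pairsOrdered : Bool → (Sym → ℕ) → List Sym → Bool
pairsOrdered d π (x ∷ y ∷ u) = ordered d (π x) (π y) ∧ pairsOrdered d π u
pairsOrdered d π _ = true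

pairsOrdered-cong : ∀ d {π ρ} u → (∀ {x} → x ∈ u → π x ≡ ρ x) → pairsOrdered d π u ≡ pairsOrdered d ρ u
pairsOrdered-cong d [] h = refl
pairsOrdered-cong d (_ ∷ []) h = refl
pairsOrdered-cong d (x ∷ y ∷ u) h = cong₂ _∧_
  (cong₂ (ordered d) (h (here refl)) (h (there (here refl)))) (pairsOrdered-cong d u (h ∘ there ∘ there))

-- Exchanging the two members of a pair halves the count.
pairs-halving : ∀ d I → Unique I → ∀ s u → Unique u → (∀ {x} → x ∈ u → x ∈ I) → s + s ≤ length u →
  ∑ (perms I) (λ q → ind (pairsOrdered d (rank q) u)) * 2 ^ s ≤ length (perms I)
pairs-halving d I uI zero u _ _ _ = ≤-trans (≤-reflexive (*-identityʳ _))
  (≤-trans (∑-mono (perms I) (λ _ → ind≤1 _)) (≤-reflexive (∑-one (perms I))))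
  where
  ind≤1 : ∀ b → ind b ≤ 1
  ind≤1 true = ≤-refl
  ind≤1 false = z≤n
pairs-halving d I uI (suc s) (_ ∷ []) _ _ len = contradiction (≤-pred len) (<⇒≱ (≤-trans (s≤s z≤n) (≤-reflexive (sym (+-suc s s)))))
pairs-halving d I uI (suc s) (a ∷ b ∷ u) ((a≢b ∷ a∉) ∷ (b∉ ∷ uu)) u⊆I len =
  ≤-trans (≤-reflexive (sym (*-assoc (∑ (perms I) φ) 2 (2 ^ s)))) (≤-trans (*-monoˡ-≤ (2 ^ s) twice)
    (pairs-halving d I uI s u uu (u⊆I ∘ there ∘ there) (≤-pred (≤-trans (≤-reflexive (sym (+-suc s s))) (≤-pred len)))))
  where
  φ : List Sym → ℕ
  φ q = ind (pairsOrdered d (rank q) (a ∷ b ∷ u))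
  swapped : ∀ q → φ (map (exchange a b) q) ≡ ind (ordered d (rank q b) (rank q a) ∧ pairsOrdered d (rank q) u)
  swapped q = cong ind (cong₂ _∧_
    (cong₂ (ordered d) (trans (rank-exchange a b q a) (cong (rank q) (exchange-l a b)))
                       (trans (rank-exchange a b q b) (cong (rank q) (exchange-r a b))))
    (pairsOrdered-cong d u λ {x} x∈ → trans (rank-exchange a b q x) (cong (rank q)
      (exchange-other (λ { refl → All.lookup a∉ x∈ refl }) (λ { refl → All.lookup b∉ x∈ refl })))))
  twice : ∑ (perms I) φ * 2 ≤ ∑ (perms I) (λ q → ind (pairsOrdered d (rank q) u))
  twice = begin
    ∑ (perms I) φ * 2                ≡⟨ *-comm (∑ (perms I) φ) 2 ⟩
    ∑ (perms I) φ + (∑ (perms I) φ + 0) ≡⟨ cong (∑ (perms I) φ +_) (+-identityʳ _) ⟩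
    ∑ (perms I) φ + ∑ (perms I) φ    ≡⟨ cong (∑ (perms I) φ +_) (sym (∑-perms-exchange a≢b (u⊆I (here refl)) (u⊆I (there (here refl))) uI φ)) ⟩
    ∑ (perms I) φ + ∑ (perms I) (φ ∘ map (exchange a b)) ≡⟨ sym (∑-+ (perms I) φ _) ⟩
    ∑ (perms I) (λ q → φ q + φ (map (exchange a b) q))
      ≤⟨ ∑-mono (perms I) (λ {q} _ → ≤-trans (≤-reflexive (cong (φ q +_) (swapped q))) (ordered-asym d (rank q a) (rank q b) _)) ⟩
    ∑ (perms I) (λ q → ind (pairsOrdered d (rank q) u)) ∎
    where open ≤-Reasoning

rank-++ : ∀ {x} p q → x ∉ p → rank (p ++ q) x ≡ length p + rank q x
rank-++ [] q x∉ = refl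
rank-++ {x} (y ∷ p) q x∉ with x ≟ₛ y
... | yes e = contradiction (here e) x∉
... | no n rewrite symEq-≢ n = cong suc (rank-++ p q (x∉ ∘ there))

rank-prefix : ∀ {x} p q → x ∈ p → rank (p ++ q) x ≤ length p
rank-prefix {x} (y ∷ p) q x∈ with x ≟ₛ y
... | yes refl rewrite symEq-refl x = s≤s z≤n
... | no n rewrite symEq-≢ n = s≤s (rank-prefix p q (Any.tail n x∈))

rank-positive : ∀ {x} q → x ∈ q → 1 ≤ rank q x
rank-positive {x} (y ∷ q) x∈ with symEq x y
... | true = ≤-refl
... | false = s≤s z≤n

rank-injective : ∀ {x y} o → x ∈ o → y ∈ o → rank o x ≡ rank o y → x ≡ y
rank-injective {x} {y} (z ∷ o) x∈ y∈ e with x ≟ₛ z | y ≟ₛ z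
... | yes p | yes q = trans p (sym q)
... | yes refl | no n rewrite symEq-refl x | symEq-≢ n =
  contradiction (rank-positive o (Any.tail n y∈)) (<⇒≱ (≤-reflexive (cong suc (sym (suc-injective e)))))
... | no n | yes refl rewrite symEq-refl y | symEq-≢ n =
  contradiction (rank-positive o (Any.tail n x∈)) (<⇒≱ (≤-reflexive (cong suc (suc-injective e))))
... | no n | no m rewrite symEq-≢ n | symEq-≢ m = rank-injective o (Any.tail n x∈) (Any.tail m y∈) (suc-injective e)

insertions-↭ : ∀ x q {s} → s ∈ insertions x q → s ↭ x ∷ q
insertions-↭ x [] (here refl) = ↭-refl
insertions-↭ x (y ∷ q) (here refl) = ↭-refl
insertions-↭ x (y ∷ q) (there s∈) with ∈-map⁻ (y ∷_) s∈
... | s' , s'∈ , refl = ↭-trans (↭-prep y (insertions-↭ x q s'∈)) (swap y x refl)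

perms-↭ : ∀ I {q} → q ∈ perms I → q ↭ I
perms-↭ [] (here refl) = ↭-refl
perms-↭ (x ∷ I) q∈ with find (∈-concatMap⁻ (insertions x) {xs = perms I} q∈)
... | q' , q'∈ , q∈' = ↭-trans (insertions-↭ x q' q∈') (↭-prep x (perms-↭ I q'∈))

elemB-sound : ∀ x xs → elemB x xs ≡ true → x ∈ xs
elemB-sound x (y ∷ ys) e with x ≟ₛ y
... | yes p = here p
... | no n rewrite symEq-≢ n = there (elemB-sound x ys e)

elemB-complete : ∀ {x xs} → x ∈ xs → elemB x xs ≡ true
elemB-complete {x} (here refl) rewrite symEq-refl x = refl
elemB-complete {x} {y ∷ ys} (there p) rewrite elemB-complete p = ∨-zeroʳ (symEq x y)

dedup-∈ : ∀ {x xs} → x ∈ xs → x ∈ dedup xs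
dedup-∈ {x} {y ∷ ys} x∈ with elemB y ys in e | x∈
... | true | here refl = dedup-∈ (elemB-sound y ys e)
... | true | there p = dedup-∈ p
... | false | here refl = here refl
... | false | there p = there (dedup-∈ p)

∈-dedup : ∀ {x} xs → x ∈ dedup xs → x ∈ xs
∈-dedup (y ∷ ys) x∈ with elemB y ys
... | true = there (∈-dedup ys x∈)
∈-dedup (y ∷ ys) (here p) | false = here p
∈-dedup (y ∷ ys) (there x∈) | false = there (∈-dedup ys x∈)

dedup-unique : ∀ xs → Unique (dedup xs)
dedup-unique [] = []
dedup-unique (x ∷ xs) with elemB x xs in e
... | true = dedup-unique xs
... | false = All.tabulate (λ { y∈ refl → true≢false (elemB-complete (∈-dedup xs y∈)) e }) ∷ dedup-unique xs

filterᵇ-∈ : ∀ {A : Set} (f : A → Bool) {x xs} → x ∈ xs → f x ≡ true → x ∈ filterᵇ f xs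
filterᵇ-∈ f (here refl) e rewrite e = here refl
filterᵇ-∈ f {xs = y ∷ _} (there p) e with f y
... | true = there (filterᵇ-∈ f p e)
... | false = filterᵇ-∈ f p e

∈-filterᵇ : ∀ {A : Set} (f : A → Bool) {x} xs → x ∈ filterᵇ f xs → x ∈ xs × f x ≡ true
∈-filterᵇ f (y ∷ ys) x∈ with f y in e
∈-filterᵇ f (y ∷ ys) (here refl) | true = here refl , e
∈-filterᵇ f (y ∷ ys) (there x∈) | true with ∈-filterᵇ f ys x∈
... | p , q = there p , q
∈-filterᵇ f (y ∷ ys) x∈ | false with ∈-filterᵇ f ys x∈
... | p , q = there p , q

filterᵇ-unique : ∀ {A : Set} (f : A → Bool) {xs} → Unique xs → Unique (filterᵇ f xs)
filterᵇ-unique f [] = []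
filterᵇ-unique f {x ∷ xs} (x∉ ∷ u) with f x
... | true = All.tabulate (λ y∈ → All.lookup x∉ (proj₁ (∈-filterᵇ f xs y∈))) ∷ filterᵇ-unique f u
... | false = filterᵇ-unique f u

outSyms inSyms : ℕ → List Sym → List Sym
outSyms k T = filterᵇ (λ A → not (inA k A)) (dedup T)
inSyms k T = filterᵇ (inA k) (dedup T)

∑-orders : ∀ k T φ → ∑ (admissibleOrders k T) φ ≡
  ∑ (perms (outSyms k T)) (λ p → ∑ (perms (inSyms k T)) (λ q → φ (p ++ q)))
∑-orders k T φ = trans (∑-concatMap _ (perms (outSyms k T)) φ)
  (∑-cong (perms (outSyms k T)) (λ p → ∑-map (p ++_) (perms (inSyms k T)) φ))

order-parts : ∀ k T {o} → o ∈ admissibleOrders k T → ∃₂ λ p q →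
  o ≡ p ++ q × p ↭ outSyms k T × q ↭ inSyms k T
order-parts k T o∈ with find (∈-concatMap⁻ (λ p → map (p ++_) (perms (inSyms k T))) {xs = perms (outSyms k T)} o∈)
... | p , p∈ , o∈' with ∈-map⁻ (p ++_) o∈'
...   | q , q∈ , refl = p , q , refl , perms-↭ (outSyms k T) p∈ , perms-↭ (inSyms k T) q∈

∈-outSyms : ∀ k T {x} → x ∈ outSyms k T → inA k x ≡ false
∈-outSyms k T {x} x∈ with inA k x | proj₂ (∈-filterᵇ (λ A → not (inA k A)) (dedup T) x∈)
... | false | _ = refl

outs-first : ∀ k T p {x} → p ↭ outSyms k T → inA k x ≡ true → x ∉ p
outs-first k T p p↭ ix x∈ = true≢false ix (∈-outSyms k T (∈-resp-↭ p↭ x∈))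

order-outsBelow : ∀ k T {o} → o ∈ admissibleOrders k T → OutsBelow k (rank o) (_∈ T)
order-outsBelow k T o∈ {z} {x} z∈ x∈ ez ex with order-parts k T o∈
... | p , q , refl , p↭ , q↭ = ≤-trans (s≤s (rank-prefix p q z∈p))
  (≤-trans (≤-trans (≤-reflexive (+-comm 1 (length p))) (+-monoʳ-≤ (length p) (rank-positive q x∈q)))
    (≤-reflexive (sym (rank-++ p q (outs-first k T p p↭ ex)))))
  where
  z∈p : z ∈ p
  z∈p = ∈-resp-↭ (↭-sym p↭) (filterᵇ-∈ _ (dedup-∈ z∈) (cong not ez))
  x∈q : x ∈ q
  x∈q = ∈-resp-↭ (↭-sym q↭) (filterᵇ-∈ _ (dedup-∈ x∈) ex)

order-injective : ∀ k T {o} → o ∈ admissibleOrders k T → ∀ {x y} → x ∈ T → y ∈ T → rank o x ≡ rank o y → x ≡ y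
order-injective k T {o} o∈ x∈ y∈ with order-parts k T o∈
... | p , q , refl , p↭ , q↭ = rank-injective (p ++ q) (mem x∈) (mem y∈)
  where
  mem : ∀ {x} → x ∈ T → x ∈ p ++ q
  mem {x} x∈ with inA k x in e
  ... | true = ∈-++⁺ʳ p (∈-resp-↭ (↭-sym q↭) (filterᵇ-∈ (inA k) (dedup-∈ x∈) e))
  ... | false = ∈-++⁺ˡ (∈-resp-↭ (↭-sym p↭) (filterᵇ-∈ (λ A → not (inA k A)) (dedup-∈ x∈) (cong not e)))

monotone : Bool → (Sym → ℕ) → List Sym → Bool
monotone d π (x ∷ y ∷ u) = ordered d (π x) (π y) ∧ monotone d π (y ∷ u)
monotone d π _ = true

monotone-drop : ∀ d π m w → monotone d π w ≡ true → monotone d π (drop m w) ≡ true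
monotone-drop d π zero w e = e
monotone-drop d π (suc m) [] e = refl
monotone-drop d π (suc zero) (x ∷ []) e = refl
monotone-drop d π (suc (suc m)) (x ∷ []) e = refl
monotone-drop d π (suc m) (x ∷ y ∷ w) e = monotone-drop d π m (y ∷ w) (∧-conicalʳ (ordered d (π x) (π y)) _ e)

monotone-pairs : ∀ d π u → monotone d π u ≡ true → pairsOrdered d π u ≡ true
monotone-pairs d π [] e = refl
monotone-pairs d π (_ ∷ []) e = refl
monotone-pairs d π (x ∷ y ∷ u) e = cong₂ _∧_ (∧-conicalˡ _ _ e)
  (monotone-pairs d π u (rest u (∧-conicalʳ (ordered d (π x) (π y)) _ e)))
  where
  rest : ∀ u → monotone d π (y ∷ u) ≡ true → monotone d π u ≡ true
  rest [] _ = refl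
  rest (z ∷ u) e = ∧-conicalʳ (ordered d (π y) (π z)) _ e

monotone-unique : ∀ d π u → monotone d π u ≡ true → Unique u
monotone-unique d π [] e = []
monotone-unique d π (x ∷ u) e = All.map (distinct d) (beyond d x u e) ∷ monotone-unique d π u (rest u e)
  where
  rest : ∀ {x} u → monotone d π (x ∷ u) ≡ true → monotone d π u ≡ true
  rest [] _ = refl
  rest {x} (z ∷ u) e = ∧-conicalʳ (ordered d (π x) (π z)) _ e
  Beyond : Bool → Sym → Sym → Set
  Beyond d x y = ordered d (π x) (π y) ≡ true
  transitive : ∀ d {x y z} → Beyond d x y → Beyond d y z → Beyond d x z
  transitive true {x} {y} {z} p q = <ᵇ-complete (<-trans (<ᵇ-sound (π x) (π y) p) (<ᵇ-sound (π y) (π z) q))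
  transitive false {x} {y} {z} p q = <ᵇ-complete (<-trans (<ᵇ-sound (π z) (π y) q) (<ᵇ-sound (π y) (π x) p))
  distinct : ∀ d {x y} → Beyond d x y → x ≢ y
  distinct true {x} p refl = <-irrefl refl (<ᵇ-sound (π x) (π x) p)
  distinct false {x} p refl = <-irrefl refl (<ᵇ-sound (π x) (π x) p)
  beyond : ∀ d x u → monotone d π (x ∷ u) ≡ true → All (Beyond d x) u
  beyond d x [] e = []
  beyond d x (y ∷ u) e = ∧-conicalˡ _ _ e ∷
    All.map (transitive d (∧-conicalˡ _ _ e)) (beyond d y u (∧-conicalʳ (ordered d (π x) (π y)) _ e))

-- Monotonicity is weakened to the order within s disjoint pairs, each of which costs a factor 2.
-- The order p of the long symbols is held fixed; it shifts the ranks of the short ones by |p|.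
monotone-count : ∀ k T d s u → (∀ {x} → x ∈ u → x ∈ T × inA k x ≡ true) → s + s ≤ length u →
  ∑ (admissibleOrders k T) (λ o → ind (monotone d (rank o) u)) * 2 ^ s ≤ length (admissibleOrders k T)
monotone-count k T d s u u⊆ len = begin
  ∑ O (λ o → ind (monotone d (rank o) u)) * 2 ^ s
    ≡⟨ cong (_* 2 ^ s) (∑-orders k T _) ⟩
  ∑ P (λ p → ∑ Q (λ q → ind (monotone d (rank (p ++ q)) u))) * 2 ^ s
    ≡⟨ trans (*-comm _ (2 ^ s)) (sym (∑-* (2 ^ s) P _)) ⟩
  ∑ P (λ p → 2 ^ s * ∑ Q (λ q → ind (monotone d (rank (p ++ q)) u)))
    ≤⟨ ∑-mono P (λ {p} p∈ → ≤-trans (≤-reflexive (*-comm (2 ^ s) (∑ Q (λ q → ind (monotone d (rank (p ++ q)) u))))) (per-prefix p p∈)) ⟩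
  ∑ P (λ _ → length Q)
    ≡⟨ trans (∑-cong P (λ p → sym (∑-one Q))) (trans (sym (∑-orders k T (λ _ → 1))) (∑-one O)) ⟩
  length O ∎
  where
  open ≤-Reasoning
  O = admissibleOrders k T
  P = perms (outSyms k T)
  Q = perms (inSyms k T)
  u⊆I : ∀ {x} → x ∈ u → x ∈ inSyms k T
  u⊆I x∈ = filterᵇ-∈ (inA k) (dedup-∈ (proj₁ (u⊆ x∈))) (proj₂ (u⊆ x∈))
  per-prefix : ∀ p → p ∈ P → ∑ Q (λ q → ind (monotone d (rank (p ++ q)) u)) * 2 ^ s ≤ length Q
  per-prefix p p∈ with allPairs? (λ x y → ¬? (x ≟ₛ y)) u
  -- A repeated symbol rules out strict monotonicity, so the sum vanishes.
  ... | no nu = ≤-trans (≤-reflexive (cong (_* 2 ^ s) (trans (∑-cong Q none) (trans (∑-const Q 0) (*-zeroʳ (length Q)))))) z≤n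
    where
    none : ∀ q → ind (monotone d (rank (p ++ q)) u) ≡ 0
    none q with monotone d (rank (p ++ q)) u in e
    ... | true = contradiction (monotone-unique d _ u e) nu
    ... | false = refl
  ... | yes uu = ≤-trans (*-monoˡ-≤ (2 ^ s) (∑-mono Q λ {q} _ → ind-mono λ e →
      trans (sym (shifted q)) (monotone-pairs d (rank (p ++ q)) u e)))
      (pairs-halving d (inSyms k T) (filterᵇ-unique (inA k) (dedup-unique T)) s u uu u⊆I len)
    where
    shift-ordered : ∀ d m a b → ordered d (m + a) (m + b) ≡ ordered d a b
    shift-ordered true zero a b = refl
    shift-ordered false zero a b = refl
    shift-ordered true (suc m) a b = shift-ordered true m a b
    shift-ordered false (suc m) a b = shift-ordered false m a b
    shift-pairs : ∀ m π u → pairsOrdered d (λ x → m + π x) u ≡ pairsOrdered d π u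
    shift-pairs m π [] = refl
    shift-pairs m π (_ ∷ []) = refl
    shift-pairs m π (x ∷ y ∷ u) = cong₂ _∧_ (shift-ordered d m (π x) (π y)) (shift-pairs m π u)
    shifted : ∀ q → pairsOrdered d (rank (p ++ q)) u ≡ pairsOrdered d (rank q) u
    shifted q = trans (pairsOrdered-cong d u λ x∈ →
        rank-++ p q (outs-first k T p (perms-↭ (outSyms k T) p∈) (proj₂ (u⊆ x∈))))
      (shift-pairs (length p) (rank q) u)

DistinctNeighbours : (Sym → ℕ) → List Sym → Set
DistinctNeighbours π w = ∀ U x y V → w ≡ U ++ x ∷ y ∷ V → π x ≢ π y

descend : ∀ k π {x} y r → All (λ z → inA k z ≡ true) (y ∷ r) → DistinctNeighbours π (x ∷ y ∷ r) →
  π y < π x → noCut (evenRule k π) (just x) (y ∷ r) ≡ true → monotone false π (x ∷ y ∷ r) ≡ true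
descend k π y [] ins dn lt nc = cong₂ _∧_ (<ᵇ-complete lt) refl
descend k π {x} y (z ∷ r) (iy ∷ iz ∷ ins) dn lt nc =
  cong₂ _∧_ (<ᵇ-complete lt) (descend k π z r (iz ∷ ins) (λ U a b V e → dn (x ∷ U) a b V (cong (x ∷_) e)) z<y
    (∧-conicalʳ (not (evenRule k π (just x) y z)) _ nc))
  where
  no-min : locMin π (just x) y z ≡ false
  no-min with locMin π (just x) y z | trans (sym (evenRule-in k π {just x} {y} {z} iy iz)) (not-true (∧-conicalˡ _ _ nc))
    where
    not-true : ∀ {b} → not b ≡ true → b ≡ false
    not-true {false} _ = refl
  ... | false | _ = refl
  z<y : π z < π y
  z<y = ≤∧≢⇒< (≮⇒≥ λ y<z → true≢false (cong₂ _∧_ (<ᵇ-complete lt) (<ᵇ-complete y<z)) no-min)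
    (λ e → dn (x ∷ []) y z r refl (sym e))

-- Without an inner local minimum the ranks rise and then fall. If the fall begins among the first m
-- symbols, everything behind them is falling.
bitonic : ∀ k π p m w → All (λ z → inA k z ≡ true) w → DistinctNeighbours π w →
  noCut (evenRule k π) p w ≡ true → monotone true π (take m w) ≡ true ⊎ monotone false π (drop m w) ≡ true
bitonic k π p zero w ins dn nc = inj₁ refl
bitonic k π p (suc m) [] ins dn nc = inj₁ refl
bitonic k π p (suc zero) (x ∷ w) ins dn nc = inj₁ refl
bitonic k π p (suc (suc m)) (x ∷ []) ins dn nc = inj₁ refl
bitonic k π p (suc (suc m)) (x ∷ y ∷ r) (_ ∷ ins) dn nc with π x <? π y
... | yes lt with bitonic k π (just x) (suc m) (y ∷ r) ins (λ U a b V e → dn (x ∷ U) a b V (cong (x ∷_) e))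
                    (∧-conicalʳ (not (evenRule k π p x y)) _ nc)
...   | inj₁ up = inj₁ (cong₂ _∧_ (<ᵇ-complete lt) up)
...   | inj₂ down = inj₂ down
bitonic k π p (suc (suc m)) (x ∷ y ∷ r) (_ ∷ ins) dn nc | no ge =
  inj₂ (monotone-drop false π (suc m) (y ∷ r) (∧-conicalʳ (ordered false (π x) (π y)) _
    (descend k π y r ins dn (≤∧≢⇒< (≮⇒≥ ge) (λ e → dn [] x y r refl (sym e)))
      (∧-conicalʳ (not (evenRule k π p x y)) _ nc))))

-- Of the two parts of w, cut after 2 s symbols, the first rises or the second falls. Each has s
-- disjoint pairs, and the factor 2 is the union bound.
noCut-count : ∀ k T s w → (∀ {x} → x ∈ w → x ∈ T × inA k x ≡ true) →
  (∀ U x y V → w ≡ U ++ x ∷ y ∷ V → x ≢ y) → 4 * s ≤ length w →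
  ∑ (admissibleOrders k T) (λ o → ind (noCut (evenRule k (rank o)) nothing w)) * 2 ^ s
    ≤ 2 * length (admissibleOrders k T)
noCut-count k T s w w⊆ distinct len = begin
  ∑ O (λ o → ind (noCut (evenRule k (rank o)) nothing w)) * 2 ^ s
    ≤⟨ *-monoˡ-≤ (2 ^ s) (∑-mono O halves) ⟩
  ∑ O (λ o → ind (monotone true (rank o) u) + ind (monotone false (rank o) v)) * 2 ^ s
    ≡⟨ trans (cong (_* 2 ^ s) (∑-+ O _ _)) (*-distribʳ-+ (2 ^ s) (∑ O (λ o → ind (monotone true (rank o) u))) _) ⟩
  ∑ O (λ o → ind (monotone true (rank o) u)) * 2 ^ s + ∑ O (λ o → ind (monotone false (rank o) v)) * 2 ^ s
    ≤⟨ +-mono-≤ (monotone-count k T true s u (w⊆ ∘ ∈-take) u-long) (monotone-count k T false s v (w⊆ ∘ ∈-drop) v-long) ⟩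
  length O + length O
    ≡⟨ cong (length O +_) (sym (+-identityʳ _)) ⟩
  2 * length O ∎
  where
  open ≤-Reasoning
  O = admissibleOrders k T
  u v : List Sym
  u = take (s + s) w
  v = drop (s + s) w
  ∈-take : ∀ {x} → x ∈ u → x ∈ w
  ∈-take x∈ = subst (_ ∈_) (take++drop≡id (s + s) w) (∈-++⁺ˡ x∈)
  ∈-drop : ∀ {x} → x ∈ v → x ∈ w
  ∈-drop x∈ = subst (_ ∈_) (take++drop≡id (s + s) w) (∈-++⁺ʳ u x∈)
  4s : 4 * s ≡ (s + s) + (s + s)
  4s = e s where
    e : ∀ s → 4 * s ≡ (s + s) + (s + s)
    e = solve-∀
  2s≤ : s + s ≤ length w
  2s≤ = ≤-trans (m≤m+n (s + s) (s + s)) (≤-trans (≤-reflexive (sym 4s)) len)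
  u-long : s + s ≤ length u
  u-long = ≤-reflexive (sym (trans (length-take (s + s) w) (m≤n⇒m⊓n≡m 2s≤)))
  v-long : s + s ≤ length v
  v-long = ≤-trans (m+n≤o⇒m≤o∸n (s + s) (≤-trans (≤-reflexive (sym 4s)) len)) (≤-reflexive (sym (length-drop (s + s) w)))
  halves : ∀ {o} → o ∈ O → ind (noCut (evenRule k (rank o)) nothing w) ≤
    ind (monotone true (rank o) u) + ind (monotone false (rank o) v)
  halves {o} o∈ with noCut (evenRule k (rank o)) nothing w in nc
  ... | false = z≤n
  ... | true with bitonic k (rank o) nothing (s + s) w (All.tabulate (proj₂ ∘ w⊆)) dn nc
    where
    dn : DistinctNeighbours (rank o) w
    dn U x y V refl e = distinct U x y V refl (order-injective k T o∈
      (proj₁ (w⊆ (∈-++⁺ʳ U (here refl)))) (proj₁ (w⊆ (∈-++⁺ʳ U (there (here refl))))) e)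
  ...   | inj₁ up rewrite up = s≤s z≤n
  ...   | inj₂ down rewrite down = m≤n+m 1 _

-- Rational averages bounded by natural numbers

toℚᵘ-fromℕ : ∀ n → toℚᵘ (fromℕ n) ℚᵘ.≃ mkℚᵘ (ℤ.+ n) 0
toℚᵘ-fromℕ n = ℚₚ.toℚᵘ-fromℚᵘ (mkℚᵘ (ℤ.+ n) 0)

fromℕ-mono : ∀ m n → m ≤ n → fromℕ m ≤ℚ fromℕ n
fromℕ-mono m n h = ℚₚ.toℚᵘ-cancel-≤ (ℚᵘₚ.≤-respˡ-≃ (ℚᵘₚ.≃-sym (toℚᵘ-fromℕ m))
  (ℚᵘₚ.≤-respʳ-≃ (ℚᵘₚ.≃-sym (toℚᵘ-fromℕ n)) (ℚᵘ.*≤* (ℤₚ.*-monoʳ-≤-nonNeg (ℤ.+ 1) (ℤ.+≤+ h)))))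

fromℕ-+ : ∀ m n → fromℕ (m + n) ≡ fromℕ m +ℚ fromℕ n
fromℕ-+ m n = ℚₚ.toℚᵘ-injective (ℚᵘₚ.≃-trans (toℚᵘ-fromℕ (m + n)) (ℚᵘₚ.≃-sym
  (ℚᵘₚ.≃-trans (ℚₚ.toℚᵘ-homo-+ (fromℕ m) (fromℕ n))
    (ℚᵘₚ.≃-trans (ℚᵘₚ.+-cong (toℚᵘ-fromℕ m) (toℚᵘ-fromℕ n))
      (ℚᵘ.*≡* (cong (ℤ._* ℤ.+ 1) (cong₂ ℤ._+_ (ℤₚ.*-identityʳ (ℤ.+ m)) (ℤₚ.*-identityʳ (ℤ.+ n)))))))))

fromℕ-* : ∀ m n → fromℕ (m * n) ≡ fromℕ m *ℚ fromℕ n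
fromℕ-* m n = ℚₚ.toℚᵘ-injective (ℚᵘₚ.≃-trans (toℚᵘ-fromℕ (m * n)) (ℚᵘₚ.≃-sym
  (ℚᵘₚ.≃-trans (ℚₚ.toℚᵘ-homo-* (fromℕ m) (fromℕ n))
    (ℚᵘₚ.≃-trans (ℚᵘₚ.*-cong (toℚᵘ-fromℕ m) (toℚᵘ-fromℕ n))
      (ℚᵘ.*≡* (cong (ℤ._* ℤ.+ 1) (sym (ℤₚ.pos-* m n))))))))

fromℕ-cancel-≤ : ∀ {m n} → fromℕ m ≤ℚ fromℕ n → m ≤ n
fromℕ-cancel-≤ {m} {n} h with ℚᵘₚ.≤-respˡ-≃ (toℚᵘ-fromℕ m) (ℚᵘₚ.≤-respʳ-≃ (toℚᵘ-fromℕ n) (ℚₚ.toℚᵘ-mono-≤ h))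
... | ℚᵘ.*≤* le = ℤₚ.drop‿+≤+ (subst₂ ℤ._≤_ (ℤₚ.*-identityʳ (ℤ.+ m)) (ℤₚ.*-identityʳ (ℤ.+ n)) le)

fromℕ-nonNegative : ∀ n → ℚ.NonNegative (fromℕ n)
fromℕ-nonNegative n = ℚₚ.normalize-nonNeg n 1

unit : ℕ → ℚ
unit n = ℤ.+ 1 ℚ./ suc n

unit-nonNegative : ∀ n → ℚ.NonNegative (unit n)
unit-nonNegative n = ℚₚ.normalize-nonNeg 1 (suc n)

fromℕ-*-unit : ∀ n → fromℕ (suc n) *ℚ unit n ≡ fromℕ 1
fromℕ-*-unit n = ℚₚ.toℚᵘ-injective (ℚᵘₚ.≃-trans (ℚₚ.toℚᵘ-homo-* (fromℕ (suc n)) (unit n))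
  (ℚᵘₚ.≃-trans (ℚᵘₚ.*-cong (toℚᵘ-fromℕ (suc n)) (ℚₚ.toℚᵘ-fromℚᵘ (mkℚᵘ (ℤ.+ 1) n)))
    (ℚᵘₚ.≃-trans (ℚᵘ.*≡* (trans (cong (ℤ._* ℤ.+ 1) (ℤₚ.*-identityʳ (ℤ.+ suc n)))
        (trans (ℤₚ.*-identityʳ (ℤ.+ suc n)) (sym (trans (ℤₚ.*-identityˡ _) (ℤₚ.*-identityˡ _))))))
      (ℚᵘₚ.≃-sym (toℚᵘ-fromℕ 1)))))

sumℚ-bound : ∀ {X : Set} (xs : List X) (F : X → ℚ) (g : X → ℕ) →
  (∀ {x} → x ∈ xs → F x ≤ℚ fromℕ (g x)) → sumℚ (map F xs) ≤ℚ fromℕ (∑ xs g)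
sumℚ-bound [] F g h = ℚₚ.≤-refl
sumℚ-bound (x ∷ xs) F g h = ℚₚ.≤-trans
  (ℚₚ.+-mono-≤ (h (here refl)) (sumℚ-bound xs F g (h ∘ there)))
  (ℚₚ.≤-reflexive (sym (fromℕ-+ (g x) _)))

mean-bound : ∀ {X : Set} (xs : List X) (F : X → ℚ) (g : X → ℕ) B →
  (∀ {x} → x ∈ xs → F x ≤ℚ fromℕ (g x)) → ∑ xs g ≤ length xs * B → mean (map F xs) ≤ℚ fromℕ B
mean-bound [] F g B h le = fromℕ-mono 0 B z≤n
mean-bound xs@(x ∷ xs') F g B h le = begin
  sumℚ (map F xs) *ℚ unit (length (map F xs'))
    ≡⟨ cong (λ n → sumℚ (map F xs) *ℚ unit n) (length-map F xs') ⟩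
  sumℚ (map F xs) *ℚ unit (length xs')
    ≤⟨ ℚₚ.*-monoʳ-≤-nonNeg (unit (length xs')) ⦃ unit-nonNegative (length xs') ⦄ (ℚₚ.≤-trans (sumℚ-bound xs F g h) (fromℕ-mono (∑ xs g) (length xs * B) le)) ⟩
  fromℕ (length xs * B) *ℚ unit (length xs')
    ≡⟨ cong (_*ℚ unit (length xs')) (trans (cong fromℕ (*-comm (length xs) B)) (fromℕ-* B (length xs))) ⟩
  fromℕ B *ℚ fromℕ (length xs) *ℚ unit (length xs')
    ≡⟨ ℚₚ.*-assoc (fromℕ B) (fromℕ (length xs)) (unit (length xs')) ⟩
  fromℕ B *ℚ (fromℕ (length xs) *ℚ unit (length xs'))
    ≡⟨ cong (fromℕ B *ℚ_) (fromℕ-*-unit (length xs')) ⟩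
  fromℕ B *ℚ ℚ.1ℚ
    ≡⟨ ℚₚ.*-identityʳ (fromℕ B) ⟩
  fromℕ B ∎
  where open ℚₚ.≤-Reasoning

-- Accounting for productions

concat-blks : ∀ b p T → concat (blks b p T) ≡ T
concat-blks b p [] = refl
concat-blks b p (x ∷ []) = refl
concat-blks b p (x ∷ y ∷ ys) with b p x y | concat-blks b (just x) (y ∷ ys)
... | true | ih = cong (x ∷_) ih
... | false | ih with blks b (just x) (y ∷ ys) | blks-∷ b (just x) y ys
...   | .((y ∷ _) ∷ _) | _ , _ , refl = cong (x ∷_) ih

∑-length-concat : ∀ {A : Set} (xss : List (List A)) → ∑ xss length ≡ length (concat xss)
∑-length-concat [] = refl
∑-length-concat (xs ∷ xss) = trans (cong (length xs +_) (∑-length-concat xss)) (sym (length-++ xs))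

unique-⊆⇒∑≤ : ∀ {A : Set} {xs ys : List A} (f : A → ℕ) → Unique xs →
  (∀ {x} → x ∈ xs → x ∈ ys ⊎ f x ≡ 0) → ∑ xs f ≤ ∑ ys f
unique-⊆⇒∑≤ f [] h = z≤n
unique-⊆⇒∑≤ {xs = x ∷ xs} {ys} f (x∉ ∷ u) h with h (here refl)
... | inj₂ z rewrite z = unique-⊆⇒∑≤ f u (h ∘ there)
... | inj₁ x∈ with ∈-∃++ x∈
...   | as , bs , refl = ≤-trans (+-monoʳ-≤ (f x) (unique-⊆⇒∑≤ f u reduce))
          (≤-reflexive (trans (cong (f x +_) (∑-++ as bs f)) (trans (exchange-sums (f x) (∑ as f) (∑ bs f)) (sym (∑-++ as (x ∷ bs) f)))))
  where
  exchange-sums : ∀ a b c → a + (b + c) ≡ b + (a + c)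
  exchange-sums = solve-∀
  reduce : ∀ {y} → y ∈ xs → y ∈ as ++ bs ⊎ f y ≡ 0
  reduce y∈ with h (there y∈)
  ... | inj₂ z = inj₂ z
  ... | inj₁ y∈ys with ∈-++⁻ as y∈ys
  ...   | inj₁ p = inj₁ (∈-++⁺ˡ p)
  ...   | inj₂ (here refl) = contradiction refl (All.lookup x∉ y∈)
  ...   | inj₂ (there p) = inj₁ (∈-++⁺ʳ as p)

grammarSize-∑ : ∀ occ → grammarSize occ ≡ ∑ (dedup occ) prodSize
grammarSize-∑ occ = go (dedup occ)
  where
  go : ∀ xs → foldr (λ A s → prodSize A + s) 0 xs ≡ ∑ xs prodSize
  go [] = refl
  go (x ∷ xs) = cong (prodSize x +_) (go xs)

grammarSize-≤ : ∀ occ ys → (∀ {x} → x ∈ occ → x ∈ ys ⊎ prodSize x ≡ 0) → grammarSize occ ≤ ∑ ys prodSize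
grammarSize-≤ occ ys h = ≤-trans (≤-reflexive (grammarSize-∑ occ))
  (unique-⊆⇒∑≤ prodSize (dedup-unique occ) (h ∘ ∈-dedup occ))

record Compressor (c : List Sym → Sym) : Set where
  field
    single : ∀ x → c (x ∷ []) ≡ x
    size   : ∀ x y ys → prodSize (c (x ∷ y ∷ ys)) ≤ length (x ∷ y ∷ ys)

runCompressor : Compressor runSym
runCompressor = record { single = λ _ → refl ; size = λ _ _ _ → s≤s (s≤s z≤n) }

tupleCompressor : Compressor tupleSym
tupleCompressor = record { single = λ _ → refl ; size = λ _ _ _ → ≤-refl }

data Origin (b : Rule) (c : List Sym → Sym) (T : List Sym) (x : Sym) : Set where
  kept : x ∈ T → Origin b c T x
  made : ∀ y z B → (y ∷ z ∷ B) ∈ blks b nothing T → x ≡ c (y ∷ z ∷ B) → Origin b c T x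

origin : ∀ {b c T} → Compressor c → ∀ {x} → x ∈ map c (blks b nothing T) → Origin b c T x
origin {b} {c} {T} cc x∈ with ∈-map⁻ c x∈
... | [] , B∈ , e = contradiction refl (All.lookup (blks-nonEmpty b nothing T) B∈)
... | y ∷ z ∷ B , B∈ , e = made y z B B∈ e
... | y ∷ [] , B∈ , e = kept (subst (_∈ T) (sym (trans e (Compressor.single cc y)))
        (subst (y ∈_) (concat-blks b nothing T) (∈-concat⁺′ (here refl) B∈)))

blockCost : (List Sym → Sym) → List Sym → ℕ
blockCost c (y ∷ z ∷ B) = prodSize (c (y ∷ z ∷ B))
blockCost c _ = 0

-- A production of size at most m replaces m ≥ 2 symbols by one.
step-potential : ∀ {b c T} → Compressor c → ∀ {occ} → (∀ {x} → x ∈ T → x ∈ occ) →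
  grammarSize (map c (blks b nothing T) ++ occ) + 2 * length (map c (blks b nothing T))
    ≤ grammarSize occ + 2 * length T
step-potential {b} {c} {T} cc {occ} T⊆ = begin
  grammarSize (map c Bs ++ occ) + 2 * length (map c Bs)
    ≤⟨ +-mono-≤ (grammarSize-≤ (map c Bs ++ occ) (concatMap new Bs ++ dedup occ) covered)
         (≤-reflexive (cong (2 *_) (length-map c Bs))) ⟩
  ∑ (concatMap new Bs ++ dedup occ) prodSize + 2 * length Bs
    ≡⟨ cong (_+ 2 * length Bs) (trans (∑-++ (concatMap new Bs) (dedup occ) prodSize)
         (cong₂ _+_ (trans (∑-concatMap new Bs prodSize) (∑-cong Bs new-cost)) (sym (grammarSize-∑ occ)))) ⟩
  ∑ Bs (blockCost c) + grammarSize occ + 2 * length Bs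
    ≡⟨ shuffle (∑ Bs (blockCost c)) (grammarSize occ) (length Bs) ⟩
  grammarSize occ + (∑ Bs (blockCost c) + length Bs * 2)
    ≡⟨ cong (grammarSize occ +_) (trans (cong (∑ Bs (blockCost c) +_) (sym (∑-const Bs 2))) (sym (∑-+ Bs (blockCost c) _))) ⟩
  grammarSize occ + ∑ Bs (λ B → blockCost c B + 2)
    ≤⟨ +-monoʳ-≤ (grammarSize occ) (∑-mono Bs λ {B} B∈ → amortised B (All.lookup (blks-nonEmpty b nothing T) B∈)) ⟩
  grammarSize occ + ∑ Bs (λ B → 2 * length B)
    ≡⟨ cong (grammarSize occ +_) (trans (∑-* 2 Bs length) (cong (2 *_) (trans (∑-length-concat Bs) (cong length (concat-blks b nothing T))))) ⟩
  grammarSize occ + 2 * length T ∎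
  where
  open ≤-Reasoning
  Bs = blks b nothing T
  new : List Sym → List Sym
  new (y ∷ z ∷ B) = c (y ∷ z ∷ B) ∷ []
  new _ = []
  new-cost : ∀ B → ∑ (new B) prodSize ≡ blockCost c B
  new-cost [] = refl
  new-cost (_ ∷ []) = refl
  new-cost (y ∷ z ∷ B) = +-identityʳ _
  shuffle : ∀ a g l → a + g + 2 * l ≡ g + (a + l * 2)
  shuffle = solve-∀
  amortised : ∀ B → NonEmpty B → blockCost c B + 2 ≤ 2 * length B
  amortised [] ne = contradiction refl ne
  amortised (_ ∷ []) ne = ≤-refl
  amortised (y ∷ z ∷ B) ne = ≤-trans (+-mono-≤ (Compressor.size cc y z B) (s≤s (s≤s z≤n)))
    (≤-reflexive (cong (length (y ∷ z ∷ B) +_) (sym (+-identityʳ _))))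
  covered : ∀ {x} → x ∈ map c Bs ++ occ → x ∈ concatMap new Bs ++ dedup occ ⊎ prodSize x ≡ 0
  covered x∈ with ∈-++⁻ (map c Bs) x∈
  ... | inj₂ q = inj₁ (∈-++⁺ʳ (concatMap new Bs) (dedup-∈ q))
  ... | inj₁ p with origin cc p
  ...   | kept q = inj₁ (∈-++⁺ʳ (concatMap new Bs) (dedup-∈ (T⊆ q)))
  ...   | made y z B B∈ refl = inj₁ (∈-++⁺ˡ (∈-concatMap⁺ new (lose B∈ (here refl))))

odd-potential : ∀ k {T occ} → (∀ {x} → x ∈ T → x ∈ occ) →
  grammarSize (oddStep k T ++ occ) + 2 * length (oddStep k T) ≤ grammarSize occ + 2 * length T
odd-potential k {T} T⊆ rewrite oddStep-blks k T = step-potential runCompressor T⊆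

even-potential : ∀ k π {T occ} → (∀ {x} → x ∈ T → x ∈ occ) →
  grammarSize (evenStep k π T ++ occ) + 2 * length (evenStep k π T) ≤ grammarSize occ + 2 * length T
even-potential k π {T} T⊆ rewrite evenStep-blks k π T = step-potential tupleCompressor T⊆

-- The potential, grammar size plus 2 |T|, never increases, whatever π is chosen and whatever fuel
-- is left. This settles all levels after the last one with a budget.
expSize-≤-potential : ∀ f k T occ → (∀ {x} → x ∈ T → x ∈ occ) →
  expSize f k T occ ≤ℚ fromℕ (grammarSize occ + 2 * length T)
expSize-≤-potential zero k T occ T⊆ = fromℕ-mono (grammarSize occ) _ (m≤m+n _ _)
expSize-≤-potential (suc f) k T occ T⊆ = go (2 ≤ᵇ length T) (k % 2) refl refl
  where
  Φ : ℕ
  Φ = grammarSize occ + 2 * length T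
  even : mean (map (λ o → expSize f (suc k) (evenStep k (rank o) T) (evenStep k (rank o) T ++ occ))
    (admissibleOrders k T)) ≤ℚ fromℕ Φ
  even = mean-bound (admissibleOrders k T) _ (λ _ → Φ) Φ
    (λ {o} _ → ℚₚ.≤-trans (expSize-≤-potential f (suc k) (evenStep k (rank o) T) _ ∈-++⁺ˡ)
      (fromℕ-mono _ Φ (even-potential k (rank o) T⊆)))
    (≤-reflexive (∑-const (admissibleOrders k T) Φ))
  go : ∀ b r → (2 ≤ᵇ length T) ≡ b → k % 2 ≡ r → expSize (suc f) k T occ ≤ℚ fromℕ Φ
  go false r e _ rewrite e = fromℕ-mono (grammarSize occ) Φ (m≤m+n _ _)
  go true 1 e p rewrite e | p = ℚₚ.≤-trans (expSize-≤-potential f (suc k) (oddStep k T) (oddStep k T ++ occ) ∈-++⁺ˡ)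
    (fromℕ-mono _ Φ (odd-potential k T⊆))
  go true 0 e p rewrite e | p = even
  go true (suc (suc r)) e p rewrite e | p = even

-- acc collects the symbols already paid for; a run symbol is paid for only at the level at
-- which its length drops below the threshold, and occurs in T until then.
Accounted : List Sym → List Sym → List Sym → Set
Accounted T occ acc = ∀ {x} → x ∈ occ → x ∈ acc ⊎ prodSize x ≡ 0 ⊎ (x ∈ T × prodSize x ≤ 2)

cheap : Sym → Bool
cheap x = prodSize x ≤ᵇ 2

∑-cheap : ∀ T → ∑ (filterᵇ cheap T) prodSize ≤ length T * 2
∑-cheap [] = z≤n
∑-cheap (x ∷ T) with prodSize x ≤ᵇ 2 in e
... | true = +-mono-≤ (≤ᵇ-sound (prodSize x) 2 e) (∑-cheap T)
... | false = ≤-trans (∑-cheap T) (m≤n+m _ 2)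

accounted-grammarSize : ∀ {T occ acc} → Accounted T occ acc → grammarSize occ ≤ ∑ acc prodSize + 2 * length T
accounted-grammarSize {T} {occ} {acc} h = ≤-trans (grammarSize-≤ occ (acc ++ filterᵇ cheap T) covered)
  (≤-trans (≤-reflexive (∑-++ acc (filterᵇ cheap T) prodSize))
    (+-monoʳ-≤ (∑ acc prodSize) (≤-trans (∑-cheap T) (≤-reflexive (*-comm (length T) 2)))))
  where
  covered : ∀ {x} → x ∈ occ → x ∈ acc ++ filterᵇ cheap T ⊎ prodSize x ≡ 0
  covered x∈ with h x∈
  ... | inj₁ p = inj₁ (∈-++⁺ˡ p)
  ... | inj₂ (inj₁ z) = inj₂ z
  ... | inj₂ (inj₂ (x∈T , le)) = inj₁ (∈-++⁺ʳ acc (filterᵇ-∈ cheap x∈T (≤ᵇ-complete le)))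

inCheap : ℕ → List Sym → List Sym
inCheap k T = filterᵇ cheap (inSyms k T)

inCheap-cost : ∀ k T → ∑ (inCheap k T) prodSize ≤ length (inSyms k T) * 2
inCheap-cost k T = ∑-cheap (inSyms k T)

-- A production that is still unpaid belongs either to a long symbol, which survives in T', or to a
-- short one, which `inCheap` pays for now.
accounted-step : ∀ k {T occ acc} T' new → (∀ {x} → x ∈ T → x ∈ occ) → Accounted T occ acc →
  (∀ {x} → x ∈ T → inA k x ≡ false → x ∈ T') →
  (∀ {x} → x ∈ T' → x ∈ T ⊎ x ∈ new ⊎ prodSize x ≤ 2) →
  Accounted T' (T' ++ occ) (new ++ inCheap k T ++ acc)
accounted-step k {T} {occ} {acc} T' new T⊆ h persist fresh x∈ with ∈-++⁻ T' x∈
... | inj₂ q = old q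
  where
  old : ∀ {x} → x ∈ occ → x ∈ new ++ inCheap k T ++ acc ⊎ prodSize x ≡ 0 ⊎ (x ∈ T' × prodSize x ≤ 2)
  old {x} x∈ with h x∈
  ... | inj₁ p = inj₁ (∈-++⁺ʳ new (∈-++⁺ʳ (inCheap k T) p))
  ... | inj₂ (inj₁ z) = inj₂ (inj₁ z)
  ... | inj₂ (inj₂ (x∈T , le)) with inA k x in e
  ...   | false = inj₂ (inj₂ (persist x∈T e , le))
  ...   | true = inj₁ (∈-++⁺ʳ new (∈-++⁺ˡ (filterᵇ-∈ cheap (filterᵇ-∈ (inA k) (dedup-∈ x∈T) e) (≤ᵇ-complete le))))
... | inj₁ p with fresh p
...   | inj₂ (inj₁ q) = inj₁ (∈-++⁺ˡ q)
...   | inj₂ (inj₂ le) = inj₂ (inj₂ (p , le))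
...   | inj₁ x∈T with h (T⊆ x∈T)
...     | inj₁ q = inj₁ (∈-++⁺ʳ new (∈-++⁺ʳ (inCheap k T) q))
...     | inj₂ (inj₁ z) = inj₂ (inj₁ z)
...     | inj₂ (inj₂ (_ , le)) = inj₂ (inj₂ (p , le))

-- A long symbol has boundaries on both sides, so it is a block of its own and is copied.
persists : ∀ {b inn Q c} → Laws b inn Q → Compressor c → ∀ T → All Q T → Positive T →
  ∀ {x} → x ∈ T → inn x ≡ false → x ∈ map c (blks b nothing T)
persists {b} {inn} {Q} {c} laws cc T allQ pos {x} x∈ e with ∈-∃++ x∈
... | U , V , d = subst (x ∈_) (sym (cong (map c) (blocks-fuse U (x ∷ []) V d (left (initLast U)) (right V))))
        (∈-map⁺′ (∈-++⁺ʳ (blocks U) (here refl)))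
  where
  open Local laws T allQ pos
  open Laws laws
  left : ∀ {U} → InitLast U → cut U (x ∷ V) ≡ true
  left [] = refl
  left (U₀ ∷ʳ′ y) = trans (cutAt-∷ʳ b nothing U₀ y x V) (out-r e)
  right : ∀ V → cut (U ++ x ∷ []) V ≡ true
  right [] = cutAt-[] b nothing (U ++ x ∷ [])
  right (v ∷ V) = trans (cutAt-∷ʳ b nothing U x v V) (out-l e)
  ∈-map⁺′ : ∀ {Bs} → (x ∷ []) ∈ Bs → x ∈ map c Bs
  ∈-map⁺′ p = subst (_∈ map c _) (Compressor.single cc x) (∈-map⁺ c p)

oddStep-fresh : ∀ k {T x} → x ∈ oddStep k T → x ∈ T ⊎ prodSize x ≤ 2
oddStep-fresh k {T} x∈ with origin runCompressor (subst (_ ∈_) (oddStep-blks k T) x∈)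
... | kept p = inj₁ p
... | made y z B B∈ refl = inj₂ ≤-refl

-- Expected size of the tuples of one even level

factors : ℕ → List Sym → List (List Sym)
factors r [] = []
factors r (x ∷ T) = take r (x ∷ T) ∷ factors r T

factors-complete : ∀ U x w V → (x ∷ w) ∈ factors (length (x ∷ w)) (U ++ (x ∷ w) ++ V)
factors-complete [] x w V = here (cong (x ∷_) (sym (take-length-++ w V)))
factors-complete (u ∷ U) x w V = there (factors-complete U x w V)

Factor : List Sym → List Sym → Set
Factor T w = ∃₂ λ U V → T ≡ U ++ w ++ V

factors-sound : ∀ r T {w} → w ∈ factors r T → Factor T w
factors-sound r (x ∷ T) (here refl) = [] , drop r (x ∷ T) , sym (take++drop≡id r (x ∷ T))
factors-sound r (x ∷ T) (there w∈) with factors-sound r T w∈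
... | U , V , refl = x ∷ U , V , refl

AllIn : ℕ → List Sym → Set
AllIn k = All (λ x → inA k x ≡ true)

inWindow? : ∀ k r w → Dec (length w ≡ r × AllIn k w)
inWindow? k r w = (length w ≟ r) ×-dec All.all? (λ x → inA k x Boolₚ.≟ true) w

-- The test on the length discards the truncated factors at the end of T.
windows : ℕ → ℕ → List Sym → List (List Sym)
windows k r T = deduplicate _≟w_ (filter (inWindow? k r) (factors r T))

windows-unique : ∀ k r T → Unique (windows k r T)
windows-unique k r T = deduplicate-! _≟w_ (filter (inWindow? k r) (factors r T))

windows-sound : ∀ k r T {w} → w ∈ windows k r T → Factor T w × length w ≡ r × AllIn k w
windows-sound k r T w∈ with ∈-filter⁻ (inWindow? k r) {xs = factors r T} (∈-deduplicate⁻ _≟w_ (filter (inWindow? k r) (factors r T)) w∈)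
... | p , q , s = factors-sound r T p , q , s

windows-complete : ∀ k U x w V → AllIn k (x ∷ w) → (x ∷ w) ∈ windows k (length (x ∷ w)) (U ++ (x ∷ w) ++ V)
windows-complete k U x w V ins = ∈-deduplicate⁺ _≟w_
  (∈-filter⁺ (inWindow? k (length (x ∷ w))) (factors-complete U x w V) (refl , ins))

expLens-in : ∀ {k c} → Level k c → ∀ {w} → AllIn k w → expLens w ≤ length w * lev c
expLens-in lv [] = z≤n
expLens-in {k} lv {x ∷ w} (i ∷ ins) = +-mono-≤ (inA-lev {k} lv {x} i) (expLens-in {k} lv ins)

not-true⇒false : ∀ {b} → not b ≡ true → b ≡ false
not-true⇒false {false} _ = refl

noCut-in : ∀ k π p x y w → noCut (evenRule k π) p (x ∷ y ∷ w) ≡ true → AllIn k (x ∷ y ∷ w)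
noCut-in k π p x y w e with inA k x in ix | inA k y in iy
... | true | true with w
...   | [] = ix ∷ iy ∷ []
...   | z ∷ w' = ix ∷ noCut-in k π (just x) y z w' (∧-conicalʳ (not (locMin π p x y)) _ e)

evenBlock-window : ∀ k π {T} → OutsBelow k π (_∈ T) → Positive T → ∀ {y z B} →
  (y ∷ z ∷ B) ∈ blks (evenRule k π) nothing T →
  Factor T (y ∷ z ∷ B) × noCut (evenRule k π) nothing (y ∷ z ∷ B) ≡ true
evenBlock-window k π {T} below pos {y} {z} {B} B∈ with ∈-∃++ B∈
... | Bs , Cs , e with Local.blocks-window (evenLaws k π below) T (All.tabulate id) pos Bs ((y ∷ z ∷ B) ∷ []) Cs e
...   | record { before = U ; middle = w ; after = V ; decomposition = d ; blocks-middle = bm }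
  with blks-single (evenRule k π) nothing w bm
...     | refl , nc = (U , V , d) , nc

uncut : ℕ → List Sym → List Sym → Bool
uncut k o w = noCut (evenRule k (rank o)) nothing w

-- A superset of the tuples created under o: windows without an inner boundary count even if they
-- are no complete block. The event then depends on the window alone, as in `noCut-count`.
newTuples : ℕ → List Sym → List Sym → List Sym
newTuples k T o = concatMap (λ r → map tup (filterᵇ (uncut k o) (windows k r T))) (downFrom (suc (length T)))

evenStep-fresh : ∀ k {T o x} → o ∈ admissibleOrders k T → Positive T → x ∈ evenStep k (rank o) T →
  x ∈ T ⊎ x ∈ newTuples k T o
evenStep-fresh k {T} {o} o∈ pos x∈ with origin tupleCompressor (subst (_ ∈_) (evenStep-blks k (rank o) T) x∈)
... | kept p = inj₁ p
... | made y z B B∈ refl with evenBlock-window k (rank o) (order-outsBelow k T o∈) pos B∈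
...   | (U , V , refl) , nc = inj₂ (∈-concatMap⁺ (λ r → map tup (filterᵇ (uncut k o) (windows k r T)))
          (lose (∈-downFrom⁺ (s≤s short)) (∈-map⁺ tup (filterᵇ-∈ (uncut k o)
            (windows-complete k U y (z ∷ B) V (noCut-in k (rank o) nothing y z B nc)) nc))))
  where
  short : length (y ∷ z ∷ B) ≤ length (U ++ (y ∷ z ∷ B) ++ V)
  short = ≤-trans (≤-trans (m≤m+n _ (length V)) (≤-reflexive (sym (length-++ (y ∷ z ∷ B)))))
    (≤-trans (m≤n+m _ (length U)) (≤-reflexive (sym (length-++ U))))

∑-filterᵇ : ∀ {A : Set} (p : A → Bool) xs f → ∑ (filterᵇ p xs) f ≡ ∑ xs (λ x → ind (p x) * f x)
∑-filterᵇ p [] f = refl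
∑-filterᵇ p (x ∷ xs) f with p x
... | true = cong₂ _+_ (sym (+-identityʳ (f x))) (∑-filterᵇ p xs f)
... | false = ∑-filterᵇ p xs f

∑-filterᵇ-split : ∀ {A : Set} (p : A → Bool) xs f → ∑ xs f ≡ ∑ (filterᵇ p xs) f + ∑ (filterᵇ (not ∘ p) xs) f
∑-filterᵇ-split p [] f = refl
∑-filterᵇ-split p (x ∷ xs) f with p x
... | true = trans (cong (f x +_) (∑-filterᵇ-split p xs f)) (sym (+-assoc (f x) _ _))
... | false = trans (cong (f x +_) (∑-filterᵇ-split p xs f)) (e (f x) (∑ (filterᵇ p xs) f) _)
  where
  e : ∀ a b c → a + (b + c) ≡ b + (a + c)
  e = solve-∀

newTuples-cost : ∀ k T o → ∑ (newTuples k T o) prodSize ≡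
  ∑ (downFrom (suc (length T))) (λ r → ∑ (windows k r T) (λ w → ind (uncut k o w) * length w))
newTuples-cost k T o = trans (∑-concatMap (λ r → map tup (filterᵇ (uncut k o) (windows k r T))) (downFrom (suc (length T))) prodSize)
  (∑-cong (downFrom (suc (length T))) λ r → trans (∑-map tup (filterᵇ (uncut k o) (windows k r T)) prodSize)
    (∑-filterᵇ (uncut k o) (windows k r T) length))

-- The hypothesis says X r ≤ B / (r (r + 1)), which telescopes.
∑-telescoping : ∀ (X : ℕ → ℕ) B → X 0 ≡ 0 → (∀ r → X r * (r * (1 + r)) ≤ B) → ∀ R → ∑ (downFrom R) X ≤ B
∑-telescoping X B X0 h zero = z≤n
∑-telescoping X B X0 h (suc R) = *-cancelˡ-≤ (suc R) (≤-trans (m≤m+n _ B) (claim R))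
  where
  -- The sum up to R is at most B (1 - 1 / (R + 1)), the telescoped value.
  claim : ∀ R → suc R * ∑ (downFrom (suc R)) X + B ≤ suc R * B
  claim zero = ≤-reflexive (trans (cong (λ x → x + 0 + 0 + B) X0) (sym (+-identityʳ B)))
  claim (suc R) = *-cancelˡ-≤ (suc R) (+-cancelʳ-≤ ((2 + R) * B) _ _ (begin
    suc R * ((2 + R) * (X (suc R) + S) + B) + (2 + R) * B   ≡⟨ e₁ R (X (suc R)) S B ⟩
    (2 + R) * (suc R * S + B) + X (suc R) * (suc R * (2 + R)) + suc R * B
      ≤⟨ +-monoˡ-≤ (suc R * B) (+-mono-≤ (*-monoʳ-≤ (2 + R) (claim R)) (h (suc R))) ⟩
    (2 + R) * (suc R * B) + B + suc R * B                   ≡⟨ e₂ R B ⟩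
    suc R * ((2 + R) * B) + (2 + R) * B                     ∎))
    where
    open ≤-Reasoning
    S = ∑ (downFrom (suc R)) X
    e₁ : ∀ R x s b → suc R * ((2 + R) * (x + s) + b) + (2 + R) * b ≡
      (2 + R) * (suc R * s + b) + x * (suc R * (2 + R)) + suc R * b
    e₁ = solve-∀
    e₂ : ∀ R b → (2 + R) * (suc R * b) + b + suc R * b ≡ suc R * ((2 + R) * b) + (2 + R) * b
    e₂ = solve-∀

∑-initial : ∀ (X : ℕ → ℕ) Λ Y → (∀ r → r ≤ Λ → X r ≤ Y) → (∀ r → Λ < r → X r ≡ 0) → ∀ R →
  ∑ (downFrom R) X ≤ suc Λ * Y
∑-initial X Λ Y h z R with R ≤? suc Λ
... | yes R≤ = ≤-trans (∑-bound (downFrom R) (λ {r} r∈ → h r (≤-pred (≤-trans (∈-downFrom⁻ r∈) R≤))))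
                 (≤-trans (≤-reflexive (cong (_* Y) (length-downFrom R))) (*-monoˡ-≤ Y R≤))
∑-initial X Λ Y h z zero | no _ = z≤n
∑-initial X Λ Y h z (suc R) | no R≰ rewrite z R (≤-pred (≰⇒> R≰)) = ∑-initial X Λ Y h z R

n<2^n : ∀ n → suc n ≤ 2 ^ n
n<2^n zero = ≤-refl
n<2^n (suc n) = ≤-trans (+-mono-≤ {1} (m^n>0 2 n) (n<2^n n)) (≤-reflexive (cong (2 ^ n +_) (sym (+-identityʳ _))))

fifth-power≤ : ∀ a q r s → r ≤ 2 ^ a * 2 ^ q → q * 5 ≤ s → r ^ 5 ≤ 2 ^ (a * 5) * 2 ^ s
fifth-power≤ a q r s r≤ 5q≤ = begin
  r ^ 5                     ≤⟨ ^-monoˡ-≤ 5 r≤ ⟩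
  (2 ^ a * 2 ^ q) ^ 5       ≡⟨ cong (_^ 5) (sym (^-distribˡ-+-* 2 a q)) ⟩
  (2 ^ (a + q)) ^ 5         ≡⟨ ^-*-assoc 2 (a + q) 5 ⟩
  2 ^ ((a + q) * 5)         ≡⟨ cong (2 ^_) (*-distribʳ-+ 5 a q) ⟩
  2 ^ (a * 5 + q * 5)       ≡⟨ ^-distribˡ-+-* 2 (a * 5) (q * 5) ⟩
  2 ^ (a * 5) * 2 ^ (q * 5) ≤⟨ *-monoʳ-≤ (2 ^ (a * 5)) (^-monoʳ-≤ 2 5q≤) ⟩
  2 ^ (a * 5) * 2 ^ s       ∎
  where open ≤-Reasoning

r≤32*2^[r/32] : ∀ r → r ≤ 2 ^ 5 * 2 ^ (r / 32)
r≤32*2^[r/32] r = ≤-trans (≤-reflexive (m≡m%n+[m/n]*n r 32))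
  (≤-trans (+-monoˡ-≤ (r / 32 * 32) (<⇒≤ (m%n<n r 32)))
    (≤-trans (≤-reflexive (*-comm (suc (r / 32)) 32)) (*-monoʳ-≤ 32 (n<2^n (r / 32)))))

5[r/32]≤r/4 : ∀ r → r / 32 * 5 ≤ r / 4
5[r/32]≤r/4 r = ≤-trans (≤-reflexive (sym (m*n/n≡m (r / 32 * 5) 4)))
  (/-mono-≤ {o = 4} (≤-trans (≤-reflexive (*-assoc (r / 32) 5 4)) (≤-trans (*-monoʳ-≤ (r / 32) (m≤m+n 20 12)) (m/n*n≤m r 32))) ≤-refl)

abstract
  tailConstant : ℕ
  tailConstant = 2 ^ (5 * 5)

  -- One power of two for the losses in both cases of `threshold`: 20 in `dense` and 4 · 2^25 in
  -- `sparse`.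
  levelConstant : ℕ
  levelConstant = 28

  4*tailConstant+20≤ : 4 * tailConstant + 20 ≤ 2 ^ levelConstant
  4*tailConstant+20≤ = ≤ᵇ⇒≤ (4 * tailConstant + 20) (2 ^ levelConstant) tt

  -- The fifth power is what `longCost-scaled` needs: one r each for the number of windows, the size
  -- of a tuple and u ≤ r v, and two for the telescoping weight r (1 + r). It is bounded through r ≤
  -- 32 · 2^(r / 32), and 32^5 = 2^25.
  tail-power≤ : ∀ r → r ^ 5 ≤ tailConstant * 2 ^ (r / 4)
  tail-power≤ r = fifth-power≤ 5 (r / 32) r (r / 4) (r≤32*2^[r/32] r) (5[r/32]≤r/4 r)

-- The 4 collects the union bound of `noCut-count` and 1 + r ≤ 2 r.
evenConstant : ℕ
evenConstant = windowConstant * 4 * tailConstant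

-- Windows of expansion length at most Λ are counted by the number of such strings; for the longer
-- ones, u ≤ |w| * v and the exponentially small probability of having no boundary are used.
module EvenLevel (k : ℕ) {T : List Sym} (positive : Positive T) (adjacent : AdjacentDistinct k T) (Δ : ℕ)
  (count-bound : ∀ r → 1 ≤ r → length (windows k r T) ≤ windowConstant * (r * Δ))
  (Λ N : ℕ) (short-bound : ∀ r → length (filterᵇ (λ w → expLens w ≤ᵇ Λ) (windows k r T)) ≤ N)
  (u v e : ℕ) .⦃ _ : NonZero u ⦄
  (long : ∀ {w} → AllIn k w → Λ < expLens w → u ≤ length w * v)
  (e-large : evenConstant * Δ * v ≤ e * u) where

  O : List (List Sym)
  O = admissibleOrders k T

  m : ℕ
  m = length O

  count : List Sym → ℕ
  count w = ∑ O (λ o → ind (uncut k o w))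

  count≤m : ∀ w → count w ≤ m
  count≤m w = ≤-trans (∑-mono O (λ {o} _ → ind-mono {uncut k o w} {true} (λ _ → refl))) (≤-reflexive (∑-one O))

  isShort : List Sym → Bool
  isShort w = expLens w ≤ᵇ Λ

  shorts longs : ℕ → List (List Sym)
  shorts r = filterᵇ isShort (windows k r T)
  longs r = filterᵇ (not ∘ isShort) (windows k r T)

  shortCost longCost : ℕ → ℕ
  shortCost r = ∑ (shorts r) (λ w → length w * count w)
  longCost r = ∑ (longs r) (λ w → length w * count w)

  total-cost : ∑ O (λ o → ∑ (newTuples k T o) prodSize) ≡
    ∑ (downFrom (suc (length T))) shortCost + ∑ (downFrom (suc (length T))) longCost
  total-cost = begin
    ∑ O (λ o → ∑ (newTuples k T o) prodSize)
      ≡⟨ ∑-cong O (newTuples-cost k T) ⟩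
    ∑ O (λ o → ∑ R (λ r → ∑ (windows k r T) (λ w → ind (uncut k o w) * length w)))
      ≡⟨ ∑-swap O R (λ o r → ∑ (windows k r T) (λ w → ind (uncut k o w) * length w)) ⟩
    ∑ R (λ r → ∑ O (λ o → ∑ (windows k r T) (λ w → ind (uncut k o w) * length w)))
      ≡⟨ ∑-cong R per-length ⟩
    ∑ R (λ r → shortCost r + longCost r)
      ≡⟨ ∑-+ R shortCost longCost ⟩
    ∑ R shortCost + ∑ R longCost ∎
    where
    open ≡-Reasoning
    R = downFrom (suc (length T))
    per-length : ∀ r → ∑ O (λ o → ∑ (windows k r T) (λ w → ind (uncut k o w) * length w)) ≡ shortCost r + longCost r
    per-length r = trans (∑-swap O (windows k r T) (λ o w → ind (uncut k o w) * length w))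
      (trans (∑-cong (windows k r T) λ w → trans (∑-cong O (λ o → *-comm (ind (uncut k o w)) (length w))) (∑-* (length w) O _))
        (∑-filterᵇ-split isShort (windows k r T) _))

  shortCost≤ : ∀ r → r ≤ Λ → shortCost r ≤ N * (Λ * m)
  shortCost≤ r r≤ = ≤-trans (∑-bound (shorts r) λ {w} w∈ → *-mono-≤
      (≤-trans (≤-reflexive (proj₁ (proj₂ (windows-sound k r T (proj₁ (∈-filterᵇ isShort (windows k r T) w∈)))))) r≤) (count≤m w))
    (*-monoˡ-≤ (Λ * m) (short-bound r))

  shortCost-0 : ∀ r → Λ < r → shortCost r ≡ 0
  shortCost-0 r Λ<r with shorts r in eq
  ... | [] = refl
  ... | w ∷ ws with ∈-filterᵇ isShort (windows k r T) (subst (w ∈_) (sym eq) (here refl))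
  ...   | w∈ , s with windows-sound k r T w∈
  ...     | (U , V , d) , refl , _ = contradiction (≤-trans (length≤expLens (Allₚ.++⁻ˡ w (Allₚ.++⁻ʳ U (subst Positive d positive))))
              (≤ᵇ-sound (expLens w) Λ s)) (<⇒≱ Λ<r)

  longCost-0 : longCost 0 ≡ 0
  longCost-0 = n≤0⇒n≡0 (≤-trans (∑-bound (longs 0) {m = 0} λ {w} w∈ → ≤-reflexive (cong (_* count w)
    (proj₁ (proj₂ (windows-sound k 0 T (proj₁ (∈-filterᵇ (not ∘ isShort) (windows k 0 T) w∈))))))) (≤-reflexive (*-zeroʳ (length (longs 0)))))

  longCost-tail : ∀ r → 1 ≤ r → longCost r * 2 ^ (r / 4) ≤ windowConstant * (r * Δ) * (r * (2 * m))
  longCost-tail r 1≤r = begin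
    longCost r * 2 ^ s ≡⟨ trans (*-comm (longCost r) (2 ^ s)) (sym (∑-* (2 ^ s) (longs r) _)) ⟩
    ∑ (longs r) (λ w → 2 ^ s * (length w * count w)) ≤⟨ ∑-bound (longs r) tail ⟩
    length (longs r) * (r * (2 * m)) ≤⟨ *-monoˡ-≤ (r * (2 * m)) (≤-trans (unique-⊆⇒length≤ (filterᵇ-unique _ (windows-unique k r T))
      (λ w∈ → proj₁ (∈-filterᵇ (not ∘ isShort) (windows k r T) w∈))) (count-bound r 1≤r)) ⟩
    windowConstant * (r * Δ) * (r * (2 * m)) ∎
    where
    open ≤-Reasoning
    s = r / 4
    e₁ : ∀ a l c → a * (l * c) ≡ l * (c * a)
    e₁ = solve-∀
    tail : ∀ {w} → w ∈ longs r → 2 ^ s * (length w * count w) ≤ r * (2 * m)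
    tail {w} w∈ with windows-sound k r T (proj₁ (∈-filterᵇ (not ∘ isShort) (windows k r T) w∈))
    ... | (U , V , d) , refl , ins = ≤-trans (≤-reflexive (e₁ (2 ^ s) (length w) (count w)))
      (*-monoʳ-≤ (length w) (noCut-count k T s w
        (λ x∈ → subst (_ ∈_) (sym d) (∈-++⁺ʳ U (∈-++⁺ˡ x∈)) , All.lookup ins x∈)
        (λ A x y B eq → adjacent (U ++ A) x y (B ++ V)
          (trans d (trans (cong (λ z → U ++ z ++ V) eq) (trans (cong (U ++_) (++-assoc A (x ∷ y ∷ B) V)) (sym (++-assoc U A _)))))
          (All.lookup ins (subst (x ∈_) (sym eq) (∈-++⁺ʳ A (here refl))))
          (All.lookup ins (subst (y ∈_) (sym eq) (∈-++⁺ʳ A (there (here refl))))))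
        (≤-trans (≤-reflexive (*-comm 4 s)) (m/n*n≤m r 4))))

  -- If a long window of r symbols exists, u can be traded for r v, and the resulting fifth power of
  -- r is absorbed by 2^(r / 4). Otherwise the cost is 0.
  longCost-scaled : ∀ r → u * longCost r * (r * (1 + r)) ≤ evenConstant * Δ * v * m
  longCost-scaled zero = ≤-trans (≤-reflexive (*-zeroʳ (u * longCost 0))) z≤n
  longCost-scaled r@(suc r') = by (longs r) refl
    where
    open ≤-Reasoning
    s = r / 4
    P = tailConstant
    e₁ : ∀ u L r p → u * L * (r * (1 + r)) * p ≡ L * p * u * (r * (1 + r))
    e₁ = solve-∀
    e₂ : ∀ a r d m v → a * (r * d) * (r * (2 * m)) * (r * v) * (r * (r + r)) ≡ a * 4 * d * v * m * (r * (r * (r * (r * (r * 1)))))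
    e₂ = solve-∀
    e₃ : ∀ a P d v m p → a * d * v * m * (P * p) ≡ a * P * d * v * m * p
    e₃ = solve-∀
    by : ∀ ws → longs r ≡ ws → u * longCost r * (r * (1 + r)) ≤ evenConstant * Δ * v * m
    by [] eq = ≤-trans (≤-reflexive (cong (_* (r * (1 + r))) (trans (cong (u *_) (cong (λ ws → ∑ ws (λ w → length w * count w)) eq)) (*-zeroʳ u)))) z≤n
    by (w ∷ ws) eq = *-cancelʳ-≤ _ _ (2 ^ s) ⦃ m^n≢0 2 s ⦄ (begin
      u * longCost r * (r * (1 + r)) * 2 ^ s ≡⟨ e₁ u (longCost r) r (2 ^ s) ⟩
      longCost r * 2 ^ s * u * (r * (1 + r))
        ≤⟨ *-mono-≤ (*-mono-≤ (longCost-tail r (s≤s z≤n)) u≤) (*-monoʳ-≤ r (+-monoˡ-≤ r (s≤s z≤n))) ⟩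
      windowConstant * (r * Δ) * (r * (2 * m)) * (r * v) * (r * (r + r)) ≡⟨ e₂ windowConstant r Δ m v ⟩
      windowConstant * 4 * Δ * v * m * r ^ 5 ≤⟨ *-monoʳ-≤ (windowConstant * 4 * Δ * v * m) (tail-power≤ r) ⟩
      windowConstant * 4 * Δ * v * m * (P * 2 ^ s) ≡⟨ e₃ (windowConstant * 4) P Δ v m (2 ^ s) ⟩
      windowConstant * 4 * P * Δ * v * m * 2 ^ s ∎)
      where
      u≤ : u ≤ r * v
      u≤ with ∈-filterᵇ (not ∘ isShort) (windows k r T) (subst (w ∈_) (sym eq) (here refl))
      ... | w∈ , sl with windows-sound k r T w∈
      ...   | _ , len , ins = subst (λ l → u ≤ l * v) len
                (long ins (≰⇒> λ le → true≢false (≤ᵇ-complete le) (not-true⇒false sl)))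

  even-cost : ∑ O (λ o → ∑ (newTuples k T o) prodSize) ≤ m * (suc Λ * (N * Λ) + e)
  even-cost = begin
    ∑ O (λ o → ∑ (newTuples k T o) prodSize) ≡⟨ total-cost ⟩
    ∑ R shortCost + ∑ R longCost
      ≤⟨ +-mono-≤ (∑-initial shortCost Λ (N * (Λ * m)) shortCost≤ shortCost-0 (suc (length T))) long-total ⟩
    suc Λ * (N * (Λ * m)) + m * e ≡⟨ e₁ Λ N m e ⟩
    m * (suc Λ * (N * Λ) + e) ∎
    where
    open ≤-Reasoning
    R = downFrom (suc (length T))
    e₁ : ∀ l n m e → suc l * (n * (l * m)) + m * e ≡ m * (suc l * (n * l) + e)
    e₁ = solve-∀
    e₂ : ∀ e u m → e * u * m ≡ u * (m * e)
    e₂ = solve-∀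
    long-total : ∑ R longCost ≤ m * e
    long-total = *-cancelˡ-≤ u (begin
      u * ∑ R longCost            ≡⟨ sym (∑-* u R longCost) ⟩
      ∑ R (λ r → u * longCost r)
        ≤⟨ ∑-telescoping (λ r → u * longCost r) (evenConstant * Δ * v * m) (trans (cong (u *_) longCost-0) (*-zeroʳ u)) longCost-scaled (suc (length T)) ⟩
      evenConstant * Δ * v * m    ≤⟨ *-monoˡ-≤ m e-large ⟩
      e * u * m                   ≡⟨ e₂ e u m ⟩
      u * (m * e)                 ∎)

-- Induction over pairs of levels

inA-level : ∀ {k c} → Level k c → ∀ x → inA k x ≡ (3 ^ c * expLen x ≤ᵇ 4 ^ c)
inA-level refl x = refl

adjacent-level : ∀ {k k' c T} → Level k c → Level k' c → AdjacentDistinct k T → AdjacentDistinct k' T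
adjacent-level {k} {k'} lv lv' adj U x y V d ix iy = adj U x y V d (same x ix) (same y iy)
  where
  same : ∀ z → inA k' z ≡ true → inA k z ≡ true
  same z iz = trans (inA-level {k} lv z) (trans (sym (inA-level {k'} lv' z)) iz)

oddStep-persists : ∀ k {T} → Positive T → ∀ {x} → x ∈ T → inA k x ≡ false → x ∈ oddStep k T
oddStep-persists k {T} pos x∈ e = subst (_ ∈_) (sym (oddStep-blks k T))
  (persists {Q = λ _ → ⊤} (oddLaws k) runCompressor T (All.tabulate λ _ → tt) pos x∈ e)

evenStep-persists : ∀ k π {T} → OutsBelow k π (_∈ T) → Positive T → ∀ {x} → x ∈ T → inA k x ≡ false → x ∈ evenStep k π T
evenStep-persists k π {T} below pos x∈ e = subst (_ ∈_) (sym (evenStep-blks k π T))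
  (persists (evenLaws k π below) tupleCompressor T (All.tabulate id) pos x∈ e)

-- The bounds are uniform in T, hence valid after any earlier choices of π. In `total` a short
-- symbol pays 2 for its possible run at either level, and e pays for the expected tuples.
record Budget (s : List ℕ) (c x : ℕ) : Set where
  field
    w e : ℕ
    odd-symbols : ∀ {T} → Good s c (margin c) T → length (inSyms (1 + c * 2) T) ≤ w
    even-symbols : ∀ {T} → Good s c (margin c + lev c + lev c) T → length (inSyms (2 + c * 2) T) ≤ w
    even-tuples : ∀ {T} → Good s c (margin c + lev c + lev c) T → AdjacentDistinct (2 + c * 2) T →
      ∑ (admissibleOrders (2 + c * 2) T) (λ o → ∑ (newTuples (2 + c * 2) T o) prodSize)
        ≤ length (admissibleOrders (2 + c * 2) T) * e
    total : w * 2 + (w * 2 + e) ≤ x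

sumFrom : (ℕ → ℕ) → ℕ → ℕ → ℕ
sumFrom x c zero = 0
sumFrom x c (suc j) = x c + sumFrom x (suc c) j

expSize-small : ∀ f k T occ → (2 ≤ᵇ length T) ≡ false → expSize f k T occ ≡ fromℕ (grammarSize occ)
expSize-small zero k T occ e = refl
expSize-small (suc f) k T occ e rewrite e = refl

odd-parity : ∀ c → (1 + c * 2) % 2 ≡ 1
odd-parity c = [m+kn]%n≡m%n 1 c 2

even-parity : ∀ c → (2 + c * 2) % 2 ≡ 0
even-parity c = [m+kn]%n≡m%n 2 c 2

expSize-odd : ∀ f c T occ → (2 ≤ᵇ length T) ≡ true → let k = 1 + c * 2 in
  expSize (suc f) k T occ ≡ expSize f (suc k) (oddStep k T) (oddStep k T ++ occ)
expSize-odd f c T occ e rewrite e | odd-parity c = refl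

expSize-even : ∀ f c T occ → (2 ≤ᵇ length T) ≡ true → let k = 2 + c * 2 in
  expSize (suc f) k T occ ≡ mean (map (λ o → expSize f (suc k) (evenStep k (rank o) T) (evenStep k (rank o) T ++ occ))
    (admissibleOrders k T))
expSize-even f c T occ e rewrite e | even-parity c = refl

module Process (s : List ℕ) (x : ℕ → ℕ) (K B : ℕ) (1≤B : 1 ≤ B)
  (budgets : ∀ c → c < K → Budget s c (x c))
  (final : ∀ {T} → Good s K (margin K) T → length T ≤ B) where

  finish : ∀ {T occ acc} → Accounted T occ acc → (2 ≤ᵇ length T) ≡ false →
    grammarSize occ ≤ ∑ acc prodSize + 4 * B
  finish {T} {occ} {acc} h e = ≤-trans (accounted-grammarSize {T} {occ} {acc} h)
    (+-monoʳ-≤ (∑ acc prodSize) (≤-trans (*-monoʳ-≤ 2 at-most-one)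
      (≤-trans (s≤s (s≤s z≤n)) (*-monoʳ-≤ 4 1≤B))))
    where
    at-most-one : length T ≤ 1
    at-most-one = ≤-pred (≰⇒> λ le → true≢false (≤ᵇ-complete {2} {length T} le) e)

  -- Generalising over acc, the symbols already paid for, confines the average at an even level to
  -- the new tuples. The 4 B consists of 2 |T| for unpaid runs and 2 |T| for the potential of the
  -- remaining levels.
  expSize-bound : ∀ j c f T occ acc → c + j ≡ K → j * 2 ≤ f → Good s c (margin c) T →
    (∀ {y} → y ∈ T → y ∈ occ) → Accounted T occ acc →
    expSize f (1 + c * 2) T occ ≤ℚ fromℕ (∑ acc prodSize + (sumFrom x c j + 4 * B))
  expSize-bound zero c f T occ acc eK _ good T⊆ h rewrite trans (sym (+-identityʳ c)) eK =
    ℚₚ.≤-trans (expSize-≤-potential f _ T occ T⊆) (fromℕ-mono (grammarSize occ + 2 * length T) _ (begin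
      grammarSize occ + 2 * length T ≤⟨ +-monoˡ-≤ (2 * length T) (accounted-grammarSize {T} {occ} {acc} h) ⟩
      ∑ acc prodSize + 2 * length T + 2 * length T ≡⟨ e (∑ acc prodSize) (length T) ⟩
      ∑ acc prodSize + 4 * length T ≤⟨ +-monoʳ-≤ (∑ acc prodSize) (*-monoʳ-≤ 4 (final good)) ⟩
      ∑ acc prodSize + 4 * B ∎))
    where
    open ≤-Reasoning
    e : ∀ a l → a + 2 * l + 2 * l ≡ a + 4 * l
    e = solve-∀
  expSize-bound (suc j) c (suc (suc f)) T occ acc eK (s≤s (s≤s fuel)) good T⊆ h =
    first (2 ≤ᵇ length T) refl
    where
    open Budget (budgets c (≤-trans (≤-trans (s≤s (m≤m+n c j)) (≤-reflexive (sym (+-suc c j)))) (≤-reflexive eK)))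
    k₁ k₂ : ℕ
    k₁ = 1 + c * 2
    k₂ = 2 + c * 2
    T₁ occ₁ acc₁ : List Sym
    T₁ = oddStep k₁ T
    occ₁ = T₁ ++ occ
    acc₁ = inCheap k₁ T ++ acc
    rest : ℕ
    rest = sumFrom x (suc c) j + 4 * B
    good₁ : Good s c (margin c + lev c + lev c) T₁
    good₁ = good-odd {k = k₁} (oddLevel c) good
    adjacent₁ : AdjacentDistinct k₂ T₁
    adjacent₁ = adjacent-level {k₁} {k₂} (oddLevel c) (evenLevel c) (oddStep-adjacentDistinct k₁ (Good.positive good) (Good.canon good))
    h₁ : Accounted T₁ occ₁ acc₁
    h₁ = accounted-step k₁ T₁ [] T⊆ h (oddStep-persists k₁ (Good.positive good))
      (λ y∈ → [ inj₁ , inj₂ ∘ inj₂ ]′ (oddStep-fresh k₁ y∈))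
    cost₁ : ∑ acc₁ prodSize ≤ w * 2 + ∑ acc prodSize
    cost₁ = ≤-trans (≤-reflexive (∑-++ (inCheap k₁ T) acc prodSize))
      (+-monoˡ-≤ (∑ acc prodSize) (≤-trans (inCheap-cost k₁ T) (*-monoˡ-≤ 2 (odd-symbols good))))
    acc₂ : List Sym → List Sym
    acc₂ o = newTuples k₂ T₁ o ++ inCheap k₂ T₁ ++ acc₁
    T₂ : List Sym → List Sym
    T₂ o = evenStep k₂ (rank o) T₁
    good₂ : ∀ {o} → o ∈ admissibleOrders k₂ T₁ → Good s (suc c) (margin (suc c)) (T₂ o)
    good₂ {o} o∈ = good-even {k = k₂} (rank o) (evenLevel c) (order-outsBelow k₂ T₁ o∈) good₁
    h₂ : ∀ {o} → o ∈ admissibleOrders k₂ T₁ → Accounted (T₂ o) (T₂ o ++ occ₁) (acc₂ o)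
    h₂ {o} o∈ = accounted-step k₂ (T₂ o) (newTuples k₂ T₁ o) ∈-++⁺ˡ h₁
      (evenStep-persists k₂ (rank o) (order-outsBelow k₂ T₁ o∈) (Good.positive good₁))
      (λ y∈ → [ inj₁ , inj₂ ∘ inj₁ ]′ (evenStep-fresh k₂ o∈ (Good.positive good₁) y∈))
    fixed : ℕ
    fixed = ∑ (inCheap k₂ T₁) prodSize + ∑ acc₁ prodSize + rest
    cost₂ : ∀ o → ∑ (acc₂ o) prodSize + rest ≡ ∑ (newTuples k₂ T₁ o) prodSize + fixed
    cost₂ o = trans (cong (_+ rest) (trans (∑-++ (newTuples k₂ T₁ o) _ prodSize)
      (cong (∑ (newTuples k₂ T₁ o) prodSize +_) (∑-++ (inCheap k₂ T₁) acc₁ prodSize)))) (+-assoc (∑ (newTuples k₂ T₁ o) prodSize) _ rest)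
    average : ∑ (admissibleOrders k₂ T₁) (λ o → ∑ (acc₂ o) prodSize + rest) ≤ length (admissibleOrders k₂ T₁) * (e + fixed)
    average = begin
      ∑ O (λ o → ∑ (acc₂ o) prodSize + rest) ≡⟨ trans (∑-cong O cost₂) (∑-+ O _ _) ⟩
      ∑ O (λ o → ∑ (newTuples k₂ T₁ o) prodSize) + ∑ O (λ _ → fixed)
        ≤⟨ +-mono-≤ (even-tuples good₁ adjacent₁) (≤-reflexive (∑-const O fixed)) ⟩
      length O * e + length O * fixed ≡⟨ sym (*-distribˡ-+ (length O) e fixed) ⟩
      length O * (e + fixed) ∎
      where
      open ≤-Reasoning
      O = admissibleOrders k₂ T₁
    spent : e + fixed ≤ ∑ acc prodSize + (sumFrom x c (suc j) + 4 * B)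
    spent = begin
      e + fixed ≤⟨ +-monoʳ-≤ e (+-monoˡ-≤ rest (+-mono-≤ (≤-trans (inCheap-cost k₂ T₁) (*-monoˡ-≤ 2 (even-symbols good₁))) cost₁)) ⟩
      e + (w * 2 + (w * 2 + ∑ acc prodSize) + rest) ≡⟨ arrange e (w * 2) (∑ acc prodSize) (sumFrom x (suc c) j) (4 * B) ⟩
      ∑ acc prodSize + (w * 2 + (w * 2 + e) + sumFrom x (suc c) j + 4 * B)
        ≤⟨ +-monoʳ-≤ (∑ acc prodSize) (+-monoˡ-≤ (4 * B) (+-monoˡ-≤ (sumFrom x (suc c) j) total)) ⟩
      ∑ acc prodSize + (sumFrom x c (suc j) + 4 * B) ∎
      where
      open ≤-Reasoning
      arrange : ∀ e w a r b → e + (w + (w + a) + (r + b)) ≡ a + (w + (w + e) + r + b)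
      arrange = solve-∀
    Goal : ℚ → Set
    Goal q = q ≤ℚ fromℕ (∑ acc prodSize + (sumFrom x c (suc j) + 4 * B))
    second : ∀ b → (2 ≤ᵇ length T₁) ≡ b → Goal (expSize (suc f) k₂ T₁ occ₁)
    second false e₁ = subst Goal (sym (expSize-small (suc f) k₂ T₁ occ₁ e₁)) (fromℕ-mono (grammarSize occ₁) _ (begin
      grammarSize occ₁ ≤⟨ finish {T₁} {occ₁} {acc₁} h₁ e₁ ⟩
      ∑ acc₁ prodSize + 4 * B ≤⟨ +-mono-≤ (m≤n+m _ (∑ (inCheap k₂ T₁) prodSize)) (m≤n+m _ (sumFrom x (suc c) j)) ⟩
      fixed ≤⟨ m≤n+m fixed e ⟩
      e + fixed ≤⟨ spent ⟩
      ∑ acc prodSize + (sumFrom x c (suc j) + 4 * B) ∎))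
      where open ≤-Reasoning
    second true e₁ = subst Goal (sym (expSize-even f c T₁ occ₁ e₁)) (ℚₚ.≤-trans
      (mean-bound (admissibleOrders k₂ T₁) _ (λ o → ∑ (acc₂ o) prodSize + rest) (e + fixed)
        (λ {o} o∈ → expSize-bound j (suc c) f (T₂ o) (T₂ o ++ occ₁) (acc₂ o) (trans (sym (+-suc c j)) eK) fuel
          (good₂ o∈) ∈-++⁺ˡ (h₂ o∈))
        average)
      (fromℕ-mono (e + fixed) _ spent))
    first : ∀ b → (2 ≤ᵇ length T) ≡ b → Goal (expSize (suc (suc f)) k₁ T occ)
    first false e₀ = subst Goal (sym (expSize-small (suc (suc f)) k₁ T occ e₀)) (fromℕ-mono (grammarSize occ) _
      (≤-trans (finish {T} {occ} {acc} h e₀) (+-monoʳ-≤ (∑ acc prodSize) (m≤n+m (4 * B) (sumFrom x c (suc j))))))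
    first true e₀ = subst Goal (sym (expSize-odd (suc f) c T occ e₀)) (second (2 ≤ᵇ length T₁) refl)

-- Budgets of low and middle levels

strings : ℕ → ℕ → List (List ℕ)
strings σ zero = [] ∷ []
strings σ (suc Λ) = [] ∷ concatMap (λ a → map (a ∷_) (strings σ Λ)) (downFrom σ)

-- Shorter strings are included, and σ + 1 treats the end of a string as one more letter.
length-strings : ∀ σ Λ → length (strings σ Λ) ≤ suc σ ^ Λ
length-strings σ zero = ≤-refl
length-strings σ (suc Λ) = +-mono-≤ (m^n>0 (suc σ) Λ) (≤-trans (≤-reflexive (begin
    length (concatMap (λ a → map (a ∷_) (strings σ Λ)) (downFrom σ)) ≡⟨ sym (∑-one (concatMap (λ a → map (a ∷_) (strings σ Λ)) (downFrom σ))) ⟩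
    ∑ (concatMap (λ a → map (a ∷_) (strings σ Λ)) (downFrom σ)) (λ _ → 1) ≡⟨ ∑-concatMap _ (downFrom σ) (λ _ → 1) ⟩
    ∑ (downFrom σ) (λ a → ∑ (map (a ∷_) (strings σ Λ)) (λ _ → 1))
      ≡⟨ ∑-cong (downFrom σ) (λ a → trans (∑-map (a ∷_) (strings σ Λ) (λ _ → 1)) (∑-one (strings σ Λ))) ⟩
    ∑ (downFrom σ) (λ _ → length (strings σ Λ)) ≡⟨ ∑-const (downFrom σ) _ ⟩
    length (downFrom σ) * length (strings σ Λ) ≡⟨ cong (_* length (strings σ Λ)) (length-downFrom σ) ⟩
    σ * length (strings σ Λ) ∎))
  (*-monoʳ-≤ σ (length-strings σ Λ)))
  where open ≡-Reasoning

∈-strings : ∀ {σ xs} Λ → All (_< σ) xs → length xs ≤ Λ → xs ∈ strings σ Λ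
∈-strings zero [] _ = here refl
∈-strings (suc Λ) [] _ = here refl
∈-strings {σ} (suc Λ) (p ∷ ps) (s≤s le) = there (∈-concatMap⁺ (λ a → map (a ∷_) (strings σ Λ))
  (lose (∈-downFrom⁺ p) (∈-map⁺ _ (∈-strings Λ ps le))))

map-unique : ∀ {A B : Set} (f : A → B) {xs} → Unique xs → (∀ {x y} → x ∈ xs → y ∈ xs → f x ≡ f y → x ≡ y) → Unique (map f xs)
map-unique f [] inj = []
map-unique f {x ∷ xs} (x∉ ∷ u) inj =
  Allₚ.map⁺ (All.tabulate λ y∈ e → All.lookup x∉ y∈ (inj (here refl) (there y∈) e)) ∷
  map-unique f u (λ x∈ y∈ → inj (there x∈) (there y∈))

midCost : ℕ → ℕ
midCost Δ = windowConstant * 4 * Δ + evenConstant * Δ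

-- The summands pay for the short symbols of both levels, for the tuples of expansion length at most
-- Λ, and, of the order of Δ ℓ / Λ rounded up, for the longer tuples.
lowCost : ℕ → ℕ → ℕ → ℕ → ℕ
lowCost σ Δ Λ c = 4 * length (strings σ Λ) + (suc Λ * (length (strings σ Λ) * Λ) + suc ((evenConstant * Δ * lev c) / suc Λ))

module Counts (s : List ℕ) (σ : ℕ) (letters : All (_< σ) s) (Δ : ℕ) (1≤Δ : 1 ≤ Δ)
  (reps : ∀ L → 1 ≤ L → Representatives s L (Δ * L)) where

  module _ {c α T} (good : Good s c α T) where
    open Good good

    -- By `Canon` expansion is injective on the factors of T, so they can be counted as strings.
    factor-count : ∀ Λ {D} → Unique D → (∀ {w} → w ∈ D → Factor T w × expLens w ≤ Λ) → length D ≤ length (strings σ Λ)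
    factor-count Λ {D} u h = ≤-trans (≤-reflexive (sym (length-map flats D)))
      (unique-⊆⇒length≤ (map-unique flats u injective) covered)
      where
      injective : ∀ {v w} → v ∈ D → w ∈ D → flats v ≡ flats w → v ≡ w
      injective v∈ w∈ e with h v∈ | h w∈
      ... | (U , V , d) , _ | (U' , V' , d') , _ = canon U _ V U' _ V' d d' e
      covered : ∀ {x} → x ∈ map flats D → x ∈ strings σ Λ
      covered x∈ with ∈-map⁻ flats x∈
      ... | w , w∈ , refl with h w∈
      ...   | (U , V , d) , le = ∈-strings Λ
              (Allₚ.++⁻ˡ (flats w) (Allₚ.++⁻ʳ (flats U) (subst (All (_< σ))
                (trans (sym flat-eq) (trans (cong flats d) (trans (flats-++ U _) (cong (flats U ++_) (flats-++ w V))))) letters)))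
              (≤-trans (≤-reflexive (length-flats w)) le)

    singles : ℕ → List (List Sym)
    singles k = map (_∷ []) (inSyms k T)

    singles-unique : ∀ k → Unique (singles k)
    singles-unique k = map-unique (_∷ []) (filterᵇ-unique (inA k) (dedup-unique T)) (λ _ _ → ∷-injectiveˡ)

    singles-sound : ∀ k {w} → w ∈ singles k → ∃ λ x → w ≡ x ∷ [] × Factor T w × inA k x ≡ true
    singles-sound k w∈ with ∈-map⁻ (_∷ []) w∈
    ... | x , x∈ , refl with ∈-filterᵇ (inA k) (dedup T) x∈
    ...   | x∈d , ix with ∈-∃++ (∈-dedup T x∈d)
    ...     | U , V , d = x , refl , (U , V , d) , ix

    module _ (k : ℕ) (lv : Level k c) where

      symbols-few : ∀ Λ → lev c ≤ Λ → length (inSyms k T) ≤ length (strings σ Λ)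
      symbols-few Λ le = ≤-trans (≤-reflexive (sym (length-map _ (inSyms k T))))
        (factor-count Λ (singles-unique k) short)
        where
        short : ∀ {w} → w ∈ singles k → Factor T w × expLens w ≤ Λ
        short w∈ with singles-sound k w∈
        ... | x , refl , f , ix = f , ≤-trans (≤-reflexive (+-identityʳ _)) (≤-trans (inA-lev {k} lv {x} ix) le)

      shorts-few : ∀ Λ r → length (filterᵇ (λ w → expLens w ≤ᵇ Λ) (windows k r T)) ≤ length (strings σ Λ)
      shorts-few Λ r = factor-count Λ (filterᵇ-unique _ (windows-unique k r T)) short
        where
        short : ∀ {w} → w ∈ filterᵇ (λ w → expLens w ≤ᵇ Λ) (windows k r T) → Factor T w × expLens w ≤ Λ
        short {w} w∈ with ∈-filterᵇ (λ w → expLens w ≤ᵇ Λ) (windows k r T) w∈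
        ... | p , q = proj₁ (windows-sound k r T p) , ≤ᵇ-sound (expLens w) Λ q

      module _ (α-bound : 3 ^ c * α ≤ 14 * 4 ^ c) where

        private
          at : ∀ {w} → Factor T w → ∃ λ q → At T q w
          at (U , V , d) = expLens U , U , V , d , refl

        windows-few : ∀ r → 1 ≤ r → length (windows k r T) ≤ windowConstant * (r * Δ)
        windows-few r 1≤r = WindowCount.windows-bound good Δ reps α-bound r 1≤r 1≤Δ (windows k r T) (windows-unique k r T)
          (λ w∈ → at (proj₁ (windows-sound k r T w∈))) (λ w∈ → proj₁ (proj₂ (windows-sound k r T w∈))) short
          where
          short : ∀ {w} → w ∈ windows k r T → expLens w ≤ r * lev c
          short w∈ with windows-sound k r T w∈
          ... | _ , refl , ins = expLens-in {k} lv ins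

        symbols-bound : length (inSyms k T) ≤ windowConstant * (1 * Δ)
        symbols-bound = ≤-trans (≤-reflexive (sym (length-map _ (inSyms k T))))
          (WindowCount.windows-bound good Δ reps α-bound 1 ≤-refl 1≤Δ (singles k) (singles-unique k) occurs length-1 short)
          where
          occurs : ∀ {w} → w ∈ singles k → ∃ λ q → At T q w
          occurs w∈ with singles-sound k w∈
          ... | x , refl , f , ix = at f
          length-1 : ∀ {w} → w ∈ singles k → length w ≡ 1
          length-1 w∈ with singles-sound k w∈
          ... | x , refl , _ = refl
          short : ∀ {w} → w ∈ singles k → expLens w ≤ 1 * lev c
          short w∈ with singles-sound k w∈
          ... | x , refl , f , ix = ≤-trans (≤-reflexive (+-identityʳ _)) (≤-trans (inA-lev {k} lv {x} ix) (≤-reflexive (sym (*-identityˡ _))))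

  margin-bound : ∀ c → 3 ^ c * margin c ≤ 14 * 4 ^ c
  margin-bound c = ≤-trans (3^c*margin≤ c) (*-monoˡ-≤ (4 ^ c) (m≤m+n 12 2))

  -- `EvenLevel` with Λ = 0, where every nonempty window is long and u = v = 1 says that it has a
  -- symbol.
  mid-budget : ∀ c → Budget s c (midCost Δ)
  mid-budget c = record
    { w = windowConstant * (1 * Δ)
    ; e = 1 * (length (strings σ 0) * 0) + evenConstant * Δ
    ; odd-symbols = λ good → symbols-bound good (1 + c * 2) (oddLevel c) (margin-bound c)
    ; even-symbols = λ good → symbols-bound good (2 + c * 2) (evenLevel c) (3^c*margin+≤ c)
    ; even-tuples = λ good adj → EvenLevel.even-cost (2 + c * 2) (Good.positive good) adj Δ
        (windows-few good (2 + c * 2) (evenLevel c) (3^c*margin+≤ c)) 0 (length (strings σ 0)) (shorts-few good (2 + c * 2) (evenLevel c) 0)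
        1 1 (evenConstant * Δ)
        (λ {w} _ lt → ≤-trans (nonempty w lt) (≤-reflexive (sym (*-identityʳ (length w)))))
        ≤-refl
    ; total = ≤-reflexive (e₁ windowConstant Δ (evenConstant * Δ)) }
    where
    nonempty : ∀ w → 0 < expLens w → 1 ≤ length w
    nonempty (_ ∷ _) _ = s≤s z≤n
    e₁ : ∀ a d g → a * (1 * d) * 2 + (a * (1 * d) * 2 + (1 * (1 * 0) + g)) ≡ a * 4 * d + g
    e₁ = solve-∀

  -- Here u = 1 + Λ and v = ℓ: an expansion longer than Λ takes at least (1 + Λ) / ℓ short symbols,
  -- which gains the factor ℓ / Λ.
  low-budget : ∀ Λ c → lev c ≤ Λ → Budget s c (lowCost σ Δ Λ c)
  low-budget Λ c le = record
    { w = N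
    ; e = suc Λ * (N * Λ) + e
    ; odd-symbols = λ good → symbols-few good (1 + c * 2) (oddLevel c) Λ le
    ; even-symbols = λ good → symbols-few good (2 + c * 2) (evenLevel c) Λ le
    ; even-tuples = λ good adj → EvenLevel.even-cost (2 + c * 2) (Good.positive good) adj Δ
        (windows-few good (2 + c * 2) (evenLevel c) (3^c*margin+≤ c)) Λ N (shorts-few good (2 + c * 2) (evenLevel c) Λ)
        (suc Λ) (lev c) e
        (λ ins lt → ≤-trans lt (expLens-in {2 + c * 2} (evenLevel c) ins))
        (≤-trans (≤-reflexive (m≡m%n+[m/n]*n X (suc Λ))) (+-monoˡ-≤ (X / suc Λ * suc Λ) (<⇒≤ (m%n<n X (suc Λ)))))
    ; total = ≤-reflexive (e₁ N (suc Λ * (N * Λ) + e)) }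
    where
    N X e : ℕ
    N = length (strings σ Λ)
    X = evenConstant * Δ * lev c
    e = suc (X / suc Λ)
    e₁ : ∀ n x → n * 2 + (n * 2 + x) ≡ 4 * n + x
    e₁ = solve-∀

-- The measure δ and logarithms

-- The local membership test of dedupℕs, recovered by unification; the parameters it inherits from
-- its clause are unused, so that instances differing only in them are convertible.
mutual
  elemℕs : List ℕ → List (List ℕ) → Bool
  elemℕs = _

  dedupℕs-∷ : ∀ x xs → dedupℕs (x ∷ xs) ≡ (if elemℕs x xs then dedupℕs xs else x ∷ dedupℕs xs)
  dedupℕs-∷ x xs = refl

mutual
  eqℕs : List ℕ → List ℕ → List (List ℕ) → Bool
  eqℕs = _

  elemℕs-∷ : ∀ x y ys → elemℕs x (y ∷ ys) ≡ (eqℕs x y ys ∨ elemℕs x ys)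
  elemℕs-∷ x y ys = refl

eqℕs-sound : ∀ as bs ys → eqℕs as bs ys ≡ true → as ≡ bs
eqℕs-sound [] [] ys e = refl
eqℕs-sound (a ∷ as) (b ∷ bs) ys e =
  cong₂ _∷_ (≡ᵇ-sound a b (∧-conicalˡ _ _ e)) (eqℕs-sound as bs ys (∧-conicalʳ (a ≡ᵇ b) _ e))

elemℕs-sound : ∀ x ys → elemℕs x ys ≡ true → x ∈ ys
elemℕs-sound x (y ∷ ys) e = by (eqℕs x y ys) refl
  where
  by : ∀ d → eqℕs x y ys ≡ d → x ∈ y ∷ ys
  by true p = here (eqℕs-sound x y ys p)
  by false p = there (elemℕs-sound x ys (subst (λ d → (d ∨ elemℕs x ys) ≡ true) p e))

dedupℕs-complete : ∀ {x} xs → x ∈ xs → x ∈ dedupℕs xs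
dedupℕs-complete (y ∷ ys) x∈ = by (elemℕs y ys) refl x∈
  where
  by : ∀ d → elemℕs y ys ≡ d → ∀ {x} → x ∈ y ∷ ys → x ∈ dedupℕs (y ∷ ys)
  by true e (here refl) = subst (λ d → y ∈ (if d then dedupℕs ys else y ∷ dedupℕs ys)) (sym e) (dedupℕs-complete ys (elemℕs-sound y ys e))
  by true e (there p) = subst (λ d → _ ∈ (if d then dedupℕs ys else y ∷ dedupℕs ys)) (sym e) (dedupℕs-complete ys p)
  by false e (here refl) = subst (λ d → y ∈ (if d then dedupℕs ys else y ∷ dedupℕs ys)) (sym e) (here refl)
  by false e (there p) = subst (λ d → _ ∈ (if d then dedupℕs ys else y ∷ dedupℕs ys)) (sym e) (there (dedupℕs-complete ys p))

dedupℕs-sound : ∀ {x} xs → x ∈ dedupℕs xs → x ∈ xs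
dedupℕs-sound (y ∷ ys) x∈ = by (elemℕs y ys) x∈
  where
  by : ∀ d {x} → x ∈ (if d then dedupℕs ys else y ∷ dedupℕs ys) → x ∈ y ∷ ys
  by true p = there (dedupℕs-sound ys p)
  by false (here e) = here e
  by false (there p) = there (dedupℕs-sound ys p)

choose-positions : ∀ s L (D : List (List ℕ)) → (∀ {x} → x ∈ D → ∃ λ i → i + L ≤ length s × take L (drop i s) ≡ x) →
  ∃ λ Ps → length Ps ≡ length D × (∀ {x} → x ∈ D → ∃ λ P → P ∈ Ps × P + L ≤ length s × take L (drop P s) ≡ x)
choose-positions s L [] h = [] , refl , λ ()
choose-positions s L (x ∷ D) h with h (here refl) | choose-positions s L D (h ∘ there)
... | i , le , e | Ps , len , k = i ∷ Ps , cong suc len , λ where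
  (here refl) → i , here refl , le , e
  (there p) → let P , P∈ , r = k p in P , there P∈ , r

representatives : ∀ s Δ → (∀ i → i < length s → dk (suc i) s ≤ Δ * suc i) → ∀ L → 1 ≤ L → Representatives s L (Δ * L)
representatives s Δ h (suc l) _ with length s <ᵇ suc l in e
... | true = [] , z≤n , λ q le → contradiction (≤-trans (m≤n+m (suc l) q) le) (<⇒≱ (<ᵇ-sound (length s) (suc l) e))
... | false with choose-positions s (suc l) (dedupℕs (substrings (suc l) s)) located
  where
  located : ∀ {x} → x ∈ dedupℕs (substrings (suc l) s) → ∃ λ i → i + suc l ≤ length s × take (suc l) (drop i s) ≡ x
  located x∈ with ∈-applyUpTo⁻ (λ i → take (suc l) (drop i s)) (dedupℕs-sound (substrings (suc l) s) x∈)
  ... | i , i< , refl = i , ≤-trans (+-monoˡ-≤ (suc l) (≤-pred i<)) (≤-reflexive (m∸n+n≡m (<ᵇ-false⇒≥ (length s) (suc l) e))) , refl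
...   | Ps , len , k = Ps , ≤-trans (≤-reflexive len) bound , λ q le →
          let P , P∈ , fits , e' = k (dedupℕs-complete (substrings (suc l) s) (∈-applyUpTo⁺ (λ i → take (suc l) (drop i s)) (s≤s (m+n≤o⇒m≤o∸n q le))))
          in P , P∈ , sym e' , le , fits
  where
  bound : length (dedupℕs (substrings (suc l) s)) ≤ Δ * suc l
  bound = subst (λ b → (if b then 0 else length (dedupℕs (substrings (suc l) s))) ≤ Δ * suc l) e
    (h l (<ᵇ-false⇒≥ (length s) (suc l) e))

maximum : (ℕ → ℕ) → ℕ → ℕ
maximum g n = foldr _⊔_ 0 (applyUpTo g n)

maximumℚ : (ℕ → ℚ) → ℕ → ℚ
maximumℚ f n = foldr ℚ._⊔_ 0ℚ (applyUpTo f n)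

maximum-≥ : ∀ g n {i} → i < n → g i ≤ maximum g n
maximum-≥ g (suc n) {zero} _ = m≤m⊔n (g 0) _
maximum-≥ g (suc n) {suc i} (s≤s lt) = ≤-trans (maximum-≥ (g ∘ suc) n lt) (m≤n⊔m (g 0) _)

maximumℚ-≥0 : ∀ f n → 0ℚ ≤ℚ maximumℚ f n
maximumℚ-≥0 f zero = ℚₚ.≤-refl
maximumℚ-≥0 f (suc n) = ℚₚ.≤-trans (maximumℚ-≥0 (f ∘ suc) n) (ℚₚ.p≤q⊔p (f 0) _)

maximumℚ-≤ : ∀ f g n → (∀ i → f i ≤ℚ fromℕ (g i)) → maximumℚ f n ≤ℚ fromℕ (maximum g n)
maximumℚ-≤ f g zero h = ℚₚ.≤-refl
maximumℚ-≤ f g (suc n) h = ℚₚ.⊔-lub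
  (ℚₚ.≤-trans (h 0) (fromℕ-mono (g 0) _ (m≤m⊔n (g 0) _)))
  (ℚₚ.≤-trans (maximumℚ-≤ (f ∘ suc) (g ∘ suc) n (h ∘ suc)) (fromℕ-mono _ _ (m≤n⊔m (g 0) _)))

maximum-≤ : ∀ f g n → (∀ i → fromℕ (g i) ≤ℚ f i +ℚ fromℕ 1) → fromℕ (maximum g n) ≤ℚ maximumℚ f n +ℚ fromℕ 1
maximum-≤ f g zero h = ℚₚ.≤-trans (fromℕ-mono 0 1 z≤n) (ℚₚ.≤-reflexive (sym (ℚₚ.+-identityˡ (fromℕ 1))))
maximum-≤ f g (suc n) h with ⊔-sel (g 0) (maximum (g ∘ suc) n)
... | inj₁ e rewrite e = ℚₚ.≤-trans (h 0) (ℚₚ.+-monoˡ-≤ (fromℕ 1) (ℚₚ.p≤p⊔q (f 0) _))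
... | inj₂ e rewrite e = ℚₚ.≤-trans (maximum-≤ (f ∘ suc) (g ∘ suc) n (h ∘ suc)) (ℚₚ.+-monoˡ-≤ (fromℕ 1) (ℚₚ.p≤q⊔p (f 0) _))

ceilDiv : ℕ → ℕ → ℕ
ceilDiv a i = (a + i) / suc i

ceilDiv-≥ : ∀ a i → a ≤ ceilDiv a i * suc i
ceilDiv-≥ a i = +-cancelʳ-≤ i _ _ (≤-trans (≤-reflexive (trans (m≡m%n+[m/n]*n (a + i) (suc i)) (+-comm _ (ceilDiv a i * suc i))))
  (+-monoʳ-≤ (ceilDiv a i * suc i) (≤-pred (m%n<n (a + i) (suc i)))))

ceilDiv-≤ : ∀ a i → ceilDiv a i * suc i ≤ a + suc i
ceilDiv-≤ a i = ≤-trans (m/n*n≤m (a + i) (suc i)) (+-monoʳ-≤ a (n≤1+n i))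

scale-unit : ∀ a i → fromℕ (a * suc i) *ℚ unit i ≡ fromℕ a
scale-unit a i = trans (cong (_*ℚ unit i) (fromℕ-* a (suc i))) (trans (ℚₚ.*-assoc (fromℕ a) (fromℕ (suc i)) (unit i))
  (trans (cong (fromℕ a *ℚ_) (fromℕ-*-unit i)) (ℚₚ.*-identityʳ (fromℕ a))))

module Measure (s : List ℕ) where

  ratio : ℕ → ℚ
  ratio i = fromℕ (dk (suc i) s) *ℚ unit i

  -- The counting works with a natural number Δ in place of δ, the maximum of these ceilings. It
  -- lies between δ and δ + 1, and δ + 1 ≤ 2 δ because d_1 ≥ 1 for a nonempty string.
  ceiling : ℕ → ℕ
  ceiling i = ceilDiv (dk (suc i) s) i

  ratio≤ceiling : ∀ i → ratio i ≤ℚ fromℕ (ceiling i)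
  ratio≤ceiling i = ℚₚ.≤-trans
    (ℚₚ.*-monoʳ-≤-nonNeg (unit i) ⦃ unit-nonNegative i ⦄ (fromℕ-mono (dk (suc i) s) (ceiling i * suc i) (ceilDiv-≥ (dk (suc i) s) i)))
    (ℚₚ.≤-reflexive (scale-unit (ceiling i) i))

  ceiling≤ratio+1 : ∀ i → fromℕ (ceiling i) ≤ℚ ratio i +ℚ fromℕ 1
  ceiling≤ratio+1 i = begin
    fromℕ (ceiling i) ≡⟨ sym (scale-unit (ceiling i) i) ⟩
    fromℕ (ceiling i * suc i) *ℚ unit i
      ≤⟨ ℚₚ.*-monoʳ-≤-nonNeg (unit i) ⦃ unit-nonNegative i ⦄ (fromℕ-mono (ceiling i * suc i) (dk (suc i) s + suc i) (ceilDiv-≤ (dk (suc i) s) i)) ⟩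
    fromℕ (dk (suc i) s + suc i) *ℚ unit i ≡⟨ cong (_*ℚ unit i) (fromℕ-+ (dk (suc i) s) (suc i)) ⟩
    (fromℕ (dk (suc i) s) +ℚ fromℕ (suc i)) *ℚ unit i ≡⟨ ℚₚ.*-distribʳ-+ (unit i) (fromℕ (dk (suc i) s)) (fromℕ (suc i)) ⟩
    ratio i +ℚ fromℕ (suc i) *ℚ unit i ≡⟨ cong (ratio i +ℚ_) (fromℕ-*-unit i) ⟩
    ratio i +ℚ fromℕ 1 ∎
    where open ℚₚ.≤-Reasoning

  dk-1-positive : 1 ≤ length s → 1 ≤ dk 1 s
  dk-1-positive le with length s <ᵇ 1 in e
  ... | true = contradiction le (<⇒≱ (<ᵇ-sound (length s) 1 e))
  ... | false = nonempty (dedupℕs-complete (substrings 1 s) (here refl))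
    where
    nonempty : ∀ {A : Set} {x : A} {xs} → x ∈ xs → 1 ≤ length xs
    nonempty {xs = _ ∷ _} _ = s≤s z≤n

  1≤ratio : 1 ≤ length s → fromℕ 1 ≤ℚ ratio 0
  1≤ratio le = ℚₚ.≤-trans (fromℕ-mono 1 (dk 1 s) (dk-1-positive le)) (ℚₚ.≤-reflexive (sym (ℚₚ.*-identityʳ (fromℕ (dk 1 s)))))

half-bound : ∀ n → n ≤ ⌈ n /2⌉ + ⌈ n /2⌉
half-bound n = ≤-trans (≤-reflexive (sym (⌊n/2⌋+⌈n/2⌉≡n n))) (+-monoˡ-≤ ⌈ n /2⌉ (⌊n/2⌋≤⌈n/2⌉ n))

n≤2^⌈log₂n⌉ : ∀ n → n ≤ 2 ^ ⌈log₂ n ⌉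
n≤2^⌈log₂n⌉ = <-rec _ go
  where
  go : ∀ n → (∀ {m} → m < n → m ≤ 2 ^ ⌈log₂ m ⌉) → n ≤ 2 ^ ⌈log₂ n ⌉
  go zero ih = z≤n
  go (suc zero) ih = m^n>0 2 ⌈log₂ 1 ⌉
  go n@(suc (suc k)) ih = begin
    n ≤⟨ half-bound n ⟩
    ⌈ n /2⌉ + ⌈ n /2⌉ ≤⟨ +-mono-≤ ih' (≤-trans ih' (≤-reflexive (sym (+-identityʳ _)))) ⟩
    2 * 2 ^ (⌈log₂ n ⌉ ∸ 1) ≡⟨ cong (2 ^_) (m+[n∸m]≡n 1≤log) ⟩
    2 ^ ⌈log₂ n ⌉ ∎
    where
    open ≤-Reasoning
    1≤log : 1 ≤ ⌈log₂ n ⌉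
    1≤log = ⌈log₂⌉-mono-≤ {2} {n} (s≤s (s≤s z≤n))
    ih' : ⌈ n /2⌉ ≤ 2 ^ (⌈log₂ n ⌉ ∸ 1)
    ih' = ≤-trans (ih (⌈n/2⌉<n k)) (≤-reflexive (cong (2 ^_) (⌈log₂⌈n/2⌉⌉≡⌈log₂n⌉∸1 n)))

2^⌈log₂n⌉≤2n : ∀ n → 2 ≤ n → 2 ^ ⌈log₂ n ⌉ ≤ 2 * n
2^⌈log₂n⌉≤2n n 2≤n with ⌈log₂ n ⌉ in e
... | zero = ≤-trans (s≤s z≤n) (≤-trans 2≤n (m≤m+n n _))
... | suc l = *-monoʳ-≤ 2 {2 ^ l} {n} (≮⇒≥ λ lt → <-irrefl refl (begin-strict
      l <⟨ ≤-reflexive (sym e) ⟩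
      ⌈log₂ n ⌉ ≤⟨ ⌈log₂⌉-mono-≤ {n} {2 ^ l} (<⇒≤ lt) ⟩
      ⌈log₂ 2 ^ l ⌉ ≡⟨ ⌈log₂2^n⌉≡n l ⟩
      l ∎))
  where open ≤-Reasoning

-- Choice of levels

least : ∀ {P : ℕ → Set} → (∀ c → Dec (P c)) → ∀ m → P m → ∃ λ h → h ≤ m × P h × (∀ c → c < h → ¬ P c)
least P? zero p = 0 , z≤n , p , λ _ ()
least P? (suc m) p with P? 0
... | yes p₀ = 0 , z≤n , p₀ , λ _ ()
... | no ¬p₀ with least (P? ∘ suc) m p
...   | h , h≤ , q , below = suc h , s≤s h≤ , q , λ where
  zero _ → ¬p₀
  (suc c) (s≤s lt) → below c lt

-- As (4/3)^3 = 64/27 > 2, three steps of the exponent at least double (4/3)^c.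
2^m*3^3m≤4^3m : ∀ m → 2 ^ m * 3 ^ (m * 3) ≤ 4 ^ (m * 3)
2^m*3^3m≤4^3m zero = ≤-refl
2^m*3^3m≤4^3m (suc m) = begin
  2 * 2 ^ m * (3 * (3 * (3 * 3 ^ (m * 3)))) ≡⟨ e (2 ^ m) (3 ^ (m * 3)) ⟩
  54 * (2 ^ m * 3 ^ (m * 3))                ≤⟨ *-mono-≤ (m≤m+n 54 10) (2^m*3^3m≤4^3m m) ⟩
  64 * 4 ^ (m * 3)                          ≡⟨ e′ (4 ^ (m * 3)) ⟩
  4 * (4 * (4 * 4 ^ (m * 3)))               ∎
  where
  open ≤-Reasoning
  e : ∀ a b → 2 * a * (3 * (3 * (3 * b))) ≡ 54 * (a * b)
  e = solve-∀
  e′ : ∀ a → 64 * a ≡ 4 * (4 * (4 * a))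
  e′ = solve-∀

2^t*2^t≡4^t : ∀ t → 2 ^ t * 2 ^ t ≡ 4 ^ t
2^t*2^t≡4^t zero = refl
2^t*2^t≡4^t (suc t) = trans (e (2 ^ t)) (cong (4 *_) (2^t*2^t≡4^t t))
  where
  e : ∀ a → 2 * a * (2 * a) ≡ 4 * (a * a)
  e = solve-∀

sumFrom-+ : ∀ x c i j → sumFrom x c (i + j) ≡ sumFrom x c i + sumFrom x (c + i) j
sumFrom-+ x c zero j = cong (λ z → sumFrom x z j) (sym (+-identityʳ c))
sumFrom-+ x c (suc i) j = trans (cong (x c +_) (trans (sumFrom-+ x (suc c) i j)
  (cong (λ z → sumFrom x (suc c) i + sumFrom x z j) (sym (+-suc c i))))) (sym (+-assoc (x c) _ _))

sumFrom-cong : ∀ x y c i → (∀ k → c ≤ k → k < c + i → x k ≡ y k) → sumFrom x c i ≡ sumFrom y c i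
sumFrom-cong x y c zero h = refl
sumFrom-cong x y c (suc i) h = cong₂ _+_ (h c ≤-refl (≤-trans (s≤s (m≤m+n c i)) (≤-reflexive (sym (+-suc c i)))))
  (sumFrom-cong x y (suc c) i (λ k lo hi → h k (<⇒≤ lo) (≤-trans hi (≤-reflexive (sym (+-suc c i))))))

sumFrom-const : ∀ a c i → sumFrom (λ _ → a) c i ≡ i * a
sumFrom-const a c zero = refl
sumFrom-const a c (suc i) = cong (a +_) (sumFrom-const a (suc c) i)

-- Since `margin` is four times the sum of the thresholds, its bound doubles as the geometric sum
-- for the low levels.
margin-sumFrom : ∀ c j → margin c + 4 * sumFrom lev c j ≡ margin (c + j)
margin-sumFrom c zero = trans (+-identityʳ _) (cong margin (sym (+-identityʳ c)))
margin-sumFrom c (suc j) = trans (e (margin c) (lev c) (sumFrom lev (suc c) j))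
  (trans (margin-sumFrom (suc c) j) (cong margin (sym (+-suc c j))))
  where
  e : ∀ m l r → m + 4 * (l + r) ≡ m + l + l + l + l + 4 * r
  e = solve-∀

module LowLevels (σ Δ Λ : ℕ) where

  St fixed : ℕ
  St = length (strings σ Λ)
  fixed = 4 * St + suc Λ * (St * Λ) + 1

  quotient : ℕ → ℕ
  quotient c = (evenConstant * Δ * lev c) / suc Λ

  lowCost-sum : ∀ c i → sumFrom (lowCost σ Δ Λ) c i ≡ i * fixed + sumFrom quotient c i
  lowCost-sum c zero = refl
  lowCost-sum c (suc i) = trans (cong (lowCost σ Δ Λ c +_) (lowCost-sum (suc c) i))
    (e (4 * St) (suc Λ * (St * Λ)) (quotient c) (i * fixed) (sumFrom quotient (suc c) i))
    where
    e : ∀ a b q f r → a + (b + suc q) + (f + r) ≡ a + b + 1 + f + (q + r)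
    e = solve-∀

  quotient-sum : ∀ c i → suc Λ * sumFrom quotient c i ≤ evenConstant * Δ * sumFrom lev c i
  quotient-sum c zero = ≤-trans (≤-reflexive (*-zeroʳ (suc Λ))) z≤n
  quotient-sum c (suc i) = begin
    suc Λ * (quotient c + sumFrom quotient (suc c) i) ≡⟨ *-distribˡ-+ (suc Λ) (quotient c) _ ⟩
    suc Λ * quotient c + suc Λ * sumFrom quotient (suc c) i
      ≤⟨ +-mono-≤ (≤-trans (≤-reflexive (*-comm (suc Λ) (quotient c))) (m/n*n≤m (evenConstant * Δ * lev c) (suc Λ))) (quotient-sum (suc c) i) ⟩
    evenConstant * Δ * lev c + evenConstant * Δ * sumFrom lev (suc c) i ≡⟨ sym (*-distribˡ-+ (evenConstant * Δ) (lev c) _) ⟩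
    evenConstant * Δ * (lev c + sumFrom lev (suc c) i) ∎
    where open ≤-Reasoning

  -- The last threshold before h is at most Λ, so all of them sum to at most 4 Λ, and the terms Δ ℓ
  -- / Λ add up to O(Δ) however large h is.
  quotient-total : ∀ h → (∀ c → c < h → 4 ^ c ≤ 3 ^ c * Λ) → sumFrom quotient 0 h ≤ 4 * evenConstant * Δ
  quotient-total zero _ = z≤n
  quotient-total h@(suc h') low = *-cancelˡ-≤ (suc Λ) (*-cancelˡ-≤ 4 (begin
    4 * (suc Λ * sumFrom quotient 0 h) ≤⟨ *-monoʳ-≤ 4 (quotient-sum 0 h) ⟩
    4 * (E * sumFrom lev 0 h)          ≡⟨ e₁ E (sumFrom lev 0 h) ⟩
    E * (4 * sumFrom lev 0 h)          ≡⟨ cong (E *_) (margin-sumFrom 0 h) ⟩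
    E * margin h                       ≤⟨ *-monoʳ-≤ E margin≤ ⟩
    E * (16 * Λ)                       ≤⟨ *-monoʳ-≤ E (*-monoʳ-≤ 16 (n≤1+n Λ)) ⟩
    E * (16 * suc Λ)                   ≡⟨ e₂ evenConstant Δ (suc Λ) ⟩
    4 * (suc Λ * (4 * evenConstant * Δ)) ∎))
    where
    open ≤-Reasoning
    E = evenConstant * Δ
    e₁ : ∀ a b → 4 * (a * b) ≡ a * (4 * b)
    e₁ = solve-∀
    e₂ : ∀ a d l → a * d * (16 * l) ≡ 4 * (l * (4 * a * d))
    e₂ = solve-∀
    e₃ : ∀ b l → 12 * (4 * (b * l)) ≡ 3 * b * (16 * l)
    e₃ = solve-∀
    margin≤ : margin h ≤ 16 * Λ
    margin≤ = *-cancelˡ-≤ (3 ^ h) ⦃ m^n≢0 3 h ⦄ (≤-trans (3^c*margin≤ h)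
      (≤-trans (*-monoʳ-≤ 12 (*-monoʳ-≤ 4 (low h' ≤-refl))) (≤-reflexive (e₃ (3 ^ h') Λ))))

  -- All factors polynomial in Λ, the number h of exponents included, are bounded by powers of 2^Λ.
  -- The exponent 3 Λ + 2 λ Λ, with λ = 1 + l, fits into 5 λ Λ; and 18 = 3 · 6.
  fixed-total : ∀ h l → h ≤ Λ * 3 → suc σ ≤ 2 ^ (2 * suc l) → h * fixed ≤ 18 * 2 ^ (5 * suc l * Λ)
  fixed-total h l h≤ σ≤ = begin
    h * fixed ≤⟨ *-mono-≤ h≤3a fixed≤ ⟩
    a * 3 * (6 * (a * a * W)) ≡⟨ e₁ a W ⟩
    18 * (a * a * a * W) ≡⟨ cong (18 *_) powers ⟩
    18 * 2 ^ (Λ + Λ + Λ + 2 * suc l * Λ) ≤⟨ *-monoʳ-≤ 18 (^-monoʳ-≤ 2 exponent) ⟩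
    18 * 2 ^ (5 * suc l * Λ) ∎
    where
    open ≤-Reasoning
    a W : ℕ
    a = 2 ^ Λ
    W = 2 ^ (2 * suc l * Λ)
    1≤a : 1 ≤ a
    1≤a = m^n>0 2 Λ
    h≤3a : h ≤ a * 3
    h≤3a = ≤-trans h≤ (*-monoˡ-≤ 3 (<⇒≤ (n<2^n Λ)))
    St≤ : St ≤ W
    St≤ = ≤-trans (length-strings σ Λ) (≤-trans (^-monoˡ-≤ Λ σ≤) (≤-reflexive (^-*-assoc 2 (2 * suc l) Λ)))
    aaW≥ : W ≤ a * a * W
    aaW≥ = ≤-trans (≤-reflexive (sym (*-identityˡ W))) (*-monoˡ-≤ W (*-mono-≤ 1≤a 1≤a))
    fixed≤ : fixed ≤ 6 * (a * a * W)
    fixed≤ = ≤-trans (+-mono-≤ (+-mono-≤ (*-monoʳ-≤ 4 (≤-trans St≤ aaW≥)) (*-mono-≤ (n<2^n Λ) (*-mono-≤ St≤ (<⇒≤ (n<2^n Λ)))))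
      (≤-trans (m^n>0 2 (2 * suc l * Λ)) aaW≥)) (≤-reflexive (e₂ a W))
      where
      e₂ : ∀ a w → 4 * (a * a * w) + a * (w * a) + a * a * w ≡ 6 * (a * a * w)
      e₂ = solve-∀
    e₁ : ∀ a w → a * 3 * (6 * (a * a * w)) ≡ 18 * (a * a * a * w)
    e₁ = solve-∀
    powers : a * a * a * W ≡ 2 ^ (Λ + Λ + Λ + 2 * suc l * Λ)
    powers = trans (cong (_* W) (trans (cong (_* a) (sym (^-distribˡ-+-* 2 Λ Λ))) (sym (^-distribˡ-+-* 2 (Λ + Λ) Λ))))
      (sym (^-distribˡ-+-* 2 (Λ + Λ + Λ) (2 * suc l * Λ)))
    exponent : Λ + Λ + Λ + 2 * suc l * Λ ≤ 5 * suc l * Λ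
    exponent = ≤-trans (m≤m+n _ (3 * l * Λ)) (≤-reflexive (e₃ Λ l))
      where
      e₃ : ∀ L l → L + L + L + 2 * suc l * L + 3 * l * L ≡ 5 * suc l * L
      e₃ = solve-∀

lowConstant : ℕ
lowConstant = 18 + 4 * evenConstant

totalConstant : ℕ
totalConstant = lowConstant + (levelConstant * 3 + 9) * (windowConstant * 4 + evenConstant) + 32

-- ℓ_h is of the order of (log n / log σ), up to the factor 4 ^ t, where n log σ ≤ 2 ^ t Δ log n.
record Threshold (σ Δ N n t λ′ : ℕ) : Set where
  field
    Λ h : ℕ
    low : ∀ c → c < h → 4 ^ c ≤ 3 ^ c * Λ
    cost : sumFrom (lowCost σ Δ Λ) 0 h ≤ lowConstant * Δ
    small : h * 2 ≤ n
    large : 3 ^ h * N ≤ 2 ^ levelConstant * (λ′ * 4 ^ h * 4 ^ t)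

module Thresholds (n t σ Δ N l : ℕ) (1≤Δ : 1 ≤ Δ) (1≤N : 1 ≤ N) (N≤n : N ≤ n) (2^N≤2n : 2 ^ N ≤ 2 * n)
  (σ≤ : suc σ ≤ 2 ^ (2 * suc l)) (hyp : n * suc l ≤ 2 ^ t * Δ * N) where

  -- With λ = 1 + l for log σ, the 10 is twice the 5 of `fixed-total`: then q² ≤ 2^N ≤ 2 n, so the
  -- part of the low cost bounded by q is O(√n). Comparing q with Δ decides whether low levels are
  -- set apart.
  Λ₀ q : ℕ
  Λ₀ = N / (10 * suc l)
  q = 2 ^ (5 * suc l * Λ₀)

  10λΛ≤N : Λ₀ * (10 * suc l) ≤ N
  10λΛ≤N = m/n*n≤m N (10 * suc l)

  q²≤2n : q * q ≤ 2 * n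
  q²≤2n = ≤-trans (≤-reflexive (sym (^-distribˡ-+-* 2 (5 * suc l * Λ₀) (5 * suc l * Λ₀))))
    (≤-trans (^-monoʳ-≤ 2 (≤-trans (≤-reflexive (e l Λ₀)) 10λΛ≤N)) 2^N≤2n)
    where
    e : ∀ l L → 5 * suc l * L + 5 * suc l * L ≡ L * (10 * suc l)
    e = solve-∀

  4^t≥1 : 1 ≤ 4 ^ t
  4^t≥1 = m^n>0 4 t

  -- h is the least exponent with (4/3)^h > Λ₀, and (4/3)^(3 m) ≥ 2^m > m shows that h ≤ 3 Λ₀. As N
  -- ≤ (1 + Λ₀) · 10 λ, the threshold has then reached the order of N / λ.
  dense : q ≤ Δ → Threshold σ Δ N n t (suc l)
  dense q≤Δ with least (λ c → 3 ^ c * Λ₀ <? 4 ^ c) (Λ₀ * 3)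
    (≤-trans (*-monoʳ-< (3 ^ (Λ₀ * 3)) ⦃ m^n≢0 3 (Λ₀ * 3) ⦄ (n<2^n Λ₀))
      (≤-trans (≤-reflexive (*-comm (3 ^ (Λ₀ * 3)) (2 ^ Λ₀))) (2^m*3^3m≤4^3m Λ₀)))
  ... | h , h≤ , above , below = record
    { Λ = Λ₀
    ; h = h
    ; low = low
    ; cost = ≤-trans (≤-reflexive (LowLevels.lowCost-sum σ Δ Λ₀ 0 h))
        (≤-trans (+-mono-≤ (≤-trans (LowLevels.fixed-total σ Δ Λ₀ h l h≤ σ≤) (*-monoʳ-≤ 18 q≤Δ)) (LowLevels.quotient-total σ Δ Λ₀ h low))
          (≤-reflexive (sym (*-distribʳ-+ Δ 18 (4 * evenConstant)))))
    ; small = ≤-trans (*-monoˡ-≤ 2 h≤) (≤-trans (≤-trans (≤-reflexive (*-assoc Λ₀ 3 2)) (*-monoʳ-≤ Λ₀ 6≤)) (≤-trans 10λΛ≤N N≤n))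
    ; large = large }
    where
    low : ∀ c → c < h → 4 ^ c ≤ 3 ^ c * Λ₀
    low c lt = ≮⇒≥ (below c lt)
    6≤ : 6 ≤ 10 * suc l
    6≤ = ≤-trans (m≤m+n 6 4) (*-monoʳ-≤ 10 (s≤s z≤n))
    N< : N ≤ suc Λ₀ * (10 * suc l)
    N< = ≤-trans (≤-reflexive (m≡m%n+[m/n]*n N (10 * suc l))) (+-monoˡ-≤ (Λ₀ * (10 * suc l)) (<⇒≤ (m%n<n N (10 * suc l))))
    large : 3 ^ h * N ≤ 2 ^ levelConstant * (suc l * 4 ^ h * 4 ^ t)
    large = begin
      3 ^ h * N ≤⟨ *-monoʳ-≤ (3 ^ h) N< ⟩
      3 ^ h * (suc Λ₀ * (10 * suc l)) ≡⟨ e₁ (3 ^ h) Λ₀ l ⟩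
      (3 ^ h + 3 ^ h * Λ₀) * (10 * suc l) ≤⟨ *-monoˡ-≤ (10 * suc l) (+-mono-≤ (^-monoˡ-≤ h (n≤1+n 3)) (<⇒≤ above)) ⟩
      (4 ^ h + 4 ^ h) * (10 * suc l) ≡⟨ e₂ (4 ^ h) l ⟩
      20 * (suc l * 4 ^ h * 1) ≤⟨ *-mono-≤ (≤-trans (m≤n+m 20 (4 * tailConstant)) 4*tailConstant+20≤) (*-monoʳ-≤ (suc l * 4 ^ h) 4^t≥1) ⟩
      2 ^ levelConstant * (suc l * 4 ^ h * 4 ^ t) ∎
      where
      open ≤-Reasoning
      e₁ : ∀ b L l → b * (suc L * (10 * suc l)) ≡ (b + b * L) * (10 * suc l)
      e₁ = solve-∀
      e₂ : ∀ a l → (a + a) * (10 * suc l) ≡ 20 * (suc l * a * 1)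
      e₂ = solve-∀

  -- Here Δ < √(2n), so that 2 ^ t is at least of the order of √n / log n.
  sparse : Δ < q → Threshold σ Δ N n t (suc l)
  sparse Δ<q = record
    { Λ = 0 ; h = 0 ; low = λ _ () ; cost = z≤n ; small = z≤n
    ; large = ≤-trans (≤-reflexive (*-identityˡ N)) (≤-trans N≤ (*-mono-≤ (≤-trans (m≤m+n _ 20) 4*tailConstant+20≤)
        (≤-trans (≤-reflexive (sym (*-identityˡ (4 ^ t)))) (*-monoˡ-≤ (4 ^ t) {1} {suc l * 1} (s≤s z≤n))))) }
    where
    open ≤-Reasoning
    n≤ : n ≤ 2 ^ t * Δ * N
    n≤ = ≤-trans (m≤m*n n (suc l)) hyp
    1≤n : 1 ≤ n
    1≤n = ≤-trans 1≤N N≤n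
    -- The square of n ≤ 2^t Δ N, with Δ² ≤ q² ≤ 2 n, divided by n.
    n≤′ : n ≤ 2 * 4 ^ t * (N * N)
    n≤′ = *-cancelˡ-≤ n ⦃ >-nonZero 1≤n ⦄ (begin
      n * n ≤⟨ *-mono-≤ n≤ n≤ ⟩
      2 ^ t * Δ * N * (2 ^ t * Δ * N) ≡⟨ e₁ (2 ^ t) Δ N ⟩
      2 ^ t * 2 ^ t * (Δ * Δ) * (N * N) ≡⟨ cong (λ z → z * (Δ * Δ) * (N * N)) (2^t*2^t≡4^t t) ⟩
      4 ^ t * (Δ * Δ) * (N * N) ≤⟨ *-monoˡ-≤ (N * N) (*-monoʳ-≤ (4 ^ t) (≤-trans (*-mono-≤ (<⇒≤ Δ<q) (<⇒≤ Δ<q)) q²≤2n)) ⟩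
      4 ^ t * (2 * n) * (N * N) ≡⟨ e₂ (4 ^ t) n N ⟩
      n * (2 * 4 ^ t * (N * N)) ∎)
      where
      e₁ : ∀ a d m → a * d * m * (a * d * m) ≡ a * a * (d * d) * (m * m)
      e₁ = solve-∀
      e₂ : ∀ a n m → a * (2 * n) * (m * m) ≡ n * (2 * a * (m * m))
      e₂ = solve-∀
    P : ℕ
    P = tailConstant
    NN≢0 : NonZero (N * N)
    NN≢0 = >-nonZero (*-mono-≤ 1≤N 1≤N)
    -- Since 2^N ≤ 2 n, the bound on n makes 2^N at most O(4^t N²), while N³ is O(2^N).
    N≤ : N ≤ 4 * P * 4 ^ t
    N≤ = *-cancelʳ-≤ N (4 * P * 4 ^ t) (N * N) ⦃ NN≢0 ⦄ (begin
      N * (N * N) ≤⟨ *-monoʳ-≤ N (*-monoʳ-≤ N (≤-trans (≤-reflexive (sym (*-identityʳ N))) (*-monoʳ-≤ N (*-mono-≤ 1≤N (*-mono-≤ 1≤N (≤-refl {1})))))) ⟩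
      N ^ 5 ≤⟨ tail-power≤ N ⟩
      P * 2 ^ (N / 4) ≤⟨ *-monoʳ-≤ P (^-monoʳ-≤ 2 (m/n≤m N 4)) ⟩
      P * 2 ^ N ≤⟨ *-monoʳ-≤ P (≤-trans 2^N≤2n (*-monoʳ-≤ 2 n≤′)) ⟩
      P * (2 * (2 * 4 ^ t * (N * N))) ≡⟨ e P (4 ^ t) (N * N) ⟩
      4 * P * 4 ^ t * (N * N) ∎)
      where
      e : ∀ p a m → p * (2 * (2 * a * m)) ≡ 4 * p * a * m
      e = solve-∀

  threshold : Threshold σ Δ N n t (suc l)
  threshold with q ≤? Δ
  ... | yes le = dense le
  ... | no gt = sparse (≰⇒> gt)

  open Threshold threshold public

  enough-n : 3 ^ (h + n * 3) * n ≤ 4 ^ (h + n * 3) * Δ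
  enough-n = begin
    3 ^ (h + n * 3) * n             ≡⟨ cong (_* n) (^-distribˡ-+-* 3 h (n * 3)) ⟩
    3 ^ h * 3 ^ (n * 3) * n         ≤⟨ *-mono-≤ (*-monoˡ-≤ (3 ^ (n * 3)) (^-monoˡ-≤ h (n≤1+n 3))) (<⇒≤ (n<2^n n)) ⟩
    4 ^ h * 3 ^ (n * 3) * 2 ^ n     ≡⟨ e (4 ^ h) (3 ^ (n * 3)) (2 ^ n) ⟩
    4 ^ h * (2 ^ n * 3 ^ (n * 3))   ≤⟨ *-monoʳ-≤ (4 ^ h) (2^m*3^3m≤4^3m n) ⟩
    4 ^ h * 4 ^ (n * 3)             ≡⟨ sym (^-distribˡ-+-* 4 h (n * 3)) ⟩
    4 ^ (h + n * 3)                 ≤⟨ ≤-trans (≤-reflexive (sym (*-identityʳ _))) (*-monoʳ-≤ (4 ^ (h + n * 3)) 1≤Δ) ⟩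
    4 ^ (h + n * 3) * Δ             ∎
    where
    open ≤-Reasoning
    e : ∀ a b c → a * b * c ≡ a * (c * b)
    e = solve-∀

  -- Chosen so that 2^m = 2^`levelConstant` · 2^t · 4^t, where 2^t comes from `hyp` and the other
  -- two factors from `large`.
  m : ℕ
  m = levelConstant + (t + (t + t))

  enough-m : 3 ^ (h + m * 3) * n ≤ 4 ^ (h + m * 3) * Δ
  enough-m = *-cancelʳ-≤ _ _ (suc l) (begin
    3 ^ (h + m * 3) * n * suc l      ≡⟨ cong (λ z → z * n * suc l) (^-distribˡ-+-* 3 h (m * 3)) ⟩
    A * B * n * suc l                ≡⟨ e₁ A B n (suc l) ⟩
    A * B * (n * suc l)              ≤⟨ *-monoʳ-≤ (A * B) hyp ⟩
    A * B * (2 ^ t * Δ * N)          ≡⟨ e₂ A B (2 ^ t) Δ N ⟩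
    B * (2 ^ t * Δ) * (A * N)        ≤⟨ *-monoʳ-≤ (B * (2 ^ t * Δ)) large ⟩
    B * (2 ^ t * Δ) * (2 ^ levelConstant * (suc l * 4 ^ h * 4 ^ t))
                                     ≡⟨ e₃ B (2 ^ t) Δ (2 ^ levelConstant) (suc l) (4 ^ h) (4 ^ t) ⟩
    2 ^ levelConstant * (2 ^ t * 4 ^ t) * B * (4 ^ h * Δ * suc l)
                                     ≡⟨ cong (λ z → z * B * (4 ^ h * Δ * suc l)) powers ⟩
    2 ^ m * B * (4 ^ h * Δ * suc l)  ≤⟨ *-monoˡ-≤ (4 ^ h * Δ * suc l) (2^m*3^3m≤4^3m m) ⟩
    4 ^ (m * 3) * (4 ^ h * Δ * suc l) ≡⟨ e₄ (4 ^ (m * 3)) (4 ^ h) Δ (suc l) ⟩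
    4 ^ h * 4 ^ (m * 3) * Δ * suc l  ≡⟨ cong (λ z → z * Δ * suc l) (sym (^-distribˡ-+-* 4 h (m * 3))) ⟩
    4 ^ (h + m * 3) * Δ * suc l      ∎)
    where
    open ≤-Reasoning
    A = 3 ^ h
    B = 3 ^ (m * 3)
    powers : 2 ^ levelConstant * (2 ^ t * 4 ^ t) ≡ 2 ^ m
    powers = sym (trans (^-distribˡ-+-* 2 levelConstant (t + (t + t))) (cong (2 ^ levelConstant *_)
      (trans (^-distribˡ-+-* 2 t (t + t)) (cong (2 ^ t *_) (trans (^-distribˡ-+-* 2 t t) (2^t*2^t≡4^t t))))))
    e₁ : ∀ a b n l → a * b * n * l ≡ a * b * (n * l)
    e₁ = solve-∀
    e₂ : ∀ a b p d m → a * b * (p * d * m) ≡ b * (p * d) * (a * m)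
    e₂ = solve-∀
    e₃ : ∀ b p d k l a f → b * (p * d) * (k * (l * a * f)) ≡ k * (p * f) * b * (a * d * l)
    e₃ = solve-∀
    e₄ : ∀ g a d l → g * (a * d * l) ≡ a * g * d * l
    e₄ = solve-∀

  -- The cap at n keeps the levels within the fuel when t is large; 3 n exponents beyond h always
  -- suffice, as (4/3)^(3 n) ≥ 2^n > n.
  j : ℕ
  j = (m ⊓ n) * 3

  enough : 3 ^ (h + j) * n ≤ 4 ^ (h + j) * Δ
  enough with ⊓-sel m n
  ... | inj₁ e rewrite e = enough-m
  ... | inj₂ e rewrite e = enough-n

  fuel : (h + j) * 2 ≤ 10 * n + 10
  fuel = begin
    (h + j) * 2        ≡⟨ *-distribʳ-+ 2 h j ⟩
    h * 2 + j * 2      ≤⟨ +-mono-≤ small (*-monoˡ-≤ 2 (*-monoˡ-≤ 3 (m⊓n≤n m n))) ⟩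
    n + n * 3 * 2      ≡⟨ e n ⟩
    7 * n              ≤⟨ *-monoˡ-≤ n (m≤m+n 7 3) ⟩
    10 * n             ≤⟨ m≤m+n (10 * n) 10 ⟩
    10 * n + 10        ∎
    where
    open ≤-Reasoning
    e : ∀ n → n + n * 3 * 2 ≡ 7 * n
    e = solve-∀

  cost-at : ℕ → ℕ
  cost-at c = if c <ᵇ h then lowCost σ Δ Λ c else midCost Δ

  cost-total : sumFrom cost-at 0 (h + j) + 4 * (2 + 6 * Δ) ≤ totalConstant * Δ * suc t
  cost-total = begin
    sumFrom cost-at 0 (h + j) + 4 * (2 + 6 * Δ)
      ≡⟨ cong (_+ 4 * (2 + 6 * Δ)) (trans (sumFrom-+ cost-at 0 h j) (cong₂ _+_ lows mids)) ⟩
    sumFrom (lowCost σ Δ Λ) 0 h + j * midCost Δ + 4 * (2 + 6 * Δ)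
      ≤⟨ +-mono-≤ (+-mono-≤ cost (*-monoˡ-≤ (midCost Δ) j≤)) (*-monoʳ-≤ 4 (+-monoˡ-≤ (6 * Δ) (*-monoʳ-≤ 2 1≤Δ))) ⟩
    a * Δ + (b * suc t) * (windowConstant * 4 * Δ + evenConstant * Δ) + 4 * (2 * Δ + 6 * Δ)
      ≡⟨ e₁ a b t windowConstant evenConstant Δ ⟩
    a * Δ * 1 + b * (windowConstant * 4 + evenConstant) * Δ * suc t + 32 * Δ * 1
      ≤⟨ +-mono-≤ (+-monoˡ-≤ _ (*-monoʳ-≤ (a * Δ) (s≤s z≤n))) (*-monoʳ-≤ (32 * Δ) (s≤s z≤n)) ⟩
    a * Δ * suc t + b * (windowConstant * 4 + evenConstant) * Δ * suc t + 32 * Δ * suc t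
      ≡⟨ e₂ a (b * (windowConstant * 4 + evenConstant)) 32 Δ (suc t) ⟩
    (a + b * (windowConstant * 4 + evenConstant) + 32) * Δ * suc t ∎
    where
    open ≤-Reasoning
    a b : ℕ
    a = lowConstant
    b = levelConstant * 3 + 9
    lows : sumFrom cost-at 0 h ≡ sumFrom (lowCost σ Δ Λ) 0 h
    lows = sumFrom-cong cost-at (lowCost σ Δ Λ) 0 h
      (λ k _ lt → cong (λ d → if d then lowCost σ Δ Λ k else midCost Δ) (<ᵇ-complete lt))
    mids : sumFrom cost-at h j ≡ j * midCost Δ
    mids = trans (sumFrom-cong cost-at (λ _ → midCost Δ) h j
      (λ k ge _ → cong (λ d → if d then lowCost σ Δ Λ k else midCost Δ) (≮⇒<ᵇ-false (≤⇒≯ ge)))) (sumFrom-const (midCost Δ) h j)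
    j≤ : j ≤ b * suc t
    j≤ = ≤-trans (*-monoˡ-≤ 3 (m⊓n≤m m n)) (≤-trans (≤-trans (≤-reflexive (e₃ levelConstant t)) (m≤m+n _ (levelConstant * 3 * t + 9)))
      (≤-reflexive (e₄ levelConstant t)))
      where
      e₃ : ∀ k t → (k + (t + (t + t))) * 3 ≡ k * 3 + 9 * t
      e₃ = solve-∀
      e₄ : ∀ k t → k * 3 + 9 * t + (k * 3 * t + 9) ≡ (k * 3 + 9) * suc t
      e₄ = solve-∀
    e₁ : ∀ a b t w g d → a * d + (b * suc t) * (w * 4 * d + g * d) + 4 * (2 * d + 6 * d) ≡
      a * d * 1 + b * (w * 4 + g) * d * suc t + 32 * d * 1
    e₁ = solve-∀
    e₂ : ∀ a x y d s → a * d * s + x * d * s + y * d * s ≡ (a + x + y) * d * s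
    e₂ = solve-∀

-- Assembly, with alphabets of one letter and strings of length at most one

final-length : ∀ {s K α T} Δ → Good s K α T → 3 ^ K * length s ≤ 4 ^ K * Δ → length T ≤ 2 + 6 * Δ
final-length {s} {K} {α} {T} Δ good h = *-cancelˡ-≤ (4 ^ K) ⦃ m^n≢0 4 K ⦄ (begin
  4 ^ K * length T                        ≤⟨ density [] T [] (sym (++-identityʳ T)) ⟩
  2 * 4 ^ K + 6 * 3 ^ K * expLens T       ≡⟨ cong (λ l → 2 * 4 ^ K + 6 * 3 ^ K * l) (trans (sym (length-flats T)) (cong length flat-eq)) ⟩
  2 * 4 ^ K + 6 * 3 ^ K * length s        ≡⟨ cong (2 * 4 ^ K +_) (*-assoc 6 (3 ^ K) (length s)) ⟩
  2 * 4 ^ K + 6 * (3 ^ K * length s)      ≤⟨ +-monoʳ-≤ (2 * 4 ^ K) (*-monoʳ-≤ 6 h) ⟩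
  2 * 4 ^ K + 6 * (4 ^ K * Δ)             ≡⟨ e (4 ^ K) Δ ⟩
  4 ^ K * (2 + 6 * Δ)                     ∎)
  where
  open Good good
  open ≤-Reasoning
  e : ∀ a d → 2 * a + 6 * (a * d) ≡ a * (2 + 6 * d)
  e = solve-∀

term-accounted : ∀ s → Accounted (map term s) (map term s) []
term-accounted s x∈ with ∈-map⁻ term x∈
... | _ , _ , refl = inj₂ (inj₁ refl)

-- The doubled exponent makes up for the base σ + 1 in `length-strings`.
suc≤2^[2*] : ∀ σ l → σ ≤ 2 ^ suc l → suc σ ≤ 2 ^ (2 * suc l)
suc≤2^[2*] σ l h = begin
  suc σ                       ≤⟨ s≤s h ⟩
  1 + 2 ^ suc l               ≤⟨ +-mono-≤ (m^n>0 2 (suc l)) (≤-reflexive (sym (+-identityʳ _))) ⟩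
  2 * 2 ^ suc l               ≤⟨ *-monoˡ-≤ (2 ^ suc l) (*-monoʳ-≤ 2 (m^n>0 2 l)) ⟩
  2 ^ suc l * 2 ^ suc l       ≡⟨ sym (^-distribˡ-+-* 2 (suc l) (suc l)) ⟩
  2 ^ (suc l + suc l)         ≡⟨ cong (λ z → 2 ^ (suc l + z)) (sym (+-identityʳ (suc l))) ⟩
  2 ^ (2 * suc l)             ∎
  where open ≤-Reasoning

⌈log₂n⌉≤n : ∀ n → ⌈log₂ n ⌉ ≤ n
⌈log₂n⌉≤n n = ≤-trans (⌈log₂⌉-mono-≤ {n} {2 ^ n} (<⇒≤ (n<2^n n))) (≤-reflexive (⌈log₂2^n⌉≡n n))

several-letters : ∀ s σ Δ t l → All (_< σ) s → 2 ≤ length s → 1 ≤ Δ →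
  (∀ L → 1 ≤ L → Representatives s L (Δ * L)) → ⌈log₂ σ ⌉ ≡ suc l →
  length s * suc l ≤ 2 ^ t * Δ * ⌈log₂ length s ⌉ →
  expSize (10 * length s + 10) 1 (map term s) (map term s) ≤ℚ fromℕ (totalConstant * Δ * suc t)
several-letters s σ Δ t l letters 2≤n 1≤Δ reps eσ hyp = ℚₚ.≤-trans
  (expSize-bound (h + j) 0 (10 * length s + 10) (map term s) (map term s) [] refl fuel (good-terms s) id (term-accounted s))
  (fromℕ-mono (sumFrom cost-at 0 (h + j) + 4 * (2 + 6 * Δ)) (totalConstant * Δ * suc t) cost-total)
  where
  n N : ℕ
  n = length s
  N = ⌈log₂ length s ⌉
  1≤N : 1 ≤ N
  1≤N = ⌈log₂⌉-mono-≤ {2} {n} 2≤n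
  open Thresholds n t σ Δ N l 1≤Δ 1≤N (⌈log₂n⌉≤n n) (2^⌈log₂n⌉≤2n n 2≤n)
    (suc≤2^[2*] σ l (≤-trans (n≤2^⌈log₂n⌉ σ) (≤-reflexive (cong (2 ^_) eσ)))) hyp
  open Counts s σ letters Δ 1≤Δ reps
  budget : ∀ c → Budget s c (cost-at c)
  budget c with c <ᵇ h in e
  ... | true = low-budget Λ c (*-cancelˡ-≤ (3 ^ c) ⦃ m^n≢0 3 c ⦄ (≤-trans (3^c*lev≤ c) (low c (<ᵇ-sound c h e))))
  ... | false = mid-budget c
  open Process s cost-at (h + j) (2 + 6 * Δ) (s≤s z≤n) (λ c _ → budget c)
    (λ good → final-length Δ good enough)

one-run : ∀ p x xs → inA 1 x ≡ true → All (_≡ x) xs → blks (oddRule 1) p (x ∷ xs) ≡ (x ∷ xs) ∷ []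
one-run p x [] i [] = refl
one-run p x (.x ∷ xs) i (refl ∷ h)
  rewrite one-run (just x) x xs i h | i | symEq-refl x = refl

-- For σ = 1 there is no positive log σ to divide by in the choice of Λ. But the first level turns
-- the string into a single run, of production size 2.
one-letter : ∀ s f → All (_< 1) s → 2 ≤ length s →
  expSize (suc f) 1 (map term s) (map term s) ≤ℚ fromℕ 2
one-letter (_ ∷ []) f _ (s≤s ())
one-letter (.0 ∷ .0 ∷ s) f (s≤s z≤n ∷ s≤s z≤n ∷ zeros) _ = subst (_≤ℚ fromℕ 2)
  (sym (trans (expSize-odd f 0 T T refl) (trans (cong (λ T' → expSize f 2 T' (T' ++ T)) stepped)
    (expSize-small f 2 (run ∷ []) (run ∷ T) refl))))
  (fromℕ-mono (grammarSize (run ∷ T)) 2 (grammarSize-≤ (run ∷ T) (run ∷ []) covered))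
  where
  T : List Sym
  T = map term (0 ∷ 0 ∷ s)
  run : Sym
  run = runSym T
  stepped : oddStep 1 T ≡ run ∷ []
  stepped = trans (oddStep-blks 1 T) (cong (map runSym)
    (one-run nothing (term 0) (term 0 ∷ map term s) refl (refl ∷ Allₚ.map⁺ (All.map (λ { (s≤s z≤n) → refl }) zeros))))
  covered : ∀ {x} → x ∈ run ∷ T → x ∈ run ∷ [] ⊎ prodSize x ≡ 0
  covered (here e) = inj₁ (here e)
  covered (there x∈) with ∈-map⁻ term x∈
  ... | _ , _ , refl = inj₂ refl

any-letters : ∀ s σ Δ t → All (_< σ) s → 2 ≤ length s → 1 ≤ Δ →
  (∀ L → 1 ≤ L → Representatives s L (Δ * L)) →
  length s * ⌈log₂ σ ⌉ ≤ 2 ^ t * Δ * ⌈log₂ length s ⌉ →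
  expSize (10 * length s + 10) 1 (map term s) (map term s) ≤ℚ fromℕ (totalConstant * Δ * suc t)
any-letters (_ ∷ _) zero Δ t (() ∷ _) 2≤n 1≤Δ reps hyp
any-letters s@(_ ∷ _) (suc zero) Δ t letters 2≤n 1≤Δ reps hyp =
  ℚₚ.≤-trans (one-letter s _ letters 2≤n) (fromℕ-mono 2 (totalConstant * Δ * suc t)
    (*-mono-≤ {2} {totalConstant * Δ} {1} {suc t} (*-mono-≤ {2} {totalConstant} {1} {Δ} (≤-trans (s≤s (s≤s z≤n))
      (m≤n+m 32 (lowConstant + (levelConstant * 3 + 9) * (windowConstant * 4 + evenConstant)))) 1≤Δ) (s≤s z≤n)))
any-letters s σ@(suc (suc _)) Δ t letters 2≤n 1≤Δ reps hyp with ⌈log₂ σ ⌉ in e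
... | zero = contradiction (⌈log₂⌉-mono-≤ {2} {σ} (s≤s (s≤s z≤n))) (<⇒≱ (s≤s (≤-reflexive e)))
... | suc l = several-letters s σ Δ t l letters 2≤n 1≤Δ reps e hyp

scale-δ : ∀ A Δ t δ → fromℕ Δ ≤ℚ fromℕ 2 *ℚ δ →
  fromℕ (A * Δ * suc t) ≤ℚ (fromℕ (A * 2) *ℚ δ) *ℚ fromℕ (suc t)
scale-δ A Δ t δ h = begin
  fromℕ (A * Δ * suc t) ≡⟨ trans (fromℕ-* (A * Δ) (suc t)) (cong (_*ℚ fromℕ (suc t)) (fromℕ-* A Δ)) ⟩
  (fromℕ A *ℚ fromℕ Δ) *ℚ fromℕ (suc t)
    ≤⟨ ℚₚ.*-monoʳ-≤-nonNeg (fromℕ (suc t)) ⦃ fromℕ-nonNegative (suc t) ⦄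
         (ℚₚ.*-monoˡ-≤-nonNeg (fromℕ A) ⦃ fromℕ-nonNegative A ⦄ h) ⟩
  (fromℕ A *ℚ (fromℕ 2 *ℚ δ)) *ℚ fromℕ (suc t)
    ≡⟨ cong (_*ℚ fromℕ (suc t)) (trans (sym (ℚₚ.*-assoc (fromℕ A) (fromℕ 2) δ)) (cong (_*ℚ δ) (sym (fromℕ-* A 2)))) ⟩
  (fromℕ (A * 2) *ℚ δ) *ℚ fromℕ (suc t) ∎
  where open ℚₚ.≤-Reasoning

double : ∀ δ → fromℕ 2 *ℚ δ ≡ δ +ℚ δ
double δ = trans (cong (_*ℚ δ) (fromℕ-+ 1 1)) (trans (ℚₚ.*-distribʳ-+ δ (fromℕ 1) (fromℕ 1))
  (cong₂ _+ℚ_ (ℚₚ.*-identityˡ δ) (ℚₚ.*-identityˡ δ)))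

long-string : ∀ s σ t → All (_< σ) s → 2 ≤ length s → let open Measure s in
  fromℕ (length s * ⌈log₂ σ ⌉) ≤ℚ (fromℕ (2 ^ t) *ℚ maximumℚ ratio (length s)) *ℚ fromℕ ⌈log₂ length s ⌉ →
  expSize (10 * length s + 10) 1 (map term s) (map term s)
    ≤ℚ (fromℕ (totalConstant * 2) *ℚ maximumℚ ratio (length s)) *ℚ fromℕ (suc t)
long-string s σ t letters 2≤n hyp = ℚₚ.≤-trans
  (any-letters s σ Δ t letters 2≤n 1≤Δ (representatives s Δ dk≤) hypℕ)
  (scale-δ totalConstant Δ t D Δ≤2D)
  where
  open Measure s
  n Δ : ℕ
  n = length s
  Δ = maximum ceiling n
  D : ℚ
  D = maximumℚ ratio n
  1≤n : 1 ≤ n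
  1≤n = ≤-trans (s≤s z≤n) 2≤n
  1≤Δ : 1 ≤ Δ
  1≤Δ = ≤-trans (fromℕ-cancel-≤ {1} {ceiling 0} (ℚₚ.≤-trans (1≤ratio 1≤n) (ratio≤ceiling 0))) (maximum-≥ ceiling n 1≤n)
  dk≤ : ∀ i → i < n → dk (suc i) s ≤ Δ * suc i
  dk≤ i i<n = ≤-trans (ceilDiv-≥ (dk (suc i) s) i) (*-monoˡ-≤ (suc i) (maximum-≥ ceiling n i<n))
  ratio0≤D : ratio 0 ≤ℚ D
  ratio0≤D = first n 1≤n
    where
    first : ∀ m → 1 ≤ m → ratio 0 ≤ℚ maximumℚ ratio m
    first (suc m) _ = ℚₚ.p≤p⊔q (ratio 0) _
  Δ≤2D : fromℕ Δ ≤ℚ fromℕ 2 *ℚ D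
  Δ≤2D = ℚₚ.≤-trans (maximum-≤ ratio ceiling n ceiling≤ratio+1)
    (ℚₚ.≤-trans (ℚₚ.+-monoʳ-≤ D (ℚₚ.≤-trans (1≤ratio 1≤n) ratio0≤D)) (ℚₚ.≤-reflexive (sym (double D))))
  hypℕ : n * ⌈log₂ σ ⌉ ≤ 2 ^ t * Δ * ⌈log₂ n ⌉
  hypℕ = fromℕ-cancel-≤ (ℚₚ.≤-trans hyp (ℚₚ.≤-trans
    (ℚₚ.*-monoʳ-≤-nonNeg (fromℕ ⌈log₂ n ⌉) ⦃ fromℕ-nonNegative ⌈log₂ n ⌉ ⦄
      (ℚₚ.*-monoˡ-≤-nonNeg (fromℕ (2 ^ t)) ⦃ fromℕ-nonNegative (2 ^ t) ⦄ (maximumℚ-≤ ratio ceiling n ratio≤ceiling)))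
    (ℚₚ.≤-reflexive (sym (trans (fromℕ-* (2 ^ t * Δ) ⌈log₂ n ⌉) (cong (_*ℚ fromℕ ⌈log₂ n ⌉) (fromℕ-* (2 ^ t) Δ)))))))

short-string : ∀ s f t D A → length s < 2 → 0ℚ ≤ℚ D →
  expSize f 1 (map term s) (map term s) ≤ℚ (fromℕ A *ℚ D) *ℚ fromℕ (suc t)
short-string s f t D A lt 0≤D = subst (_≤ℚ (fromℕ A *ℚ D) *ℚ fromℕ (suc t))
  (sym (trans (expSize-small f 1 (map term s) (map term s) (tiny s lt)) (cong fromℕ (free s lt))))
  (ℚₚ.≤-trans (ℚₚ.≤-reflexive (sym (trans (cong (_*ℚ fromℕ (suc t)) (ℚₚ.*-zeroʳ (fromℕ A))) (ℚₚ.*-zeroˡ (fromℕ (suc t))))))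
    (ℚₚ.*-monoʳ-≤-nonNeg (fromℕ (suc t)) ⦃ fromℕ-nonNegative (suc t) ⦄
      (ℚₚ.*-monoˡ-≤-nonNeg (fromℕ A) ⦃ fromℕ-nonNegative A ⦄ 0≤D)))
  where
  tiny : ∀ s → length s < 2 → (2 ≤ᵇ length (map term s)) ≡ false
  tiny [] _ = refl
  tiny (_ ∷ []) _ = refl
  tiny (_ ∷ _ ∷ _) (s≤s (s≤s ()))
  free : ∀ s → length s < 2 → grammarSize (map term s) ≡ 0
  free [] _ = refl
  free (_ ∷ []) _ = refl
  free (_ ∷ _ ∷ _) (s≤s (s≤s ()))

-- The variable t stands for the logarithm: for n ≥ 2 and σ ≥ 2 the least t that meets the premise
-- is log₂ (n log σ / (δ log n)) rounded up, or 0 if this is negative, where log n and log σ are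
-- rounded up as well. The summand 1 in suc t keeps the bound meaningful for ratios near 1.
theorem4 : ∃ λ (C : ℕ) → ∀ (σ n : ℕ) (S : Vec (Fin σ) n) (t : ℕ) →
    fromℕ (n * ⌈log₂ σ ⌉) ≤ℚ (fromℕ (2 ^ t) *ℚ δ S) *ℚ fromℕ ⌈log₂ n ⌉ →
    expectedRLSLPSize S ≤ℚ (fromℕ C *ℚ δ S) *ℚ fromℕ (suc t)
theorem4 = totalConstant * 2 , λ σ n S t hyp → bound σ n S t hyp
  where
  bound : ∀ σ n (S : Vec (Fin σ) n) t →
    fromℕ (n * ⌈log₂ σ ⌉) ≤ℚ (fromℕ (2 ^ t) *ℚ δ S) *ℚ fromℕ ⌈log₂ n ⌉ →
    expectedRLSLPSize S ≤ℚ (fromℕ (totalConstant * 2) *ℚ δ S) *ℚ fromℕ (suc t)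
  bound σ n S t hyp = subst (λ z → expSize (10 * n + 10) 1 z z ≤ℚ (fromℕ (totalConstant * 2) *ℚ D n) *ℚ fromℕ (suc t))
    (sym (map-∘ (toList S))) (by-length (2 ≤? length s))
    where
    s : List ℕ
    s = map toℕ (toList S)
    D : ℕ → ℚ
    D = maximumℚ (Measure.ratio s)
    n≡ : length s ≡ n
    n≡ = trans (length-map toℕ (toList S)) (length-toList S)
    letters : All (_< σ) s
    letters = Allₚ.map⁺ (All.tabulate λ {a} _ → toℕ<n a)
    Goal : ℕ → Set
    Goal m = expSize (10 * m + 10) 1 (map term s) (map term s) ≤ℚ (fromℕ (totalConstant * 2) *ℚ D m) *ℚ fromℕ (suc t)
    by-length : Dec (2 ≤ length s) → Goal n
    by-length (yes 2≤n) = subst Goal n≡ (long-string s σ t letters 2≤n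
      (subst (λ m → fromℕ (m * ⌈log₂ σ ⌉) ≤ℚ (fromℕ (2 ^ t) *ℚ D m) *ℚ fromℕ ⌈log₂ m ⌉) (sym n≡) hyp))
    by-length (no small) = short-string s (10 * n + 10) t (D n) (totalConstant * 2) (≰⇒> small) (maximumℚ-≥0 (Measure.ratio s) n)
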